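{- Let $f$ be either the function $f(x)=e^{\lambda x}-1$ for some positive real number $\lambda$, or the function $f(x)=x^\beta$, $x\geq 0$, for some real number $\beta>2$. Then $\Sigma_f$ is uniquely maximized by the quasi-star graph $QS(n,m)$ over $\mathbb{G}(n,m)$ for any two integers $m$ and $n$ such that $0\le m\le n-1$.
   Context: Graphs are finite and simple, with vertex set $\{1,\dots,n\}$; $\mathbb{G}(n,m)$ is the set of graphs with $n$ vertices and $m$ edges. For a graph with degree sequence $d=(d_1,\dots,d_n)$, $\Sigma_f(d)=\sum_{i=1}^n f(d_i)$. $\Sigma_f$ is uniquely maximized by $G\in\mathbb{G}(n,m)$ over $\mathbb{G}(n,m)$ if the degree sequence of $G$ attains the maximum of $\Sigma_f$ among all degree sequences of graphs in $\mathbb{G}(n,m)$ and, up to isomorphism, $G$ is the only graph in $\mathbb{G}(n,m)$ whose degree sequence does so. For $m\le n-1$, $QS(n,m)$ is isomorphic to the star $K_{1,m}$ together with $n-m-1$ isolated vertices. -}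

module Defs where

open import Data.Bool.Base using (Bool; false; _∧_; _∨_)
open import Data.Bool.Properties using (∨-comm)
open import Data.Fin.Base using (Fin; toℕ)
open import Data.Fin.Subset using (Subset; ∣_∣)
open import Data.Integer.Base as ℤ using (+_)
import Data.Integer.Properties as ℤ
open import Data.Nat.Base as ℕ using (ℕ; zero; suc; z≤n; s≤s; s≤s⁻¹)
import Data.Nat.Properties as ℕ
open import Data.Product.Base using (_×_; _,_; ∃; proj₁; proj₂)
open import Data.Rational.Base as ℚ using (ℚ; 0ℚ; 1ℚ; _/_)
import Data.Rational.Properties as ℚ
import Data.Rational.Solver as ℚ
import Data.Rational.Unnormalised.Base as ℚᵘ
import Data.Rational.Unnormalised.Properties as ℚᵘ
open import Data.Sum.Base using (_⊎_; inj₁; inj₂)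
open import Data.Vec.Base using (tabulate)
import Data.Vec.Functional as Vector
open import Function.Bundles using (_↔_; Inverse)
open import Relation.Binary.PropositionalEquality

∑<ℚ : ℕ → (ℕ → ℚ) → ℚ
∑<ℚ zero    f = 0ℚ
∑<ℚ (suc n) f = ∑<ℚ n f ℚ.+ f n

ℕ→ℚ : ℕ → ℚ
ℕ→ℚ n = + n / 1

1/suc : ℕ → ℚ
1/suc k = + 1 / suc k

-- x ^ k / k !
expTerm : ℚ → ℕ → ℚ
expTerm x zero    = 1ℚ
expTerm x (suc k) = expTerm x k ℚ.* (x ℚ.* 1/suc k)

expSum : ℚ → ℕ → ℚ
expSum x n = ∑<ℚ n (expTerm x)

-- 1/(a+1) + 1/(a+2) + … + 1/(a+c)
harmonicBlock : ℕ → ℕ → ℚ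
harmonicBlock a c = ∑<ℚ c (λ i → 1/suc (a ℕ.+ i))

-- The right Riemann sum of ∫₁^{1+p} dt/t with step 1/(1+k):
-- its terms 1/(1+k) · 1/(1 + i/(1+k)), 1 ≤ i ≤ p(1+k), are the 1/(1+k+i).
logSum : ℕ → ℕ → ℚ
logSum p k = harmonicBlock (suc k) (p ℕ.* suc k)

IsCauchy : (ℕ → ℚ) → Set
IsCauchy u = ∀ ε → 0ℚ ℚ.< ε →
  ∃ λ N → ∀ m n → N ℕ.≤ m → N ℕ.≤ n → ℚ.∣ u m ℚ.- u n ∣ ℚ.≤ ε

module CauchyLemmas where

  open ℚ.≤-Reasoning
  open ℚ.+-*-Solver

  open import Data.Rational.Base using (_+_; _*_; _-_; -_; _≤_; _<_)
    renaming (∣_∣ to abs)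

  ≤-gap : ∀ {p q} d → 0ℚ ≤ d → p + d ≡ q → p ≤ q
  ≤-gap {p} d 0≤d refl = begin
    p       ≡⟨ ℚ.+-identityʳ p ⟨
    p + 0ℚ  ≤⟨ ℚ.+-monoʳ-≤ p 0≤d ⟩
    p + d   ∎

  gap : ∀ {p q} → p ≤ q → 0ℚ ≤ q - p
  gap {p} {q} p≤q = begin
    0ℚ     ≡⟨ ℚ.+-inverseʳ p ⟨
    p - p  ≤⟨ ℚ.+-monoˡ-≤ (- p) p≤q ⟩
    q - p  ∎

  abs-≤ : ∀ {p ε} → p ≤ ε → - p ≤ ε → abs p ≤ ε
  abs-≤ {p} p≤ε -p≤ε with ℚ.∣p∣≡p∨∣p∣≡-p p
  ... | inj₁ eq = subst (_≤ _) (sym eq) p≤ε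
  ... | inj₂ eq = subst (_≤ _) (sym eq) -p≤ε

  p≤∣p∣ : ∀ p → p ≤ abs p
  p≤∣p∣ p with ℚ.≤-total 0ℚ p
  ... | inj₁ 0≤p = ℚ.≤-reflexive (sym (ℚ.0≤p⇒∣p∣≡p 0≤p))
  ... | inj₂ p≤0 = ℚ.≤-trans p≤0 (ℚ.0≤∣p∣ p)

  abs-sym : ∀ p q → abs (p - q) ≡ abs (q - p)
  abs-sym p q = trans (sym (ℚ.∣-p∣≡∣p∣ (p - q)))
    (cong abs (solve 2 (λ a b → :- (a :- b) := b :- a) refl p q))

  triangle : ∀ p q s → abs (p - s) ≤ abs (p - q) + abs (q - s)
  triangle p q s = begin
    abs (p - s)                ≡⟨ cong abs (solve 3 (λ a b c → a :- c := (a :- b) :+ (b :- c)) refl p q s) ⟩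
    abs ((p - q) + (q - s))    ≤⟨ ℚ.∣p+q∣≤∣p∣+∣q∣ (p - q) (q - s) ⟩
    abs (p - q) + abs (q - s)  ∎

  *-mono : ∀ {a b c d} → 0ℚ ≤ a → 0ℚ ≤ d → a ≤ b → c ≤ d → a * c ≤ b * d
  *-mono {a} {b} {c} {d} 0≤a 0≤d a≤b c≤d = ℚ.≤-trans
    (ℚ.*-monoˡ-≤-nonNeg a {{ℚ.nonNegative 0≤a}} c≤d)
    (ℚ.*-monoʳ-≤-nonNeg d {{ℚ.nonNegative 0≤d}} a≤b)

  *-nonNeg : ∀ {a b} → 0ℚ ≤ a → 0ℚ ≤ b → 0ℚ ≤ a * b
  *-nonNeg {a} {b} 0≤a 0≤b =
    subst (_≤ a * b) (ℚ.*-zeroˡ 0ℚ) (*-mono ℚ.≤-refl 0≤b 0≤a 0≤b)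

  *-pos : ∀ {a b} → 0ℚ < a → 0ℚ < b → 0ℚ < a * b
  *-pos {a} {b} 0<a 0<b = ℚ.positive⁻¹ (a * b)
    {{ℚ.pos*pos⇒pos a {{ℚ.positive 0<a}} b {{ℚ.positive 0<b}}}}

  ℕ→ℚ-+ : ∀ m n → ℕ→ℚ (m ℕ.+ n) ≡ ℕ→ℚ m + ℕ→ℚ n
  ℕ→ℚ-+ m n = ℚ.toℚᵘ-injective (ℚᵘ.≃-trans (ℚ.toℚᵘ-fromℚᵘ (ℚᵘ.mkℚᵘ (+ (m ℕ.+ n)) 0))
    (ℚᵘ.≃-trans (ℚᵘ.*≡* (cong (ℤ._* + 1)
        (cong₂ ℤ._+_ (sym (ℤ.*-identityʳ (+ m))) (sym (ℤ.*-identityʳ (+ n))))))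
      (ℚᵘ.≃-sym (ℚᵘ.≃-trans (ℚ.toℚᵘ-homo-+ (ℕ→ℚ m) (ℕ→ℚ n))
        (ℚᵘ.+-cong (ℚ.toℚᵘ-fromℚᵘ (ℚᵘ.mkℚᵘ (+ m) 0)) (ℚ.toℚᵘ-fromℚᵘ (ℚᵘ.mkℚᵘ (+ n) 0)))))))

  ℕ→ℚ-suc : ∀ n → ℕ→ℚ (suc n) ≡ 1ℚ + ℕ→ℚ n
  ℕ→ℚ-suc = ℕ→ℚ-+ 1

  ℕ→ℚ-* : ∀ m n → ℕ→ℚ (m ℕ.* n) ≡ ℕ→ℚ m * ℕ→ℚ n
  ℕ→ℚ-* zero    n = sym (ℚ.*-zeroˡ (ℕ→ℚ n))
  ℕ→ℚ-* (suc m) n = begin-equality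
    ℕ→ℚ (n ℕ.+ m ℕ.* n)      ≡⟨ ℕ→ℚ-+ n (m ℕ.* n) ⟩
    ℕ→ℚ n + ℕ→ℚ (m ℕ.* n)    ≡⟨ cong (_+_ (ℕ→ℚ n)) (ℕ→ℚ-* m n) ⟩
    ℕ→ℚ n + ℕ→ℚ m * ℕ→ℚ n    ≡⟨ solve 2 (λ a b → b :+ a :* b := (con 1ℚ :+ a) :* b) refl (ℕ→ℚ m) (ℕ→ℚ n) ⟩
    (1ℚ + ℕ→ℚ m) * ℕ→ℚ n     ≡⟨ cong (_* ℕ→ℚ n) (ℕ→ℚ-suc m) ⟨
    ℕ→ℚ (suc m) * ℕ→ℚ n      ∎

  0≤ℕ→ℚ : ∀ n → 0ℚ ≤ ℕ→ℚ n
  0≤ℕ→ℚ n = ℚ.nonNegative⁻¹ (ℕ→ℚ n) {{ℚ.normalize-nonNeg n 1}}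

  0<ℕ→ℚsuc : ∀ n → 0ℚ < ℕ→ℚ (suc n)
  0<ℕ→ℚsuc n = ℚ.positive⁻¹ (ℕ→ℚ (suc n)) {{ℚ.normalize-pos (suc n) 1}}

  ℕ→ℚ-mono : ∀ {m n} → m ℕ.≤ n → ℕ→ℚ m ≤ ℕ→ℚ n
  ℕ→ℚ-mono {m} {n} m≤n = ≤-gap (ℕ→ℚ (n ℕ.∸ m)) (0≤ℕ→ℚ (n ℕ.∸ m))
    (trans (sym (ℕ→ℚ-+ m (n ℕ.∸ m))) (cong ℕ→ℚ (ℕ.m+[n∸m]≡n m≤n)))

  0<1/suc : ∀ k → 0ℚ < 1/suc k
  0<1/suc k = ℚ.positive⁻¹ (1/suc k) {{ℚ.normalize-pos 1 (suc k)}}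

  0≤1/suc : ∀ k → 0ℚ ≤ 1/suc k
  0≤1/suc k = ℚ.<⇒≤ (0<1/suc k)

  1/suc-inverse : ∀ k → 1/suc k * ℕ→ℚ (suc k) ≡ 1ℚ
  1/suc-inverse k = ℚ.toℚᵘ-injective (ℚᵘ.≃-trans (ℚ.toℚᵘ-homo-* (1/suc k) (ℕ→ℚ (suc k)))
    (ℚᵘ.≃-trans (ℚᵘ.*-cong (ℚ.toℚᵘ-fromℚᵘ (ℚᵘ.mkℚᵘ (+ 1) k)) (ℚ.toℚᵘ-fromℚᵘ (ℚᵘ.mkℚᵘ (+ suc k) 0)))
      (ℚᵘ.*≡* (trans (ℤ.*-identityʳ (+ 1 ℤ.* + suc k))
        (cong (λ z → + 1 ℤ.* + z) (sym (ℕ.*-identityʳ (suc k))))))))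

  1/suc-antimono : ∀ {m n} → m ℕ.≤ n → 1/suc n ≤ 1/suc m
  1/suc-antimono {m} {n} m≤n = ℚ.*-cancelʳ-≤-pos (ℕ→ℚ (suc m) * ℕ→ℚ (suc n))
    {{ℚ.positive (*-pos (0<ℕ→ℚsuc m) (0<ℕ→ℚsuc n))}} (begin
    1/suc n * (ℕ→ℚ (suc m) * ℕ→ℚ (suc n))  ≡⟨ solve 3 (λ a b c → a :* (b :* c) := b :* (a :* c)) refl (1/suc n) (ℕ→ℚ (suc m)) (ℕ→ℚ (suc n)) ⟩
    ℕ→ℚ (suc m) * (1/suc n * ℕ→ℚ (suc n))  ≡⟨ cong (ℕ→ℚ (suc m) *_) (1/suc-inverse n) ⟩
    ℕ→ℚ (suc m) * 1ℚ                       ≡⟨ ℚ.*-identityʳ (ℕ→ℚ (suc m)) ⟩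
    ℕ→ℚ (suc m)                            ≤⟨ ℕ→ℚ-mono (s≤s m≤n) ⟩
    ℕ→ℚ (suc n)                            ≡⟨ ℚ.*-identityˡ (ℕ→ℚ (suc n)) ⟨
    1ℚ * ℕ→ℚ (suc n)                       ≡⟨ cong (_* ℕ→ℚ (suc n)) (1/suc-inverse m) ⟨
    1/suc m * ℕ→ℚ (suc m) * ℕ→ℚ (suc n)    ≡⟨ ℚ.*-assoc (1/suc m) (ℕ→ℚ (suc m)) (ℕ→ℚ (suc n)) ⟩
    1/suc m * (ℕ→ℚ (suc m) * ℕ→ℚ (suc n))  ∎)

  archimedean : ∀ p → ∃ λ N → p ≤ ℕ→ℚ N
  archimedean p@(ℚ.mkℚ (+ n) d-1 _) = n , ℚ.toℚᵘ-cancel-≤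
    (ℚᵘ.≤-respʳ-≃ (ℚᵘ.≃-sym (ℚ.toℚᵘ-fromℚᵘ (ℚᵘ.mkℚᵘ (+ n) 0)))
      (ℚᵘ.*≤* (ℤ.*-monoˡ-≤-nonNeg (+ n) (ℤ.+≤+ (s≤s z≤n)))))
  archimedean p@(ℚ.mkℚ (ℤ.-[1+ n ]) d-1 _) = 0 , ℚ.<⇒≤ (ℚ.negative⁻¹ p)

  archimedean-* : ∀ c ε → 0ℚ < ε → ∃ λ N → c ≤ ℕ→ℚ N * ε
  archimedean-* c ε 0<ε = N , (begin
    c                  ≡⟨ ℚ.*-identityʳ c ⟨
    c * 1ℚ             ≡⟨ cong (c *_) (ℚ.*-inverseˡ ε) ⟨
    c * (ℚ.1/ ε * ε)   ≡⟨ ℚ.*-assoc c (ℚ.1/ ε) ε ⟨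
    c * ℚ.1/ ε * ε     ≤⟨ ℚ.*-monoʳ-≤-nonNeg ε {{ℚ.nonNegative (ℚ.<⇒≤ 0<ε)}} c/ε≤N ⟩
    ℕ→ℚ N * ε          ∎)
    where
      instance _ = ℚ.pos⇒nonZero ε {{ℚ.positive 0<ε}}
      N = proj₁ (archimedean (c * ℚ.1/ ε))
      c/ε≤N = proj₂ (archimedean (c * ℚ.1/ ε))

  IsNull : (ℕ → ℚ) → Set
  IsNull v = ∀ ε → 0ℚ < ε → ∃ λ N → ∀ n → N ℕ.≤ n → v n ≤ ε

  null-by-growth : ∀ {v} c K → (∀ n → K ℕ.≤ n → v n * ℕ→ℚ n ≤ c) → IsNull v
  null-by-growth {v} c K vn≤c ε 0<ε = suc N ℕ.⊔ K , bound
    where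
      N = proj₁ (archimedean-* c ε 0<ε)
      c≤Nε = proj₂ (archimedean-* c ε 0<ε)
      bound : ∀ n → suc N ℕ.⊔ K ℕ.≤ n → v n ≤ ε
      bound zero    le with () ← ℕ.m⊔n≤o⇒m≤o (suc N) K le
      bound (suc n) le = ℚ.*-cancelʳ-≤-pos (ℕ→ℚ (suc n)) {{ℚ.positive (0<ℕ→ℚsuc n)}} (begin
        v (suc n) * ℕ→ℚ (suc n)  ≤⟨ vn≤c (suc n) (ℕ.m⊔n≤o⇒n≤o (suc N) K le) ⟩
        c                        ≤⟨ c≤Nε ⟩
        ℕ→ℚ N * ε                ≤⟨ ℚ.*-monoʳ-≤-nonNeg ε {{ℚ.nonNegative (ℚ.<⇒≤ 0<ε)}}
                                      (ℕ→ℚ-mono (ℕ.≤-trans (ℕ.n≤1+n N) (ℕ.m⊔n≤o⇒m≤o (suc N) K le))) ⟩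
        ℕ→ℚ (suc n) * ε          ≡⟨ ℚ.*-comm (ℕ→ℚ (suc n)) ε ⟩
        ε * ℕ→ℚ (suc n)          ∎)

  1/suc-null : IsNull 1/suc
  1/suc-null = null-by-growth 1ℚ 0 λ n _ → begin
    1/suc n * ℕ→ℚ n        ≤⟨ ℚ.*-monoˡ-≤-nonNeg (1/suc n) {{ℚ.nonNegative (0≤1/suc n)}} (ℕ→ℚ-mono (ℕ.n≤1+n n)) ⟩
    1/suc n * ℕ→ℚ (suc n)  ≡⟨ 1/suc-inverse n ⟩
    1ℚ                     ∎

  cauchy-ordered : ∀ u → (∀ ε → 0ℚ < ε →
    ∃ λ N → ∀ m n → N ℕ.≤ m → m ℕ.≤ n → abs (u n - u m) ≤ ε) → IsCauchy u
  cauchy-ordered u h ε 0<ε = N , bound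
    where
      N = proj₁ (h ε 0<ε)
      bound : ∀ m n → N ℕ.≤ m → N ℕ.≤ n → abs (u m - u n) ≤ ε
      bound m n N≤m N≤n with ℕ.≤-total m n
      ... | inj₁ m≤n = subst (_≤ ε) (abs-sym (u n) (u m)) (proj₂ (h ε 0<ε) m n N≤m m≤n)
      ... | inj₂ n≤m = proj₂ (h ε 0<ε) n m N≤n n≤m

  module Squeeze (u v : ℕ → ℚ) (K : ℕ)
    (0≤v  : ∀ n → 0ℚ ≤ v n)
    (u-up : ∀ n → K ℕ.≤ n → u n ≤ u (suc n))
    (w-dn : ∀ n → K ℕ.≤ n → u (suc n) + v (suc n) ≤ u n + v n) where

    up : ∀ m k → K ℕ.≤ m → u m ≤ u (k ℕ.+ m)
    up m zero    K≤m = ℚ.≤-refl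
    up m (suc k) K≤m = ℚ.≤-trans (up m k K≤m) (u-up (k ℕ.+ m) (ℕ.≤-trans K≤m (ℕ.m≤n+m m k)))

    dn : ∀ m k → K ℕ.≤ m → u (k ℕ.+ m) + v (k ℕ.+ m) ≤ u m + v m
    dn m zero    K≤m = ℚ.≤-refl
    dn m (suc k) K≤m = ℚ.≤-trans (w-dn (k ℕ.+ m) (ℕ.≤-trans K≤m (ℕ.m≤n+m m k))) (dn m k K≤m)

    increasing : ∀ {m n} → K ℕ.≤ m → m ℕ.≤ n → u m ≤ u n
    increasing {m} {n} K≤m m≤n =
      subst (λ z → u m ≤ u z) (ℕ.m∸n+n≡m m≤n) (up m (n ℕ.∸ m) K≤m)

    difference : ∀ {m n} → K ℕ.≤ m → m ℕ.≤ n → u n - u m ≤ v m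
    difference {m} {n} K≤m m≤n = begin
      u n - u m          ≤⟨ ℚ.+-monoˡ-≤ (- u m) (≤-gap {u n} (v n) (0≤v n) refl) ⟩
      u n + v n - u m    ≤⟨ ℚ.+-monoˡ-≤ (- u m) (subst (λ z → u z + v z ≤ u m + v m)
                              (ℕ.m∸n+n≡m m≤n) (dn m (n ℕ.∸ m) K≤m)) ⟩
      u m + v m - u m    ≡⟨ solve 2 (λ a b → a :+ b :- a := b) refl (u m) (v m) ⟩
      v m                ∎

    cauchy : IsNull v → IsCauchy u
    cauchy v-null = cauchy-ordered u λ ε 0<ε →
      let (N , vN) = v-null ε 0<ε in
      K ℕ.⊔ N , λ m n KN≤m m≤n →
        let K≤m = ℕ.m⊔n≤o⇒m≤o K N KN≤m
            0≤d = gap (increasing K≤m m≤n)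
        in subst (_≤ ε) (sym (ℚ.0≤p⇒∣p∣≡p 0≤d))
             (ℚ.≤-trans (difference K≤m m≤n) (vN m (ℕ.m⊔n≤o⇒n≤o K N KN≤m)))

  eventually-bounded : ∀ {u} → IsCauchy u → ∃ λ B → ∃ λ N → ∀ n → N ℕ.≤ n → abs (u n) ≤ ℕ→ℚ B
  eventually-bounded {u} cu = B , N , λ n N≤n → begin
      abs (u n)                    ≡⟨ cong abs (solve 2 (λ a b → a := (a :- b) :+ b) refl (u n) (u N)) ⟩
      abs ((u n - u N) + u N)      ≤⟨ ℚ.∣p+q∣≤∣p∣+∣q∣ (u n - u N) (u N) ⟩
      abs (u n - u N) + abs (u N)  ≤⟨ ℚ.+-monoˡ-≤ (abs (u N)) (near n N N≤n ℕ.≤-refl) ⟩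
      1ℚ + abs (u N)               ≤⟨ proj₂ (archimedean (1ℚ + abs (u N))) ⟩
      ℕ→ℚ B                        ∎
    where
      N    = proj₁ (cu 1ℚ (ℚ.positive⁻¹ 1ℚ))
      near = proj₂ (cu 1ℚ (ℚ.positive⁻¹ 1ℚ))
      B    = proj₁ (archimedean (1ℚ + abs (u N)))

  0<half : ∀ {ε} → 0ℚ < ε → 0ℚ < ε * 1/suc 1
  0<half 0<ε = *-pos 0<ε (0<1/suc 1)

  halves : ∀ ε → ε * 1/suc 1 + ε * 1/suc 1 ≡ ε
  halves = solve 1 (λ e → e :* con (1/suc 1) :+ e :* con (1/suc 1) := e) refl

  scale : ∀ B δ → ℕ→ℚ (suc B) * (δ * 1/suc B) ≡ δ
  scale B δ = trans
    (solve 3 (λ a b c → a :* (b :* c) := b :* (c :* a)) refl (ℕ→ℚ (suc B)) δ (1/suc B))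
    (trans (cong (δ *_) (1/suc-inverse B)) (ℚ.*-identityʳ δ))

  ∑-mono : ∀ n {f g} → (∀ i → i ℕ.< n → f i ≤ g i) → ∑<ℚ n f ≤ ∑<ℚ n g
  ∑-mono zero    h = ℚ.≤-refl
  ∑-mono (suc n) h = ℚ.+-mono-≤ (∑-mono n (λ i i<n → h i (ℕ.m<n⇒m<1+n i<n))) (h n ℕ.≤-refl)

  ∑-cong : ∀ n {f g : ℕ → ℚ} → (∀ i → f i ≡ g i) → ∑<ℚ n f ≡ ∑<ℚ n g
  ∑-cong zero    h = refl
  ∑-cong (suc n) h = cong₂ _+_ (∑-cong n h) (h n)

  ∑-const : ∀ n c → ∑<ℚ n (λ _ → c) ≡ ℕ→ℚ n * c
  ∑-const zero    c = sym (ℚ.*-zeroˡ c)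
  ∑-const (suc n) c = begin-equality
    ∑<ℚ n (λ _ → c) + c   ≡⟨ cong (_+ c) (∑-const n c) ⟩
    ℕ→ℚ n * c + c         ≡⟨ solve 2 (λ a b → a :* b :+ b := (con 1ℚ :+ a) :* b) refl (ℕ→ℚ n) c ⟩
    (1ℚ + ℕ→ℚ n) * c      ≡⟨ cong (_* c) (ℕ→ℚ-suc n) ⟨
    ℕ→ℚ (suc n) * c       ∎

  ∑-split : ∀ m n f → ∑<ℚ (m ℕ.+ n) f ≡ ∑<ℚ m f + ∑<ℚ n (λ i → f (m ℕ.+ i))
  ∑-split m zero    f = trans (cong (λ z → ∑<ℚ z f) (ℕ.+-identityʳ m)) (sym (ℚ.+-identityʳ _))
  ∑-split m (suc n) f = begin-equality
    ∑<ℚ (m ℕ.+ suc n) f                                     ≡⟨ cong (λ z → ∑<ℚ z f) (ℕ.+-suc m n) ⟩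
    ∑<ℚ (m ℕ.+ n) f + f (m ℕ.+ n)                           ≡⟨ cong (_+ f (m ℕ.+ n)) (∑-split m n f) ⟩
    ∑<ℚ m f + ∑<ℚ n (λ i → f (m ℕ.+ i)) + f (m ℕ.+ n)       ≡⟨ ℚ.+-assoc (∑<ℚ m f) _ _ ⟩
    ∑<ℚ m f + (∑<ℚ n (λ i → f (m ℕ.+ i)) + f (m ℕ.+ n))     ∎

  harmonicBlock-upper : ∀ a c → harmonicBlock a c ≤ ℕ→ℚ c * 1/suc a
  harmonicBlock-upper a c = ℚ.≤-trans
    (∑-mono c (λ i _ → 1/suc-antimono (ℕ.m≤m+n a i)))
    (ℚ.≤-reflexive (∑-const c (1/suc a)))

  harmonicBlock-lower : ∀ a c → ℕ→ℚ (suc c) * 1/suc (a ℕ.+ c) ≤ harmonicBlock a (suc c)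
  harmonicBlock-lower a c = ℚ.≤-trans
    (ℚ.≤-reflexive (sym (∑-const (suc c) (1/suc (a ℕ.+ c)))))
    (∑-mono (suc c) (λ i i≤c → 1/suc-antimono (ℕ.+-monoʳ-≤ a (s≤s⁻¹ i≤c))))

  harmonicBlock-head : ∀ a c → harmonicBlock a (suc c) ≡ 1/suc a + harmonicBlock (suc a) c
  harmonicBlock-head a c = trans (∑-split 1 c (λ i → 1/suc (a ℕ.+ i)))
    (cong₂ _+_ (trans (ℚ.+-identityˡ _) (cong 1/suc (ℕ.+-identityʳ a)))
      (∑-cong c (λ i → cong 1/suc (ℕ.+-suc a i))))

  logSum-step : ∀ p k → let s = suc k in
    logSum p (suc k) + 1/suc s ≡ logSum p k + harmonicBlock (suc p ℕ.* s) (suc p)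
  logSum-step p k = begin-equality
    logSum p (suc k) + 1/suc s                   ≡⟨ ℚ.+-comm (logSum p (suc k)) (1/suc s) ⟩
    1/suc s + logSum p (suc k)                   ≡⟨ harmonicBlock-head s (p ℕ.* suc s) ⟨
    harmonicBlock s (suc (p ℕ.* suc s))          ≡⟨ cong (harmonicBlock s) lengths ⟩
    harmonicBlock s (p ℕ.* s ℕ.+ suc p)          ≡⟨ ∑-split (p ℕ.* s) (suc p) (λ i → 1/suc (s ℕ.+ i)) ⟩
    logSum p k + ∑<ℚ (suc p) (λ i → 1/suc (s ℕ.+ (p ℕ.* s ℕ.+ i)))
      ≡⟨ cong (_+_ (logSum p k)) (∑-cong (suc p) (λ i → cong 1/suc (sym (ℕ.+-assoc s (p ℕ.* s) i)))) ⟩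
    logSum p k + harmonicBlock (suc p ℕ.* s) (suc p)  ∎
    where
      s = suc k
      lengths : suc (p ℕ.* suc s) ≡ p ℕ.* s ℕ.+ suc p
      lengths = trans (cong suc (trans (ℕ.*-suc p s) (ℕ.+-comm p (p ℕ.* s)))) (sym (ℕ.+-suc (p ℕ.* s) p))

  ratio : ∀ p k l → suc p ℕ.* suc k ≡ suc l → ℕ→ℚ (suc p) * 1/suc l ≡ 1/suc k
  ratio p k l eq = begin-equality
    P * 1/suc l                            ≡⟨ ℚ.*-identityʳ (P * 1/suc l) ⟨
    P * 1/suc l * 1ℚ                       ≡⟨ cong (P * 1/suc l *_) (1/suc-inverse k) ⟨
    P * 1/suc l * (1/suc k * Q)            ≡⟨ solve 4 (λ a b c d → a :* b :* (c :* d) := c :* (b :* (a :* d))) refl P (1/suc l) (1/suc k) Q ⟩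
    1/suc k * (1/suc l * (P * Q))          ≡⟨ cong (λ z → 1/suc k * (1/suc l * z)) (sym (ℕ→ℚ-* (suc p) (suc k))) ⟩
    1/suc k * (1/suc l * ℕ→ℚ (suc p ℕ.* suc k))  ≡⟨ cong (λ z → 1/suc k * (1/suc l * ℕ→ℚ z)) eq ⟩
    1/suc k * (1/suc l * ℕ→ℚ (suc l))      ≡⟨ cong (1/suc k *_) (1/suc-inverse l) ⟩
    1/suc k * 1ℚ                           ≡⟨ ℚ.*-identityʳ (1/suc k) ⟩
    1/suc k                                ∎
    where P = ℕ→ℚ (suc p) ; Q = ℕ→ℚ (suc k)

  logSum-up : ∀ p k → logSum p k ≤ logSum p (suc k)
  logSum-up p k = ≤-gap (H - 1/suc s)
    (gap (ℚ.≤-trans (ℚ.≤-reflexive (sym (ratio p s (suc p ℕ.* s ℕ.+ p) eq))) (harmonicBlock-lower (suc p ℕ.* s) p)))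
    (begin-equality
      logSum p k + (H - 1/suc s)               ≡⟨ ℚ.+-assoc (logSum p k) H (- 1/suc s) ⟨
      logSum p k + H - 1/suc s                 ≡⟨ cong (_- 1/suc s) (logSum-step p k) ⟨
      logSum p (suc k) + 1/suc s - 1/suc s     ≡⟨ solve 2 (λ a b → a :+ b :- b := a) refl (logSum p (suc k)) (1/suc s) ⟩
      logSum p (suc k)                         ∎)
    where
      s = suc k
      H = harmonicBlock (suc p ℕ.* s) (suc p)
      eq : suc p ℕ.* suc s ≡ suc (suc p ℕ.* s ℕ.+ p)
      eq = trans (ℕ.*-suc (suc p) s) (cong suc (ℕ.+-comm p (suc p ℕ.* s)))

  logSum-dn : ∀ p k → logSum p (suc k) + 1/suc (suc k) ≤ logSum p k + 1/suc k
  logSum-dn p k = begin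
    logSum p (suc k) + 1/suc s     ≡⟨ logSum-step p k ⟩
    logSum p k + H                 ≤⟨ ℚ.+-monoʳ-≤ (logSum p k) (harmonicBlock-upper (suc p ℕ.* s) (suc p)) ⟩
    logSum p k + ℕ→ℚ (suc p) * 1/suc (suc p ℕ.* s)
      ≤⟨ ℚ.+-monoʳ-≤ (logSum p k) (ℚ.*-monoˡ-≤-nonNeg (ℕ→ℚ (suc p)) {{ℚ.nonNegative (0≤ℕ→ℚ (suc p))}}
           (1/suc-antimono (ℕ.n≤1+n (k ℕ.+ p ℕ.* s)))) ⟩
    logSum p k + ℕ→ℚ (suc p) * 1/suc (k ℕ.+ p ℕ.* s)
      ≡⟨ cong (_+_ (logSum p k)) (ratio p k (k ℕ.+ p ℕ.* s) refl) ⟩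
    logSum p k + 1/suc k           ∎
    where
      s = suc k
      H = harmonicBlock (suc p ℕ.* s) (suc p)

  logSum-cauchy : ∀ p → IsCauchy (logSum p)
  logSum-cauchy p = Squeeze.cauchy (logSum p) 1/suc 0 0≤1/suc (λ k _ → logSum-up p k) (λ k _ → logSum-dn p k) 1/suc-null

  const-cauchy : ∀ q → IsCauchy (λ _ → q)
  const-cauchy q ε 0<ε = 0 , λ _ _ _ _ →
    subst (_≤ ε) (sym (cong abs (ℚ.+-inverseʳ q))) (ℚ.<⇒≤ 0<ε)

  neg-cauchy : ∀ {u} → IsCauchy u → IsCauchy (λ n → - u n)
  neg-cauchy {u} cu ε 0<ε = let (N , h) = cu ε 0<ε in N , λ m n N≤m N≤n →
    subst (_≤ ε) (trans (sym (ℚ.∣-p∣≡∣p∣ (u m - u n)))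
      (cong abs (ℚ.neg-distrib-+ (u m) (- u n)))) (h m n N≤m N≤n)

  +-cauchy : ∀ {u v} → IsCauchy u → IsCauchy v → IsCauchy (λ n → u n + v n)
  +-cauchy {u} {v} cu cv ε 0<ε =
    let (M , hu) = cu (ε * 1/suc 1) (0<half 0<ε)
        (N , hv) = cv (ε * 1/suc 1) (0<half 0<ε)
    in M ℕ.⊔ N , λ m n m≥ n≥ → begin
      abs (u m + v m - (u n + v n))        ≡⟨ cong abs (solve 4 (λ a b c d → a :+ b :- (c :+ d) := (a :- c) :+ (b :- d)) refl (u m) (v m) (u n) (v n)) ⟩
      abs ((u m - u n) + (v m - v n))      ≤⟨ ℚ.∣p+q∣≤∣p∣+∣q∣ (u m - u n) (v m - v n) ⟩
      abs (u m - u n) + abs (v m - v n)    ≤⟨ ℚ.+-mono-≤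
                                                (hu m n (ℕ.m⊔n≤o⇒m≤o M N m≥) (ℕ.m⊔n≤o⇒m≤o M N n≥))
                                                (hv m n (ℕ.m⊔n≤o⇒n≤o M N m≥) (ℕ.m⊔n≤o⇒n≤o M N n≥)) ⟩
      ε * 1/suc 1 + ε * 1/suc 1            ≡⟨ halves ε ⟩
      ε                                    ∎

  *-cauchy : ∀ {u v} → IsCauchy u → IsCauchy v → IsCauchy (λ n → u n * v n)
  *-cauchy {u} {v} cu cv ε 0<ε =
    let (B , M₁ , bu) = eventually-bounded cu
        (C , N₁ , bv) = eventually-bounded cv
        δ             = ε * 1/suc 1
        (M₂ , hu)     = cu (δ * 1/suc C) (*-pos (0<half 0<ε) (0<1/suc C))
        (N₂ , hv)     = cv (δ * 1/suc B) (*-pos (0<half 0<ε) (0<1/suc B))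
        M = M₁ ℕ.⊔ M₂
        N = N₁ ℕ.⊔ N₂
        M₁≤ : ∀ {n} → M ℕ.⊔ N ℕ.≤ n → M₁ ℕ.≤ n
        M₁≤ le = ℕ.m⊔n≤o⇒m≤o M₁ M₂ (ℕ.m⊔n≤o⇒m≤o M N le)
        M₂≤ : ∀ {n} → M ℕ.⊔ N ℕ.≤ n → M₂ ℕ.≤ n
        M₂≤ le = ℕ.m⊔n≤o⇒n≤o M₁ M₂ (ℕ.m⊔n≤o⇒m≤o M N le)
        N₁≤ : ∀ {n} → M ℕ.⊔ N ℕ.≤ n → N₁ ℕ.≤ n
        N₁≤ le = ℕ.m⊔n≤o⇒m≤o N₁ N₂ (ℕ.m⊔n≤o⇒n≤o M N le)
        N₂≤ : ∀ {n} → M ℕ.⊔ N ℕ.≤ n → N₂ ℕ.≤ n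
        N₂≤ le = ℕ.m⊔n≤o⇒n≤o N₁ N₂ (ℕ.m⊔n≤o⇒n≤o M N le)
    in M ℕ.⊔ N , λ m n m≥ n≥ → begin
      abs (u m * v m - u n * v n)
        ≡⟨ cong abs (solve 4 (λ a b c d → a :* b :- c :* d := a :* (b :- d) :+ d :* (a :- c)) refl (u m) (v m) (u n) (v n)) ⟩
      abs (u m * (v m - v n) + v n * (u m - u n))
        ≤⟨ ℚ.∣p+q∣≤∣p∣+∣q∣ (u m * (v m - v n)) (v n * (u m - u n)) ⟩
      abs (u m * (v m - v n)) + abs (v n * (u m - u n))
        ≡⟨ cong₂ _+_ (ℚ.∣p*q∣≡∣p∣*∣q∣ (u m) (v m - v n)) (ℚ.∣p*q∣≡∣p∣*∣q∣ (v n) (u m - u n)) ⟩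
      abs (u m) * abs (v m - v n) + abs (v n) * abs (u m - u n)
        ≤⟨ ℚ.+-mono-≤
             (*-mono (ℚ.0≤∣p∣ (u m)) (ℚ.<⇒≤ (*-pos (0<half 0<ε) (0<1/suc B)))
               (ℚ.≤-trans (bu m (M₁≤ m≥)) (ℕ→ℚ-mono (ℕ.n≤1+n B))) (hv m n (N₂≤ m≥) (N₂≤ n≥)))
             (*-mono (ℚ.0≤∣p∣ (v n)) (ℚ.<⇒≤ (*-pos (0<half 0<ε) (0<1/suc C)))
               (ℚ.≤-trans (bv n (N₁≤ n≥)) (ℕ→ℚ-mono (ℕ.n≤1+n C))) (hu m n (M₂≤ m≥) (M₂≤ n≥))) ⟩
      ℕ→ℚ (suc B) * (δ * 1/suc B) + ℕ→ℚ (suc C) * (δ * 1/suc C)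
        ≡⟨ cong₂ _+_ (scale B δ) (scale C δ) ⟩
      δ + δ  ≡⟨ halves ε ⟩
      ε      ∎

  expTerm-nonNeg : ∀ {b} → 0ℚ ≤ b → ∀ k → 0ℚ ≤ expTerm b k
  expTerm-nonNeg 0≤b zero    = ℚ.nonNegative⁻¹ 1ℚ
  expTerm-nonNeg 0≤b (suc k) = *-nonNeg (expTerm-nonNeg 0≤b k) (*-nonNeg 0≤b (0≤1/suc k))

  abs-1/suc : ∀ k → abs (1/suc k) ≡ 1/suc k
  abs-1/suc k = ℚ.0≤p⇒∣p∣≡p (0≤1/suc k)

  expTerm-bound : ∀ {x b} → abs x ≤ b → ∀ k → abs (expTerm x k) ≤ expTerm b k
  expTerm-bound         ∣x∣≤b zero    = ℚ.≤-refl
  expTerm-bound {x} {b} ∣x∣≤b (suc k) = begin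
    abs (expTerm x k * (x * 1/suc k))        ≡⟨ ℚ.∣p*q∣≡∣p∣*∣q∣ (expTerm x k) (x * 1/suc k) ⟩
    abs (expTerm x k) * abs (x * 1/suc k)    ≡⟨ cong (abs (expTerm x k) *_)
                                                  (trans (ℚ.∣p*q∣≡∣p∣*∣q∣ x (1/suc k)) (cong (abs x *_) (abs-1/suc k))) ⟩
    abs (expTerm x k) * (abs x * 1/suc k)    ≤⟨ *-mono (ℚ.0≤∣p∣ (expTerm x k)) (*-nonNeg 0≤b (0≤1/suc k))
                                                  (expTerm-bound ∣x∣≤b k)
                                                  (ℚ.*-monoʳ-≤-nonNeg (1/suc k) {{ℚ.nonNegative (0≤1/suc k)}} ∣x∣≤b) ⟩
    expTerm b k * (b * 1/suc k)              ∎
    where 0≤b = ℚ.≤-trans (ℚ.0≤∣p∣ x) ∣x∣≤b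

  -- k · b^k/k! = b · b^(k-1)/(k-1)!
  expTerm-recurrence : ∀ b k → ℕ→ℚ (suc k) * expTerm b (suc k) ≡ expTerm b k * b
  expTerm-recurrence b k = begin-equality
    K * (expTerm b k * (b * 1/suc k))     ≡⟨ solve 4 (λ a c d e → a :* (c :* (d :* e)) := c :* d :* (e :* a)) refl K (expTerm b k) b (1/suc k) ⟩
    expTerm b k * b * (1/suc k * K)       ≡⟨ cong (expTerm b k * b *_) (1/suc-inverse k) ⟩
    expTerm b k * b * 1ℚ                  ≡⟨ ℚ.*-identityʳ (expTerm b k * b) ⟩
    expTerm b k * b                       ∎
    where K = ℕ→ℚ (suc k)

  expTerm-lipschitz : ∀ {x y b} → abs x ≤ b → abs y ≤ b → ∀ k →
    abs (expTerm x (suc k) - expTerm y (suc k)) ≤ expTerm b k * abs (x - y)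
  expTerm-lipschitz {x} {y} {b} ∣x∣≤b ∣y∣≤b k = begin
    abs (t * (x * ρ) - s * (y * ρ))
      ≡⟨ cong abs (solve 5 (λ t s x y r → t :* (x :* r) :- s :* (y :* r) := r :* ((t :- s) :* x :+ s :* (x :- y))) refl t s x y ρ) ⟩
    abs (ρ * ((t - s) * x + s * (x - y)))
      ≡⟨ trans (ℚ.∣p*q∣≡∣p∣*∣q∣ ρ _) (cong (_* abs ((t - s) * x + s * (x - y))) (abs-1/suc k)) ⟩
    ρ * abs ((t - s) * x + s * (x - y))
      ≤⟨ ℚ.*-monoˡ-≤-nonNeg ρ {{ℚ.nonNegative (0≤1/suc k)}} (begin
           abs ((t - s) * x + s * (x - y))            ≤⟨ ℚ.∣p+q∣≤∣p∣+∣q∣ ((t - s) * x) (s * (x - y)) ⟩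
           abs ((t - s) * x) + abs (s * (x - y))      ≡⟨ cong₂ _+_ (ℚ.∣p*q∣≡∣p∣*∣q∣ (t - s) x) (ℚ.∣p*q∣≡∣p∣*∣q∣ s (x - y)) ⟩
           abs (t - s) * abs x + abs s * abs (x - y)  ≤⟨ ℚ.+-mono-≤ (previous k)
                                                           (ℚ.*-monoʳ-≤-nonNeg D {{ℚ.nonNegative (ℚ.0≤∣p∣ (x - y))}} (expTerm-bound ∣y∣≤b k)) ⟩
           ℕ→ℚ k * expTerm b k * D + expTerm b k * D  ∎) ⟩
    ρ * (ℕ→ℚ k * expTerm b k * D + expTerm b k * D)
      ≡⟨ solve 4 (λ r n e d → r :* (n :* e :* d :+ e :* d) := r :* (con 1ℚ :+ n) :* (e :* d)) refl ρ (ℕ→ℚ k) (expTerm b k) D ⟩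
    ρ * (1ℚ + ℕ→ℚ k) * (expTerm b k * D)
      ≡⟨ cong (λ z → ρ * z * (expTerm b k * D)) (sym (ℕ→ℚ-suc k)) ⟩
    ρ * ℕ→ℚ (suc k) * (expTerm b k * D)
      ≡⟨ trans (cong (_* (expTerm b k * D)) (1/suc-inverse k)) (ℚ.*-identityˡ _) ⟩
    expTerm b k * D  ∎
    where
      t = expTerm x k
      s = expTerm y k
      ρ = 1/suc k
      D = abs (x - y)
      0≤b = ℚ.≤-trans (ℚ.0≤∣p∣ x) ∣x∣≤b
      previous : ∀ j → abs (expTerm x j - expTerm y j) * abs x ≤ ℕ→ℚ j * expTerm b j * D
      previous zero    = ℚ.≤-reflexive (trans (ℚ.*-zeroˡ (abs x))
        (sym (trans (cong (_* D) (ℚ.*-zeroˡ 1ℚ)) (ℚ.*-zeroˡ D))))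
      previous (suc j) = begin
        abs (expTerm x (suc j) - expTerm y (suc j)) * abs x
          ≤⟨ *-mono (ℚ.0≤∣p∣ _) 0≤b (expTerm-lipschitz ∣x∣≤b ∣y∣≤b j) ∣x∣≤b ⟩
        expTerm b j * D * b
          ≡⟨ solve 3 (λ e d b → e :* d :* b := e :* b :* d) refl (expTerm b j) D b ⟩
        expTerm b j * b * D
          ≡⟨ cong (_* D) (expTerm-recurrence b j) ⟨
        ℕ→ℚ (suc j) * expTerm b (suc j) * D  ∎

  expSum-lipschitz : ∀ {x y b} → abs x ≤ b → abs y ≤ b → ∀ n →
    abs (expSum x n - expSum y n) ≤ expSum b n * abs (x - y)
  expSum-lipschitz {x} {y} {b} ∣x∣≤b ∣y∣≤b n = ℚ.≤-trans (sharper n)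
    (ℚ.*-monoʳ-≤-nonNeg (abs (x - y)) {{ℚ.nonNegative (ℚ.0≤∣p∣ (x - y))}} (pred-≤ n))
    where
      0≤b = ℚ.≤-trans (ℚ.0≤∣p∣ x) ∣x∣≤b
      pred-≤ : ∀ n → expSum b (ℕ.pred n) ≤ expSum b n
      pred-≤ zero    = ℚ.≤-refl
      pred-≤ (suc n) = ≤-gap (expTerm b n) (expTerm-nonNeg 0≤b n) refl
      sharper : ∀ n → abs (expSum x n - expSum y n) ≤ expSum b (ℕ.pred n) * abs (x - y)
      sharper zero          = ℚ.≤-reflexive (sym (ℚ.*-zeroˡ (abs (x - y))))
      sharper (suc zero)    = ℚ.≤-reflexive (sym (ℚ.*-zeroˡ (abs (x - y))))
      sharper (suc (suc n)) = begin
        abs (expSum x (suc n) + t - (expSum y (suc n) + s))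
          ≡⟨ cong abs (solve 4 (λ a b c d → a :+ b :- (c :+ d) := (a :- c) :+ (b :- d)) refl (expSum x (suc n)) t (expSum y (suc n)) s) ⟩
        abs ((expSum x (suc n) - expSum y (suc n)) + (t - s))
          ≤⟨ ℚ.∣p+q∣≤∣p∣+∣q∣ (expSum x (suc n) - expSum y (suc n)) (t - s) ⟩
        abs (expSum x (suc n) - expSum y (suc n)) + abs (t - s)
          ≤⟨ ℚ.+-mono-≤ (sharper (suc n)) (expTerm-lipschitz ∣x∣≤b ∣y∣≤b n) ⟩
        expSum b n * abs (x - y) + expTerm b n * abs (x - y)
          ≡⟨ ℚ.*-distribʳ-+ (abs (x - y)) (expSum b n) (expTerm b n) ⟨
        expSum b (suc n) * abs (x - y)  ∎
        where t = expTerm x (suc n) ; s = expTerm y (suc n)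

  expSum-tail : ∀ {x b} → abs x ≤ b → ∀ m n → m ℕ.≤ n →
    abs (expSum x n - expSum x m) ≤ expSum b n - expSum b m
  expSum-tail {x} {b} ∣x∣≤b m n m≤n =
    subst (λ z → abs (expSum x z - expSum x m) ≤ expSum b z - expSum b m) (ℕ.m∸n+n≡m m≤n) (go (n ℕ.∸ m))
    where
      go : ∀ k → abs (expSum x (k ℕ.+ m) - expSum x m) ≤ expSum b (k ℕ.+ m) - expSum b m
      go zero    = ℚ.≤-reflexive (trans (cong abs (ℚ.+-inverseʳ (expSum x m))) (sym (ℚ.+-inverseʳ (expSum b m))))
      go (suc k) = begin
        abs (X + t - expSum x m)            ≡⟨ cong abs (solve 3 (λ a b c → a :+ b :- c := (a :- c) :+ b) refl X t (expSum x m)) ⟩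
        abs ((X - expSum x m) + t)          ≤⟨ ℚ.∣p+q∣≤∣p∣+∣q∣ (X - expSum x m) t ⟩
        abs (X - expSum x m) + abs t        ≤⟨ ℚ.+-mono-≤ (go k) (expTerm-bound ∣x∣≤b (k ℕ.+ m)) ⟩
        (Y - expSum b m) + s                ≡⟨ solve 3 (λ a b c → (a :- c) :+ b := a :+ b :- c) refl Y s (expSum b m) ⟩
        Y + s - expSum b m                  ∎
        where
          X = expSum x (k ℕ.+ m) ; Y = expSum b (k ℕ.+ m)
          t = expTerm x (k ℕ.+ m) ; s = expTerm b (k ℕ.+ m)

  module _ (B : ℕ) where

    private
      b   = ℕ→ℚ B
      0≤b = 0≤ℕ→ℚ B
      0≤t = expTerm-nonNeg 0≤b
      K   = B ℕ.+ B
      two = ℕ→ℚ 2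

    expTerm-halving : ∀ k → K ℕ.≤ k → expTerm b (suc k) + expTerm b (suc k) ≤ expTerm b k
    expTerm-halving k K≤k = ℚ.*-cancelʳ-≤-pos (ℕ→ℚ (suc k)) {{ℚ.positive (0<ℕ→ℚsuc k)}} (begin
      (t′ + t′) * ℕ→ℚ (suc k)     ≡⟨ solve 2 (λ t n → (t :+ t) :* n := n :* t :+ n :* t) refl t′ (ℕ→ℚ (suc k)) ⟩
      ℕ→ℚ (suc k) * t′ + ℕ→ℚ (suc k) * t′  ≡⟨ cong₂ _+_ (expTerm-recurrence b k) (expTerm-recurrence b k) ⟩
      t * b + t * b               ≡⟨ ℚ.*-distribˡ-+ t b b ⟨
      t * (b + b)                 ≡⟨ cong (t *_) (ℕ→ℚ-+ B B) ⟨
      t * ℕ→ℚ K                   ≤⟨ ℚ.*-monoˡ-≤-nonNeg t {{ℚ.nonNegative (0≤t k)}} (ℕ→ℚ-mono (ℕ.m≤n⇒m≤1+n K≤k)) ⟩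
      t * ℕ→ℚ (suc k)             ∎)
      where t = expTerm b k ; t′ = expTerm b (suc k)

    expTerm-decreasing : ∀ k → K ℕ.≤ k → expTerm b (suc k) ≤ expTerm b k
    expTerm-decreasing k K≤k =
      ℚ.≤-trans (≤-gap (expTerm b (suc k)) (0≤t (suc k)) refl) (expTerm-halving k K≤k)

    expTerm-max : ∀ j → expTerm b (j ℕ.+ K) ≤ expTerm b K
    expTerm-max zero    = ℚ.≤-refl
    expTerm-max (suc j) = ℚ.≤-trans (expTerm-decreasing (j ℕ.+ K) (ℕ.m≤n+m K j)) (expTerm-max j)

    2expTerm-null : IsNull (λ k → expTerm b k + expTerm b k)
    2expTerm-null = null-by-growth (T * b + T * b) (suc K) bound
      where
        T = expTerm b K
        bound : ∀ k → suc K ℕ.≤ k → (expTerm b k + expTerm b k) * ℕ→ℚ k ≤ T * b + T * b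
        bound (suc k) (s≤s K≤k) = begin
          (t + t) * ℕ→ℚ (suc k)     ≡⟨ solve 2 (λ t n → (t :+ t) :* n := n :* t :+ n :* t) refl t (ℕ→ℚ (suc k)) ⟩
          ℕ→ℚ (suc k) * t + ℕ→ℚ (suc k) * t      ≡⟨ cong₂ _+_ (expTerm-recurrence b k) (expTerm-recurrence b k) ⟩
          expTerm b k * b + expTerm b k * b      ≤⟨ ℚ.+-mono-≤ le le ⟩
          T * b + T * b             ∎
          where
            t  = expTerm b (suc k)
            le : expTerm b k * b ≤ T * b
            le = ℚ.*-monoʳ-≤-nonNeg b {{ℚ.nonNegative 0≤b}}
                   (subst (λ z → expTerm b z ≤ T) (ℕ.m∸n+n≡m K≤k) (expTerm-max (k ℕ.∸ K)))

    expSum-cauchy-ℕ : IsCauchy (expSum b)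
    expSum-cauchy-ℕ = Squeeze.cauchy (expSum b) (λ k → expTerm b k + expTerm b k) K
      (λ k → ℚ.+-mono-≤ (0≤t k) (0≤t k))
      (λ k _ → ≤-gap (expTerm b k) (0≤t k) refl)
      (λ k K≤k → begin
        expSum b k + expTerm b k + (expTerm b (suc k) + expTerm b (suc k))
          ≤⟨ ℚ.+-monoʳ-≤ (expSum b k + expTerm b k) (expTerm-halving k K≤k) ⟩
        expSum b k + expTerm b k + expTerm b k
          ≡⟨ ℚ.+-assoc (expSum b k) (expTerm b k) (expTerm b k) ⟩
        expSum b k + (expTerm b k + expTerm b k)  ∎)
      2expTerm-null

  exp-cauchy : ∀ {u} → IsCauchy u → IsCauchy (λ n → expSum (u n) n)
  exp-cauchy {u} cu = cauchy-ordered (λ n → expSum (u n) n) λ ε 0<ε →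
    let (B , N₁ , bu) = eventually-bounded cu
        b             = ℕ→ℚ B
        cE            = expSum-cauchy-ℕ B
        (C , N₂ , bE) = eventually-bounded cE
        δ             = ε * 1/suc 1
        0<δ           = 0<half 0<ε
        (N₃ , hE)     = cE δ 0<δ
        (N₄ , hu)     = cu (δ * 1/suc C) (*-pos 0<δ (0<1/suc C))
        N             = (N₁ ℕ.⊔ N₂) ℕ.⊔ (N₃ ℕ.⊔ N₄)
    in N , λ m n N≤m m≤n →
      let N₁₂≤m = ℕ.m⊔n≤o⇒m≤o (N₁ ℕ.⊔ N₂) (N₃ ℕ.⊔ N₄) N≤m
          N₃₄≤m = ℕ.m⊔n≤o⇒n≤o (N₁ ℕ.⊔ N₂) (N₃ ℕ.⊔ N₄) N≤m
          N₁≤m  = ℕ.m⊔n≤o⇒m≤o N₁ N₂ N₁₂≤m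
          N₂≤m  = ℕ.m⊔n≤o⇒n≤o N₁ N₂ N₁₂≤m
          N₃≤m  = ℕ.m⊔n≤o⇒m≤o N₃ N₄ N₃₄≤m
          N₄≤m  = ℕ.m⊔n≤o⇒n≤o N₃ N₄ N₃₄≤m
          bm    = bu m N₁≤m
          bn    = bu n (ℕ.≤-trans N₁≤m m≤n)
      in begin
        abs (expSum (u n) n - expSum (u m) m)
          ≤⟨ triangle (expSum (u n) n) (expSum (u n) m) (expSum (u m) m) ⟩
        abs (expSum (u n) n - expSum (u n) m) + abs (expSum (u n) m - expSum (u m) m)
          ≤⟨ ℚ.+-mono-≤ (expSum-tail bn m n m≤n) (expSum-lipschitz bn bm m) ⟩
        (expSum b n - expSum b m) + expSum b m * abs (u n - u m)
          ≤⟨ ℚ.+-mono-≤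
               (ℚ.≤-trans (p≤∣p∣ (expSum b n - expSum b m)) (hE n m (ℕ.≤-trans N₃≤m m≤n) N₃≤m))
               (ℚ.≤-trans
                 (ℚ.*-monoʳ-≤-nonNeg (abs (u n - u m)) {{ℚ.nonNegative (ℚ.0≤∣p∣ (u n - u m))}}
                   (ℚ.≤-trans (p≤∣p∣ (expSum b m)) (ℚ.≤-trans (bE m N₂≤m) (ℕ→ℚ-mono (ℕ.n≤1+n C)))))
                 (ℚ.*-monoˡ-≤-nonNeg (ℕ→ℚ (suc C)) {{ℚ.nonNegative (0≤ℕ→ℚ (suc C))}}
                   (hu n m (ℕ.≤-trans N₄≤m m≤n) N₄≤m))) ⟩
        δ + ℕ→ℚ (suc C) * (δ * 1/suc C)  ≡⟨ cong (_+_ δ) (scale C δ) ⟩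
        δ + δ                            ≡⟨ halves ε ⟩
        ε                                ∎

record ℝ : Set where
  constructor real
  field
    approx : ℕ → ℚ
    cauchy : IsCauchy approx

open ℝ public

infix  4 _≈_ _≤_ _<_
infixl 6 _+_ _-_
infixl 7 _*_
infix  8 -_

_≈_ : ℝ → ℝ → Set
x ≈ y = ∀ ε → 0ℚ ℚ.< ε →
  ∃ λ N → ∀ n → N ℕ.≤ n → ℚ.∣ approx x n ℚ.- approx y n ∣ ℚ.≤ ε

_≤_ : ℝ → ℝ → Set
x ≤ y = ∀ ε → 0ℚ ℚ.< ε →
  ∃ λ N → ∀ n → N ℕ.≤ n → approx x n ℚ.≤ approx y n ℚ.+ ε

_<_ : ℝ → ℝ → Set
x < y = ∃ λ ε → 0ℚ ℚ.< ε ×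
  ∃ λ N → ∀ n → N ℕ.≤ n → approx x n ℚ.+ ε ℚ.≤ approx y n

ℚ→ℝ : ℚ → ℝ
ℚ→ℝ q = real (λ _ → q) (CauchyLemmas.const-cauchy q)

ℕ→ℝ : ℕ → ℝ
ℕ→ℝ n = ℚ→ℝ (ℕ→ℚ n)

0ℝ 1ℝ : ℝ
0ℝ = ℕ→ℝ 0
1ℝ = ℕ→ℝ 1

_+_ : ℝ → ℝ → ℝ
real u cu + real v cv = real (λ n → u n ℚ.+ v n) (CauchyLemmas.+-cauchy {u} {v} cu cv)

-_ : ℝ → ℝ
- real u cu = real (λ n → ℚ.- u n) (CauchyLemmas.neg-cauchy {u} cu)

_-_ : ℝ → ℝ → ℝ
x - y = x + (- y)

_*_ : ℝ → ℝ → ℝ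
real u cu * real v cv = real (λ n → u n ℚ.* v n) (CauchyLemmas.*-cauchy {u} {v} cu cv)

-- The n-th approximation evaluates the n-th Taylor polynomial at the n-th
-- approximation of the argument; this has limit Σ x^k/k! because the series
-- converges uniformly on bounded sets.
exp : ℝ → ℝ
exp (real u cu) = real (λ n → expSum (u n) n) (CauchyLemmas.exp-cauchy {u} cu)

-- log n = ∫₁ⁿ dt/t
log : (n : ℕ) .{{_ : ℕ.NonZero n}} → ℝ
log (suc p) = real (logSum p) (CauchyLemmas.logSum-cauchy p)

-- Real exponents, natural bases; the value at base 0 is the right one for
-- positive exponents only.
_^_ : ℕ → ℝ → ℝ
zero      ^ β = 0ℝ
n@(suc _) ^ β = exp (β * log n)

record Graph (n : ℕ) : Set where
  field
    adj         : Fin n → Fin n → Bool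
    symmetric   : ∀ i j → adj i j ≡ adj j i
    irreflexive : ∀ i → adj i i ≡ false

open Graph public

neighbours : ∀ {n} → Graph n → Fin n → Subset n
neighbours G i = tabulate (adj G i)

degrees : ∀ {n} → Graph n → Vector.Vector ℕ n
degrees G i = ∣ neighbours G i ∣

edgeCount : ∀ {n} → Graph n → ℕ
edgeCount G = Vector.foldr ℕ._+_ 0
  (λ i → ∣ tabulate (λ j → (toℕ i ℕ.<ᵇ toℕ j) ∧ adj G i j) ∣)

_∈𝔾_ : ∀ {n} → Graph n → ℕ → Set
G ∈𝔾 m = edgeCount G ≡ m

_≅_ : ∀ {n} → Graph n → Graph n → Set
_≅_ {n} G H = ∃ λ (φ : Fin n ↔ Fin n) →
  ∀ i j → adj G i j ≡ adj H (Inverse.to φ i) (Inverse.to φ j)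

Σ[_] : (ℕ → ℝ) → ∀ {n} → Vector.Vector ℕ n → ℝ
Σ[ f ] d = Vector.foldr _+_ 0ℝ (Vector.map f d)

Maximizes : (ℕ → ℝ) → ∀ {n} → ℕ → Graph n → Set
Maximizes f {n} m G = G ∈𝔾 m ×
  (∀ (H : Graph n) → H ∈𝔾 m → Σ[ f ] (degrees H) ≤ Σ[ f ] (degrees G))

UniquelyMaximizes : (ℕ → ℝ) → ∀ {n} → ℕ → Graph n → Set
UniquelyMaximizes f {n} m G = Maximizes f m G ×
  (∀ (H : Graph n) → Maximizes f m H → H ≅ G)

isSpoke : ℕ → ℕ → ℕ → Bool
isSpoke m zero    (suc j) = j ℕ.<ᵇ m
isSpoke m zero    zero    = false
isSpoke m (suc _) _       = false

-- Vertex 0 is the centre, vertices 1, …, m the leaves, the rest isolated.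
-- For m ≥ n the quasi-star is not of this form, hence the hypothesis.
QS : (n m : ℕ) → .(m ℕ.< n) → Graph n
QS n m _ = record
  { adj         = λ i j → isSpoke m (toℕ i) (toℕ j) ∨ isSpoke m (toℕ j) (toℕ i)
  ; symmetric   = λ i j → ∨-comm (isSpoke m (toℕ i) (toℕ j)) (isSpoke m (toℕ j) (toℕ i))
  ; irreflexive = λ i → noLoop (toℕ i)
  }
  where
    noLoop : ∀ k → isSpoke m k k ∨ isSpoke m k k ≡ false
    noLoop zero    = refl
    noLoop (suc k) = refl

IsShiftedExponential : (ℕ → ℝ) → Set
IsShiftedExponential f = ∃ λ rate → 0ℝ < rate × (∀ x → f x ≈ exp (rate * ℕ→ℝ x) - 1ℝ)

IsPowerAbove2 : (ℕ → ℝ) → Set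
IsPowerAbove2 f = ∃ λ β → ℕ→ℝ 2 < β × (∀ x → f x ≈ x ^ β)

{-# OPTIONS --safe #-}

-- Summing d v over the ordered pairs of adjacent vertices gives Σ d² ≤ m (m + 1),
-- because d u + d v ≤ m + 1 for every edge uv.  If x ↦ f x / x is convex, then f
-- lies on [1, m] below x times the chord of f x / x through 1 and m, so that
-- Σ f (d v) is bounded by a combination of Σ d = 2m and Σ d² which equals
-- f m + m f 1, the value of the star.  A graph without a vertex of degree m is
-- not a star, and for it the inequality is strict.
--
-- The chord condition is checked exactly on rational approximations and term by
-- term, so that strictness is uniform in the precision: for e^{λx} - 1 on the
-- terms (λx)ʲ/j!, and for x^{2+δ} on the terms x² (δ log x)ʲ/j!, where it says
-- that x log x / (x - 1) increases.  The second case needs exp (2 log x) = x² in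
-- the limit.
module Submission where

open import Defs hiding (_≈_; _≤_; _<_; _+_; _-_; _*_; -_; _^_)
import Defs as ℝ
open import Algebra.Bundles using (CommutativeRing)
open import Data.Bool.Base using (Bool; true; false; _∧_; _∨_; if_then_else_)
open import Data.Bool.Properties using (∨-identityʳ)
open import Data.Fin.Base using (Fin; zero; suc; toℕ; fromℕ; punchIn; punchOut)
import Data.Fin.Permutation as Perm
import Data.Fin.Properties as Fin
open import Data.Fin.Subset using (∣_∣)
open import Data.Nat.Base as ℕ using (ℕ; zero; suc; z≤n; s≤s; s≤s⁻¹)
import Data.Nat.Properties as ℕ
import Data.Nat.Solver as ℕ
open import Data.Product.Base using (_,_; ∃; proj₁; proj₂)
open import Data.Rational.Base as ℚ using (ℚ; 0ℚ; 1ℚ)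
import Data.Rational.Properties as ℚ
import Data.Rational.Solver as ℚ
open import Data.Sum.Base using (_⊎_; inj₁; inj₂)
open import Data.Vec.Base using (tabulate)
open import Function.Base using (_∘_)
open import Function.Bundles using (_↔_; Inverse)
open import Relation.Binary.PropositionalEquality
open import Relation.Nullary using (¬_; yes; no; does; contradiction)

-- The order of Cauchy reals is not decidable, so no proof step decides how two sums of `f` compare.
-- The case distinction is made on the graph: its degrees tell whether it is the star, and if not
-- they point at a term bounded below by a positive rational `η`. There are two sources of such a
-- term, because m (m - 1) times the gap to the star is exactly the sum of the slacks plus (m (m +
-- 1) - Σ d²) (f m - m f 1). The slack vanishes at the degrees 0, 1 and m, so a degree strictly
-- between 1 and m feeds the first summand, while a graph of maximum degree 1 can only use the
-- second.
--
-- A strict inequality between reals is a rational margin valid from some index on, so `η` must not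
-- depend on the precision k. It is built from a rational e below all late approximations of λ, or
-- of β - 2. For powers the chord inequality holds at each precision because the two estimates of
-- log behind it are already true of the right Riemann sums. The factor x² is split off exactly
-- since its slack is zero, which leaves all slack to the logarithm; at finite precision the partial
-- sums for β log x do not factor in this way, whence the passage to the limit.

-- Degree sums, the shapes of a graph, and stars.

module DegreeSums where

  open import Data.Nat.Base using (_+_; _*_; _≤_; _<_; _<ᵇ_)
  open import Algebra.Properties.Semiring.Sum ℕ.+-*-semiring
    using (sum; sum-cong-≗; sum-replicate-zero; ∑-distrib-+; ∑-comm; *-distribʳ-sum; sum-permute; sum-remove)
  open ℕ.≤-Reasoning

  𝟙 : Bool → ℕ
  𝟙 true  = 1
  𝟙 false = 0

  𝟙≤1 : ∀ b → 𝟙 b ≤ 1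
  𝟙≤1 true  = ℕ.≤-refl
  𝟙≤1 false = z≤n

  sum-mono : ∀ {n} {f g : Fin n → ℕ} → (∀ i → f i ≤ g i) → sum f ≤ sum g
  sum-mono {zero}  f≤g = z≤n
  sum-mono {suc n} f≤g = ℕ.+-mono-≤ (f≤g zero) (sum-mono (f≤g ∘ suc))

  sum-mono-injective : ∀ {n} {f g : Fin n → ℕ} → (∀ i → f i ≤ g i) → sum g ≤ sum f → ∀ i → f i ≡ g i
  sum-mono-injective {suc n} {f} {g} f≤g ∑g≤∑f = λ
    { zero    → head≡
    ; (suc i) → sum-mono-injective (f≤g ∘ suc) (ℕ.+-cancelˡ-≤ (g zero) _ _
                  (subst (λ z → g zero + sum (g ∘ suc) ≤ z + sum (f ∘ suc)) head≡ ∑g≤∑f)) i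
    }
    where
      head≡ : f zero ≡ g zero
      head≡ = ℕ.≤-antisym (f≤g zero) (ℕ.+-cancelʳ-≤ (sum (g ∘ suc)) _ _
        (ℕ.≤-trans ∑g≤∑f (ℕ.+-monoʳ-≤ (f zero) (sum-mono (f≤g ∘ suc)))))

  only : ∀ {n} → Fin n → (Fin n → ℕ) → Fin n → ℕ
  only v f w = if does (v Fin.≟ w) then f w else 0

  sum-only : ∀ {n} (v : Fin n) f → sum (only v f) ≡ f v
  sum-only {suc n} zero f = trans (cong (f zero +_) (sum-replicate-zero n)) (ℕ.+-identityʳ (f zero))
  sum-only (suc v)      f = sum-only v (f ∘ suc)

  count-sum : ∀ {n} (p : Fin n → Bool) → ∣ tabulate p ∣ ≡ sum (𝟙 ∘ p)
  count-sum {zero}  p = refl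
  count-sum {suc n} p with p zero
  ... | true  = cong suc (count-sum (p ∘ suc))
  ... | false = count-sum (p ∘ suc)

  degree-sum : ∀ {n} (G : Graph n) v → degrees G v ≡ sum (λ w → 𝟙 (adj G v w))
  degree-sum G v = count-sum (adj G v)

  -- `edgeCount` counts an edge from its smaller end. Each ordered adjacent pair is increasing or
  -- decreasing, and transposing the double sum turns the decreasing pairs into the increasing ones.
  handshake : ∀ {n} (G : Graph n) → sum (degrees G) ≡ edgeCount G + edgeCount G
  handshake {n} G = begin-equality
    sum (degrees G)                                  ≡⟨ sum-cong-≗ (degree-sum G) ⟩
    sum (λ i → sum (λ j → 𝟙 (adj G i j)))            ≡⟨ sum-cong-≗ (λ i → sum-cong-≗ (split i)) ⟩
    sum (λ i → sum (λ j → up i j + up j i))          ≡⟨ sum-cong-≗ (λ i → ∑-distrib-+ (up i) (λ j → up j i)) ⟩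
    sum (λ i → sum (up i) + sum (λ j → up j i))      ≡⟨ ∑-distrib-+ (sum ∘ up) (λ i → sum (λ j → up j i)) ⟩
    sum (sum ∘ up) + sum (λ i → sum (λ j → up j i))  ≡⟨ cong (sum (sum ∘ up) +_) (∑-comm up) ⟨
    sum (sum ∘ up) + sum (sum ∘ up)                  ≡⟨ cong₂ _+_ edges edges ⟩
    edgeCount G + edgeCount G                        ∎
    where
      up : Fin n → Fin n → ℕ
      up i j = 𝟙 ((toℕ i <ᵇ toℕ j) ∧ adj G i j)
      edges : sum (sum ∘ up) ≡ edgeCount G
      edges = sum-cong-≗ (λ i → sym (count-sum (λ j → (toℕ i <ᵇ toℕ j) ∧ adj G i j)))
      orient : ∀ a b c → (a ≡ b → c ≡ false) → 𝟙 c ≡ 𝟙 ((a <ᵇ b) ∧ c) + 𝟙 ((b <ᵇ a) ∧ c)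
      orient zero    zero    c h = cong 𝟙 (h refl)
      orient zero    (suc b) c h = sym (ℕ.+-identityʳ (𝟙 c))
      orient (suc a) zero    c h = refl
      orient (suc a) (suc b) c h = orient a b c (h ∘ cong suc)
      split : ∀ i j → 𝟙 (adj G i j) ≡ up i j + up j i
      split i j = trans
        (orient (toℕ i) (toℕ j) (adj G i j) λ i≡j →
          trans (cong (adj G i) (sym (Fin.toℕ-injective i≡j))) (irreflexive G i))
        (cong (λ z → up i j + 𝟙 ((toℕ j <ᵇ toℕ i) ∧ z)) (symmetric G i j))

  adj≤degree : ∀ {n} (G : Graph n) v w → 𝟙 (adj G v w) ≤ degrees G v
  adj≤degree G v w = begin
    𝟙 (adj G v w)                           ≡⟨ sum-only w (𝟙 ∘ adj G v) ⟨
    sum (only w (𝟙 ∘ adj G v))              ≤⟨ sum-mono pointwise ⟩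
    sum (𝟙 ∘ adj G v)                       ≡⟨ degree-sum G v ⟨
    degrees G v                             ∎
    where
      pointwise : ∀ x → only w (𝟙 ∘ adj G v) x ≤ 𝟙 (adj G v x)
      pointwise x with w Fin.≟ x
      ... | yes _ = ℕ.≤-refl
      ... | no  _ = z≤n

  adj+adj≤degree : ∀ {n} (G : Graph n) v {w x} → w ≢ x → 𝟙 (adj G v w) + 𝟙 (adj G v x) ≤ degrees G v
  adj+adj≤degree G v {w} {x} w≢x = begin
    𝟙 (adj G v w) + 𝟙 (adj G v x)           ≡⟨ cong₂ _+_ (sum-only w a) (sum-only x a) ⟨
    sum (only w a) + sum (only x a)         ≡⟨ ∑-distrib-+ (only w a) (only x a) ⟨
    sum (λ y → only w a y + only x a y)     ≤⟨ sum-mono pointwise ⟩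
    sum a                                   ≡⟨ degree-sum G v ⟨
    degrees G v                             ∎
    where
      a = 𝟙 ∘ adj G v
      pointwise : ∀ y → only w a y + only x a y ≤ a y
      pointwise y with w Fin.≟ y | x Fin.≟ y
      ... | yes refl | yes refl = contradiction refl w≢x
      ... | yes _    | no _     = ℕ.≤-reflexive (ℕ.+-identityʳ (a y))
      ... | no _     | yes _    = ℕ.≤-refl
      ... | no _     | no _     = z≤n

  adjacent⇒≢ : ∀ {n} (G : Graph n) {v w} → adj G v w ≡ true → v ≢ w
  adjacent⇒≢ G {v} vw refl with () ← trans (sym vw) (irreflexive G v)

  module _ {n} (G : Graph n) {m} (G∈ : G ∈𝔾 m) where

    private
      d = degrees G

    sum-degrees : sum d ≡ m + m
    sum-degrees = trans (handshake G) (cong₂ _+_ G∈ G∈)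

    -- Counting the edges at v and at w from both of their ends shows
    -- 2 (d v + d w) ≤ Σ d + 2, where the 2 accounts for the edge vw.
    edge-degree-sum : ∀ {v w} → adj G v w ≡ true → d v + d w ≤ suc m
    edge-degree-sum {v} {w} vw = ℕ.*-cancelˡ-≤ 2 (begin
      2 * (d v + d w)
        ≡⟨ solve 2 (λ a b → con 2 :* (a :+ b) := (a :+ b) :+ (a :+ b)) refl (d v) (d w) ⟩
      (d v + d w) + (d v + d w)
        ≡⟨ cong₂ _+_ (cong₂ _+_ (column v) (column w)) (sym (cong₂ _+_ (sum-only v d) (sum-only w d))) ⟩
      (sum (c v) + sum (c w)) + (sum (only v d) + sum (only w d))
        ≡⟨ cong₂ _+_ (∑-distrib-+ (c v) (c w)) (∑-distrib-+ (only v d) (only w d)) ⟨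
      sum (λ x → c v x + c w x) + sum (λ x → only v d x + only w d x)
        ≡⟨ ∑-distrib-+ (λ x → c v x + c w x) (λ x → only v d x + only w d x) ⟨
      sum (λ x → (c v x + c w x) + (only v d x + only w d x))
        ≤⟨ sum-mono pointwise ⟩
      sum (λ x → d x + (only v one x + only w one x))
        ≡⟨ trans (∑-distrib-+ d _) (cong (sum d +_) (∑-distrib-+ (only v one) (only w one))) ⟩
      sum d + (sum (only v one) + sum (only w one))
        ≡⟨ cong₂ _+_ sum-degrees (cong₂ _+_ (sum-only v one) (sum-only w one)) ⟩
      (m + m) + 2
        ≡⟨ solve 1 (λ m → (m :+ m) :+ con 2 := con 2 :* (con 1 :+ m)) refl m ⟩
      2 * suc m  ∎)
      where
        open ℕ.+-*-Solver
        one : Fin n → ℕ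
        one _ = 1
        c : Fin n → Fin n → ℕ
        c u x = 𝟙 (adj G x u)
        column : ∀ u → d u ≡ sum (c u)
        column u = trans (degree-sum G u) (sum-cong-≗ (λ x → cong 𝟙 (symmetric G u x)))
        v≢w = adjacent⇒≢ G vw
        pointwise : ∀ x → (c v x + c w x) + (only v d x + only w d x) ≤ d x + (only v one x + only w one x)
        pointwise x with v Fin.≟ x | w Fin.≟ x
        ... | yes refl | yes refl = contradiction refl v≢w
        ... | yes refl | no _ = begin
          (𝟙 (adj G v v) + 𝟙 (adj G v w)) + (d v + 0)
            ≡⟨ cong₂ (λ a b → (𝟙 a + 𝟙 b) + (d v + 0)) (irreflexive G v) vw ⟩
          1 + (d v + 0)  ≡⟨ solve 1 (λ a → con 1 :+ (a :+ con 0) := a :+ con 1) refl (d v) ⟩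
          d v + 1        ∎
        ... | no _ | yes refl = begin
          (𝟙 (adj G w v) + 𝟙 (adj G w w)) + d w
            ≡⟨ cong₂ (λ a b → (𝟙 a + 𝟙 b) + d w) (trans (symmetric G w v) vw) (irreflexive G w) ⟩
          1 + d w        ≡⟨ ℕ.+-comm 1 (d w) ⟩
          d w + 1        ∎
        ... | no _ | no _ = ℕ.+-monoˡ-≤ 0 (adj+adj≤degree G x v≢w)

    private
      -- Summed over `w`, the left side counts the edges at `v` from both of their ends. This gives
      -- 2 d v ≤ Σ d = 2m, and its equality case gives the structure of a star.
      column≤ : ∀ v w → only v d w + 𝟙 (adj G v w) ≤ d w
      column≤ v w with v Fin.≟ w
      ... | yes refl = ℕ.≤-reflexive (trans (cong (λ b → d v + 𝟙 b) (irreflexive G v)) (ℕ.+-identityʳ (d v)))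
      ... | no _     = subst (λ b → 𝟙 b ≤ d w) (symmetric G w v) (adj≤degree G w v)

      sum-column : ∀ v → sum (λ w → only v d w + 𝟙 (adj G v w)) ≡ d v + d v
      sum-column v = trans (∑-distrib-+ (only v d) (𝟙 ∘ adj G v))
        (cong₂ _+_ (sum-only v d) (sym (degree-sum G v)))

    degree≤edges : ∀ v → d v ≤ m
    degree≤edges v = ℕ.*-cancelˡ-≤ 2 (begin
      2 * d v     ≡⟨ cong (d v +_) (ℕ.+-identityʳ (d v)) ⟩
      d v + d v   ≡⟨ sum-column v ⟨
      sum (λ w → only v d w + 𝟙 (adj G v w))  ≤⟨ sum-mono (column≤ v) ⟩
      sum d       ≡⟨ sum-degrees ⟩
      m + m       ≡⟨ cong (m +_) (ℕ.+-identityʳ m) ⟨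
      2 * m       ∎)

    -- If d c = m, the two sides of `column≤` have the same sum, so they agree at every vertex: no
    -- degree is left for edges avoiding `c`.
    degrees-star : ∀ {c} → d c ≡ m → ∀ {w} → c ≢ w → d w ≡ 𝟙 (adj G c w)
    degrees-star {c} dc≡m {w} c≢w = trans (sym (sum-mono-injective (column≤ c) total w)) off-centre
      where
        total : sum d ≤ sum (λ w → only c d w + 𝟙 (adj G c w))
        total = ℕ.≤-reflexive (trans sum-degrees (trans (sym (cong₂ _+_ dc≡m dc≡m)) (sym (sum-column c))))
        off-centre : only c d w + 𝟙 (adj G c w) ≡ 𝟙 (adj G c w)
        off-centre with c Fin.≟ w
        ... | yes c≡w = contradiction c≡w c≢w
        ... | no _    = refl

    -- The degree of `v` is already used up by its possible edge to `c`, so a second neighbour `w`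
    -- would exceed it.
    leaves-independent : ∀ {c} → d c ≡ m → ∀ {v w} → c ≢ v → c ≢ w → adj G v w ≡ false
    leaves-independent {c} dc≡m {v} {w} c≢v c≢w = zero⇒false (adj G v w) (ℕ.+-cancelˡ-≤ (𝟙 (adj G v c)) _ _ (begin
      𝟙 (adj G v c) + 𝟙 (adj G v w)  ≤⟨ adj+adj≤degree G v c≢w ⟩
      d v                            ≡⟨ degrees-star dc≡m c≢v ⟩
      𝟙 (adj G c v)                  ≡⟨ cong 𝟙 (symmetric G c v) ⟩
      𝟙 (adj G v c)                  ≡⟨ ℕ.+-identityʳ _ ⟨
      𝟙 (adj G v c) + 0              ∎))
      where
        zero⇒false : ∀ b → 𝟙 b ≤ 0 → b ≡ false
        zero⇒false false _ = refl

    -- Σ d² is the sum over the edges of the degrees of both endpoints.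
    sum-degrees² : sum (λ v → d v * d v) ≤ m * suc m
    sum-degrees² = ℕ.*-cancelˡ-≤ 2 (begin
      2 * sum (λ v → d v * d v)
        ≡⟨ cong (sum (λ v → d v * d v) +_) (ℕ.+-identityʳ _) ⟩
      sum (λ v → d v * d v) + sum (λ v → d v * d v)
        ≡⟨ cong₂ _+_ rows (trans rows (trans (∑-comm (λ v w → 𝟙 (adj G v w) * d v)) swap)) ⟩
      sum (λ v → sum (λ w → 𝟙 (adj G v w) * d v)) + sum (λ v → sum (λ w → 𝟙 (adj G v w) * d w))
        ≡⟨ trans (sum-cong-≗ (λ v → ∑-distrib-+ (λ w → 𝟙 (adj G v w) * d v) (λ w → 𝟙 (adj G v w) * d w)))
             (∑-distrib-+ _ (λ v → sum (λ w → 𝟙 (adj G v w) * d w))) ⟨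
      sum (λ v → sum (λ w → 𝟙 (adj G v w) * d v + 𝟙 (adj G v w) * d w))
        ≤⟨ sum-mono (λ v → sum-mono (pointwise v)) ⟩
      sum (λ v → sum (λ w → 𝟙 (adj G v w) * suc m))
        ≡⟨ sum-cong-≗ (λ v → trans (cong (_* suc m) (degree-sum G v)) (*-distribʳ-sum (suc m) (𝟙 ∘ adj G v))) ⟨
      sum (λ v → d v * suc m)
        ≡⟨ *-distribʳ-sum (suc m) d ⟨
      sum d * suc m
        ≡⟨ cong (_* suc m) sum-degrees ⟩
      (m + m) * suc m
        ≡⟨ solve 1 (λ m → (m :+ m) :* (con 1 :+ m) := con 2 :* (m :* (con 1 :+ m))) refl m ⟩
      2 * (m * suc m)  ∎)
      where
        open ℕ.+-*-Solver
        rows : sum (λ v → d v * d v) ≡ sum (λ v → sum (λ w → 𝟙 (adj G v w) * d v))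
        rows = sum-cong-≗ (λ v → trans (cong (_* d v) (degree-sum G v)) (*-distribʳ-sum (d v) (𝟙 ∘ adj G v)))
        swap : sum (λ w → sum (λ v → 𝟙 (adj G v w) * d v)) ≡ sum (λ v → sum (λ w → 𝟙 (adj G v w) * d w))
        swap = sum-cong-≗ (λ v → sum-cong-≗ (λ w → cong (λ b → 𝟙 b * d w) (symmetric G w v)))
        pointwise : ∀ v w → 𝟙 (adj G v w) * d v + 𝟙 (adj G v w) * d w ≤ 𝟙 (adj G v w) * suc m
        pointwise v w with adj G v w in vw
        ... | false = z≤n
        ... | true  = begin
          1 * d v + 1 * d w  ≡⟨ ℕ.*-distribˡ-+ 1 (d v) (d w) ⟨
          1 * (d v + d w)    ≤⟨ ℕ.*-monoʳ-≤ 1 (edge-degree-sum vw) ⟩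
          1 * suc m          ∎

  -- With m the number of edges, a vertex of degree m lies on every edge.
  data Shape {n} (G : Graph n) (m : ℕ) : Set where
    star     : ∀ c → degrees G c ≡ m → Shape G m
    middle   : 2 ≤ m → ∀ v → 2 ≤ degrees G v → degrees G v < m → Shape G m
    matching : 2 ≤ m → sum (λ v → degrees G v * degrees G v) ≤ m + m → Shape G m

  -- The cases are found by searching the finite vertex set. If no degree is m and none is at least
  -- 2, all are 0 or 1, so that Σ d² is at most Σ d = 2m.
  shape : ∀ {n} (G : Graph (suc n)) {m} → G ∈𝔾 m → Shape G m
  shape {n} G {m} G∈ with Fin.any? (λ v → degrees G v ℕ.≟ m)
  ... | yes (c , dc≡m) = star c dc≡m
  ... | no  ¬star with Fin.any? (λ v → 2 ℕ.≤? degrees G v)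
  ...   | yes (v , 2≤dv) = middle (ℕ.≤-trans 2≤dv (degree≤edges G G∈ v)) v 2≤dv
            (ℕ.≤∧≢⇒< (degree≤edges G G∈ v) (λ dv≡m → ¬star (v , dv≡m)))
  ...   | no  ¬2≤d = matching (2≤m m refl) (begin
            sum (λ v → d v * d v)  ≤⟨ sum-mono (λ v → ℕ.*-monoʳ-≤ (d v) (d≤1 v)) ⟩
            sum (λ v → d v * 1)    ≡⟨ sum-cong-≗ (λ v → ℕ.*-identityʳ (d v)) ⟩
            sum d                  ≡⟨ sum-degrees G G∈ ⟩
            m + m                  ∎)
    where
      d = degrees G
      d≤1 : ∀ v → d v ≤ 1
      d≤1 v = ℕ.≮⇒≥ (λ 2≤dv → ¬2≤d (v , 2≤dv))
      -- For m = 0 any vertex has degree m, and `suc n` supplies one. For m = 1 all degrees would be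
      -- 0, against Σ d = 2. The extra variable `k` allows matching on the number of edges.
      2≤m : ∀ k → k ≡ m → 2 ≤ k
      2≤m zero          refl = contradiction (zero , ℕ.n≤0⇒n≡0 (degree≤edges G G∈ zero)) ¬star
      2≤m (suc zero)    refl with () ← trans (sym (sum-degrees G G∈))
        (trans (sum-cong-≗ {suc n} (λ v → ℕ.n<1⇒n≡0 (ℕ.≤∧≢⇒< (degree≤edges G G∈ v) (λ dv≡1 → ¬star (v , dv≡1)))))
          (sum-replicate-zero (suc n)))
      2≤m (suc (suc k)) _ = s≤s (s≤s z≤n)

  -- Isomorphism with the quasi-star, and its degrees.

  insert-self : ∀ {m n} i j (φ : Perm.Permutation m n) → Inverse.to (Perm.insert i j φ) i ≡ j
  insert-self i j φ with i Fin.≟ i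
  ... | yes _  = refl
  ... | no i≢i = contradiction refl i≢i

  toℕ-punchIn-last : ∀ {n} (i : Fin n) → toℕ (punchIn (fromℕ n) i) ≡ toℕ i
  toℕ-punchIn-last zero    = refl
  toℕ-punchIn-last (suc i) = cong suc (toℕ-punchIn-last i)

  ≤⇒<ᵇ-false : ∀ {m n} → m ≤ n → (n <ᵇ m) ≡ false
  ≤⇒<ᵇ-false z≤n       = refl
  ≤⇒<ᵇ-false (s≤s m≤n) = ≤⇒<ᵇ-false m≤n

  sum-𝟙≤ : ∀ {n} (p : Fin n → Bool) → sum (𝟙 ∘ p) ≤ n
  sum-𝟙≤ {zero}  p = z≤n
  sum-𝟙≤ {suc n} p = ℕ.+-mono-≤ (𝟙≤1 (p zero)) (sum-𝟙≤ (p ∘ suc))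

  -- The true positions are moved to the front. A true head stays first; a false head is sent to the
  -- last place, which leaves the numbers of all other vertices unchanged.
  sort : ∀ {n} (p : Fin n → Bool) →
    ∃ λ (φ : Fin n ↔ Fin n) → ∀ i → p i ≡ (toℕ (Inverse.to φ i) <ᵇ sum (𝟙 ∘ p))
  sort {zero}  p = Perm.id , λ ()
  sort {suc n} p with p zero in p0 | sort (p ∘ suc)
  ... | true  | φ , sorted = Perm.lift₀ φ , λ { zero → p0 ; (suc i) → sorted i }
  ... | false | φ , sorted = Perm.insert zero (fromℕ n) φ , λ
    { zero    → trans p0 (sym (trans (cong (_<ᵇ s) (Fin.toℕ-fromℕ n)) (≤⇒<ᵇ-false (sum-𝟙≤ (p ∘ suc)))))
    ; (suc i) → trans (sorted i) (cong (_<ᵇ s) (sym (toℕ-punchIn-last (Inverse.to φ i))))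
    }
    where s = sum (𝟙 ∘ p ∘ suc)

  -- The centre goes to vertex 0, and the other vertices are sorted so that the neighbours of `c`
  -- receive the numbers 1, ..., m.
  star≅QS : ∀ {n} (G : Graph (suc n)) {m} → G ∈𝔾 m → .(m<n : m < suc n) →
    ∀ c → degrees G c ≡ m → G ≅ QS (suc n) m m<n
  star≅QS {n} G {m} G∈ m<n c dc≡m = π , same
    where
      p : Fin n → Bool
      p k = adj G c (punchIn c k)
      φ = proj₁ (sort p)
      π = Perm.insert c zero φ
      f : Fin (suc n) → ℕ
      f i = toℕ (Inverse.to π i)
      ∑p≡m : sum (𝟙 ∘ p) ≡ m
      ∑p≡m = trans (cong (λ b → 𝟙 b + sum (𝟙 ∘ p)) (sym (irreflexive G c)))
        (trans (sym (sum-remove {i = c} (𝟙 ∘ adj G c))) (trans (sym (degree-sum G c)) dc≡m))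
      f-centre : f c ≡ 0
      f-centre = cong toℕ (insert-self c zero φ)
      f-leaf : ∀ k → f (punchIn c k) ≡ suc (toℕ (Inverse.to φ k))
      f-leaf k = cong toℕ (Perm.insert-punchIn c zero φ k)
      sorted : ∀ k → p k ≡ (toℕ (Inverse.to φ k) <ᵇ m)
      sorted k = trans (proj₂ (sort p) k) (cong (toℕ (Inverse.to φ k) <ᵇ_) ∑p≡m)
      spokes : ℕ → ℕ → Bool
      spokes a b = isSpoke m a b ∨ isSpoke m b a
      data Position : Fin (suc n) → Set where
        centre : Position c
        leaf   : ∀ k → Position (punchIn c k)
      position : ∀ i → Position i
      position i with c Fin.≟ i
      ... | yes refl = centre
      ... | no c≢i   = subst Position (Fin.punchIn-punchOut c≢i) (leaf (punchOut c≢i))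
      same : ∀ i j → adj G i j ≡ spokes (f i) (f j)
      same i j with position i | position j
      ... | centre | centre =
        trans (irreflexive G c) (sym (cong₂ spokes f-centre f-centre))
      ... | centre | leaf k =
        trans (sorted k) (trans (sym (∨-identityʳ _)) (sym (cong₂ spokes f-centre (f-leaf k))))
      ... | leaf k | centre =
        trans (symmetric G _ c) (trans (sorted k) (sym (cong₂ spokes (f-leaf k) f-centre)))
      ... | leaf k | leaf l =
        trans (leaves-independent G G∈ dc≡m (≢leaf k) (≢leaf l)) (sym (cong₂ spokes (f-leaf k) (f-leaf l)))
        where
          ≢leaf : ∀ k → c ≢ punchIn c k
          ≢leaf k = Fin.punchInᵢ≢i c k ∘ sym

  degrees-≅ : ∀ {n} {G H : Graph n} ((φ , _) : G ≅ H) → ∀ i → degrees G i ≡ degrees H (Inverse.to φ i)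
  degrees-≅ {_} {G} {H} (φ , same) i = begin-equality
    degrees G i                                              ≡⟨ degree-sum G i ⟩
    sum (λ j → 𝟙 (adj G i j))                                ≡⟨ sum-cong-≗ (λ j → cong 𝟙 (same i j)) ⟩
    sum (λ j → 𝟙 (adj H (Inverse.to φ i) (Inverse.to φ j)))  ≡⟨ sum-permute (𝟙 ∘ adj H (Inverse.to φ i)) φ ⟨
    sum (𝟙 ∘ adj H (Inverse.to φ i))                         ≡⟨ degree-sum H (Inverse.to φ i) ⟨
    degrees H (Inverse.to φ i)                               ∎

  sum-initial : ∀ {m n} → m ≤ n → sum {n} (λ j → 𝟙 (toℕ j <ᵇ m)) ≡ m
  sum-initial {n = n} z≤n = sum-replicate-zero n
  sum-initial (s≤s m≤n)   = cong suc (sum-initial m≤n)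

  module _ {n m} (m≤n : m ≤ n) where

    private
      Q = QS (suc n) m (s≤s m≤n)

    degree-QS-centre : degrees Q zero ≡ m
    degree-QS-centre = trans (degree-sum Q zero)
      (trans (sum-cong-≗ {n} (λ j → cong 𝟙 (∨-identityʳ (toℕ j <ᵇ m)))) (sum-initial m≤n))

    degree-QS-leaf : ∀ j → degrees Q (suc j) ≡ 𝟙 (toℕ j <ᵇ m)
    degree-QS-leaf j = trans (degree-sum Q (suc j))
      (trans (cong (𝟙 (toℕ j <ᵇ m) +_) (sum-replicate-zero n)) (ℕ.+-identityʳ _))

    -- Obtained from the degrees by `handshake`, which avoids evaluating the count over increasing
    -- pairs in `edgeCount`.
    QS∈𝔾 : Q ∈𝔾 m
    QS∈𝔾 = ℕ.*-cancelˡ-≡ _ _ 2 (begin-equality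
      2 * edgeCount Q                           ≡⟨ cong (edgeCount Q +_) (ℕ.+-identityʳ (edgeCount Q)) ⟩
      edgeCount Q + edgeCount Q                 ≡⟨ handshake Q ⟨
      sum (degrees Q)                           ≡⟨ cong₂ _+_ degree-QS-centre (sum-cong-≗ degree-QS-leaf) ⟩
      m + sum {n} (λ j → 𝟙 (toℕ j <ᵇ m))        ≡⟨ cong (m +_) (sum-initial m≤n) ⟩
      m + m                                     ≡⟨ cong (m +_) (ℕ.+-identityʳ m) ⟨
      2 * m                                     ∎)

-- The chord inequality for a rational function, and its transfer to real sums.

module ChordBound where

  open CauchyLemmas
  open DegreeSums
  open import Data.Rational.Base using (_+_; _*_; _-_; -_; _≤_; _<_) renaming (∣_∣ to abs)
  open import Algebra.Properties.Semiring.Sum ℕ.+-*-semiring using () renaming (sum to sumℕ)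
  open import Algebra.Properties.Semiring.Sum (CommutativeRing.semiring ℚ.+-*-commutativeRing)
    using (sum; sum-cong-≗; sum-permute)
  open ℚ.≤-Reasoning
  open ℚ.+-*-Solver

  ∑-linear₃ : ∀ {n} a b c (x y z : Fin n → ℚ) →
    sum (λ i → a * x i + b * y i + c * z i) ≡ a * sum x + b * sum y + c * sum z
  ∑-linear₃ {zero}  a b c x y z =
    solve 3 (λ a b c → con 0ℚ := a :* con 0ℚ :+ b :* con 0ℚ :+ c :* con 0ℚ) refl a b c
  ∑-linear₃ {suc n} a b c x y z = trans
    (cong (_+_ (a * x zero + b * y zero + c * z zero)) (∑-linear₃ a b c (x ∘ suc) (y ∘ suc) (z ∘ suc)))
    (solve 9 (λ a b c x y z X Y Z →
        (a :* x :+ b :* y :+ c :* z) :+ (a :* X :+ b :* Y :+ c :* Z)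
        := a :* (x :+ X) :+ b :* (y :+ Y) :+ c :* (z :+ Z))
      refl a b c (x zero) (y zero) (z zero) (sum (x ∘ suc)) (sum (y ∘ suc)) (sum (z ∘ suc)))

  ℕ→ℚ-sum : ∀ {n} (f : Fin n → ℕ) → ℕ→ℚ (sumℕ f) ≡ sum (ℕ→ℚ ∘ f)
  ℕ→ℚ-sum {zero}  f = refl
  ℕ→ℚ-sum {suc n} f = trans (ℕ→ℚ-+ (f zero) _) (cong (_+_ (ℕ→ℚ (f zero))) (ℕ→ℚ-sum (f ∘ suc)))

  sum-nonNeg : ∀ {n} {f : Fin n → ℚ} → (∀ i → 0ℚ ≤ f i) → 0ℚ ≤ sum f
  sum-nonNeg {zero}  0≤f = ℚ.≤-refl
  sum-nonNeg {suc n} 0≤f = ℚ.+-mono-≤ (0≤f zero) (sum-nonNeg (0≤f ∘ suc))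

  term≤sum : ∀ {n} {f : Fin n → ℚ} → (∀ i → 0ℚ ≤ f i) → ∀ i → f i ≤ sum f
  term≤sum {f = f} 0≤f zero    = ≤-gap (sum (f ∘ suc)) (sum-nonNeg (0≤f ∘ suc)) refl
  term≤sum {f = f} 0≤f (suc i) = ℚ.≤-trans (term≤sum (0≤f ∘ suc) i)
    (≤-gap (f zero) (0≤f zero) (ℚ.+-comm (sum (f ∘ suc)) (f zero)))

  -- d m (m - 1) times the height at d of the chord of x ↦ F x / x over [1, m]
  -- above its graph.
  slack : (ℕ → ℚ) → ℕ → ℕ → ℚ
  slack F m d =
    (ℕ→ℚ m - ℕ→ℚ d) * ℕ→ℚ d * ℕ→ℚ m * F 1
      + (ℕ→ℚ d - 1ℚ) * ℕ→ℚ d * F m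
      - (ℕ→ℚ m - 1ℚ) * ℕ→ℚ m * F d

  -- `η` is a common margin for the two sources of strictness: an interior degree (`slack≥η`), and a
  -- value of Σ d² below m (m + 1) (`growth`, which makes the slope of the chord positive).
  record Chordal (F : ℕ → ℚ) (m : ℕ) (η : ℚ) : Set where
    field
      vanishes : F 0 ≡ 0ℚ
      slack≥0  : ∀ d → d ℕ.≤ m → 0ℚ ≤ slack F m d
      slack≥η  : ∀ d → 2 ℕ.≤ d → d ℕ.< m → η ≤ slack F m d
      growth   : 2 ℕ.≤ m → η ≤ F m - ℕ→ℚ m * F 1

  sum-QS : ∀ {n m} (m≤n : m ℕ.≤ n) (F : ℕ → ℚ) → F 0 ≡ 0ℚ →
    sum (F ∘ degrees (QS (suc n) m (s≤s m≤n))) ≡ F m + ℕ→ℚ m * F 1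
  sum-QS {n} {m} m≤n F F0≡0 = cong₂ _+_ (cong F (degree-QS-centre m≤n))
    (trans (sum-cong-≗ (λ j → cong F (degree-QS-leaf m≤n j)))
    (trans (indicator {n} (λ j → toℕ j ℕ.<ᵇ m)) (cong (λ z → ℕ→ℚ z * F 1) (sum-initial m≤n))))
    where
      indicator : ∀ {n} (p : Fin n → Bool) → sum (λ j → F (𝟙 (p j))) ≡ ℕ→ℚ (sumℕ (𝟙 ∘ p)) * F 1
      indicator {zero}  p = sym (ℚ.*-zeroˡ (F 1))
      indicator {suc n} p with p zero | indicator (p ∘ suc)
      ... | false | ih = trans (cong₂ _+_ F0≡0 ih) (ℚ.+-identityˡ _)
      ... | true  | ih = begin-equality
        F 1 + sum (λ j → F (𝟙 (p (suc j))))     ≡⟨ cong (F 1 +_) ih ⟩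
        F 1 + s * F 1                           ≡⟨ solve 2 (λ f s → f :+ s :* f := (con 1ℚ :+ s) :* f) refl (F 1) s ⟩
        (1ℚ + s) * F 1                          ≡⟨ cong (_* F 1) (ℕ→ℚ-suc (sumℕ (𝟙 ∘ p ∘ suc))) ⟨
        ℕ→ℚ (suc (sumℕ (𝟙 ∘ p ∘ suc))) * F 1    ∎
        where s = ℕ→ℚ (sumℕ (𝟙 ∘ p ∘ suc))

  module _ {n} (G : Graph n) {m} (G∈ : G ∈𝔾 m) (F : ℕ → ℚ) where

    private
      d  = degrees G
      M  = ℕ→ℚ m
      S₂ = ℕ→ℚ (sumℕ (λ v → d v ℕ.* d v))

    -- As a function of the degree d, the slack is a combination of d, d² and F d. Substituting Σ d
    -- = 2m makes the distance to the star an exact sum of two terms, each nonnegative under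
    -- `Chordal`.
    sum-slack : sum (slack F m ∘ d) + (M * (1ℚ + M) - S₂) * (F m - M * F 1) + (M - 1ℚ) * M * sum (F ∘ d)
      ≡ (M - 1ℚ) * M * (F m + M * F 1)
    sum-slack = begin-equality
      sum (slack F m ∘ d) + (M * (1ℚ + M) - S₂) * (F m - M * F 1) + (M - 1ℚ) * M * sum (F ∘ d)
        ≡⟨ cong (λ z → z + (M * (1ℚ + M) - S₂) * (F m - M * F 1) + (M - 1ℚ) * M * sum (F ∘ d)) linear ⟩
      (M * M * F 1 - F m) * (M + M) + (F m - M * F 1) * S₂ + - ((M - 1ℚ) * M) * sum (F ∘ d)
          + (M * (1ℚ + M) - S₂) * (F m - M * F 1) + (M - 1ℚ) * M * sum (F ∘ d)
        ≡⟨ solve 5 (λ m s f g t →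
             (m :* m :* f :- g) :* (m :+ m) :+ (g :- m :* f) :* s :+ :- ((m :- con 1ℚ) :* m) :* t
               :+ (m :* (con 1ℚ :+ m) :- s) :* (g :- m :* f) :+ (m :- con 1ℚ) :* m :* t
             := (m :- con 1ℚ) :* m :* (g :+ m :* f))
           refl M S₂ (F 1) (F m) (sum (F ∘ d)) ⟩
      (M - 1ℚ) * M * (F m + M * F 1)  ∎
      where
        D : Fin n → ℚ
        D v = ℕ→ℚ (d v)
        linear : sum (slack F m ∘ d)
          ≡ (M * M * F 1 - F m) * (M + M) + (F m - M * F 1) * S₂ + - ((M - 1ℚ) * M) * sum (F ∘ d)
        linear = begin-equality
          sum (slack F m ∘ d)
            ≡⟨ sum-cong-≗ (λ v → solve 5 (λ m d f g h →
                 (m :- d) :* d :* m :* f :+ (d :- con 1ℚ) :* d :* g :- (m :- con 1ℚ) :* m :* h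
                 := (m :* m :* f :- g) :* d :+ (g :- m :* f) :* (d :* d) :+ :- ((m :- con 1ℚ) :* m) :* h)
               refl M (D v) (F 1) (F m) (F (d v))) ⟩
          sum (λ v → (M * M * F 1 - F m) * D v + (F m - M * F 1) * (D v * D v) + - ((M - 1ℚ) * M) * F (d v))
            ≡⟨ ∑-linear₃ (M * M * F 1 - F m) (F m - M * F 1) (- ((M - 1ℚ) * M)) D (λ v → D v * D v) (F ∘ d) ⟩
          (M * M * F 1 - F m) * sum D + (F m - M * F 1) * sum (λ v → D v * D v) + - ((M - 1ℚ) * M) * sum (F ∘ d)
            ≡⟨ cong₂ (λ x y → (M * M * F 1 - F m) * x + (F m - M * F 1) * y + - ((M - 1ℚ) * M) * sum (F ∘ d))
                 (trans (sym (ℕ→ℚ-sum d)) (trans (cong ℕ→ℚ (sum-degrees G G∈)) (ℕ→ℚ-+ m m)))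
                 (trans (sum-cong-≗ (λ v → sym (ℕ→ℚ-* (d v) (d v)))) (sym (ℕ→ℚ-sum (λ v → d v ℕ.* d v)))) ⟩
          (M * M * F 1 - F m) * (M + M) + (F m - M * F 1) * S₂ + - ((M - 1ℚ) * M) * sum (F ∘ d)  ∎

    module _ {η} (0≤η : 0ℚ ≤ η) (chordal : Chordal F m η) where

      open Chordal chordal

      private
        deficit : 0ℚ ≤ M * (1ℚ + M) - S₂
        deficit = gap (begin
          S₂               ≤⟨ ℕ→ℚ-mono (sum-degrees² G G∈) ⟩
          ℕ→ℚ (m ℕ.* suc m)  ≡⟨ ℕ→ℚ-* m (suc m) ⟩
          M * ℕ→ℚ (suc m)  ≡⟨ cong (M *_) (ℕ→ℚ-suc m) ⟩
          M * (1ℚ + M)     ∎)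

        slacks≥0 : ∀ v → 0ℚ ≤ slack F m (d v)
        slacks≥0 v = slack≥0 (d v) (degree≤edges G G∈ v)

        excess : ℚ
        excess = sum (slack F m ∘ d) + (M * (1ℚ + M) - S₂) * (F m - M * F 1)

        conclude : η ≤ excess → (M - 1ℚ) * M * sum (F ∘ d) + η ≤ (M - 1ℚ) * M * (F m + M * F 1)
        conclude η≤excess = begin
          (M - 1ℚ) * M * sum (F ∘ d) + η         ≤⟨ ℚ.+-monoʳ-≤ ((M - 1ℚ) * M * sum (F ∘ d)) η≤excess ⟩
          (M - 1ℚ) * M * sum (F ∘ d) + excess    ≡⟨ ℚ.+-comm _ excess ⟩
          excess + (M - 1ℚ) * M * sum (F ∘ d)    ≡⟨ sum-slack ⟩
          (M - 1ℚ) * M * (F m + M * F 1)         ∎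

      middle-bound : 2 ℕ.≤ m → ∀ v → 2 ℕ.≤ d v → d v ℕ.< m →
        (M - 1ℚ) * M * sum (F ∘ d) + η ≤ (M - 1ℚ) * M * (F m + M * F 1)
      middle-bound 2≤m v 2≤dv dv<m = conclude (begin
        η                     ≤⟨ slack≥η (d v) 2≤dv dv<m ⟩
        slack F m (d v)       ≤⟨ term≤sum slacks≥0 v ⟩
        sum (slack F m ∘ d)   ≤⟨ ≤-gap _ (*-nonNeg deficit (ℚ.≤-trans 0≤η (growth 2≤m))) refl ⟩
        excess                ∎)

      -- Degrees 0 and 1 have no slack, so the gain has to come from the deficit m (m + 1) - Σ d²,
      -- which is a positive integer here, times the growth.
      matching-bound : 2 ℕ.≤ m → sumℕ (λ v → d v ℕ.* d v) ℕ.≤ m ℕ.+ m →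
        (M - 1ℚ) * M * sum (F ∘ d) + η ≤ (M - 1ℚ) * M * (F m + M * F 1)
      matching-bound 2≤m S₂≤2m = conclude (begin
        η                                        ≡⟨ ℚ.*-identityˡ η ⟨
        1ℚ * η                                   ≤⟨ *-mono (ℚ.nonNegative⁻¹ 1ℚ) (ℚ.≤-trans 0≤η (growth 2≤m)) 1≤deficit (growth 2≤m) ⟩
        (M * (1ℚ + M) - S₂) * (F m - M * F 1)    ≤⟨ ≤-gap _ (sum-nonNeg slacks≥0) (ℚ.+-comm _ (sum (slack F m ∘ d))) ⟩
        excess                                   ∎)
        where
          1+2m≤ : ∀ m → 2 ℕ.≤ m → suc (m ℕ.+ m) ℕ.≤ m ℕ.* suc m
          1+2m≤ (suc zero)    (s≤s ())
          -- With m = r + 2, the difference m (m + 1) - (2m + 1) is r² + 3r + 1.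
          1+2m≤ (suc (suc r)) _ = ℕ.≤-trans (ℕ.m≤m+n _ (r ℕ.* r ℕ.+ 3 ℕ.* r ℕ.+ 1)) (ℕ.≤-reflexive
            (ℕ.+-*-Solver.solve 1 (λ r → let open ℕ.+-*-Solver renaming (_:+_ to _⊕_; _:*_ to _⊗_; con to c; _:=_ to _≐_) in
              (c 1 ⊕ ((c 2 ⊕ r) ⊕ (c 2 ⊕ r))) ⊕ (r ⊗ r ⊕ c 3 ⊗ r ⊕ c 1) ≐ (c 2 ⊕ r) ⊗ (c 3 ⊕ r)) refl r))
          1≤deficit : 1ℚ ≤ M * (1ℚ + M) - S₂
          1≤deficit = begin
            1ℚ                        ≡⟨ solve 1 (λ s → con 1ℚ := (con 1ℚ :+ s) :- s) refl S₂ ⟩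
            (1ℚ + S₂) - S₂            ≡⟨ cong (_- S₂) (ℕ→ℚ-suc (sumℕ (λ v → d v ℕ.* d v))) ⟨
            ℕ→ℚ (suc (sumℕ (λ v → d v ℕ.* d v))) - S₂
              ≤⟨ ℚ.+-monoˡ-≤ (- S₂) (ℕ→ℚ-mono (ℕ.≤-trans (s≤s S₂≤2m) (1+2m≤ m 2≤m))) ⟩
            ℕ→ℚ (m ℕ.* suc m) - S₂    ≡⟨ cong (_- S₂) (trans (ℕ→ℚ-* m (suc m)) (cong (M *_) (ℕ→ℚ-suc m))) ⟩
            M * (1ℚ + M) - S₂         ∎

  approx-Σ : ∀ f {n} (d : Fin n → ℕ) k → approx (Σ[ f ] d) k ≡ sum (λ i → approx (f (d i)) k)
  approx-Σ f {zero}  d k = refl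
  approx-Σ f {suc n} d k = cong (_+_ (approx (f (d zero)) k)) (approx-Σ f (d ∘ suc) k)

  module _ (f : ℕ → ℝ) (F : ℕ → ℕ → ℚ)
    (F→f : ∀ x ε → 0ℚ < ε → ∃ λ N → ∀ k → N ℕ.≤ k → abs (approx (f x) k - F k x) ≤ ε) where

    Σ-limit : ∀ {n} (d : Fin n → ℕ) ε → 0ℚ < ε →
      ∃ λ N → ∀ k → N ℕ.≤ k → abs (approx (Σ[ f ] d) k - sum (F k ∘ d)) ≤ ε
    Σ-limit {zero}  d ε 0<ε = 0 , λ _ _ → ℚ.<⇒≤ 0<ε
    Σ-limit {suc n} d ε 0<ε =
      let (N₁ , h₁) = F→f (d zero) (ε * 1/suc 1) (0<half 0<ε)
          (N₂ , h₂) = Σ-limit (d ∘ suc) (ε * 1/suc 1) (0<half 0<ε)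
      in N₁ ℕ.⊔ N₂ , λ k N≤k →
        let a = approx (f (d zero)) k ; b = F k (d zero)
            x = approx (Σ[ f ] (d ∘ suc)) k ; y = sum (F k ∘ d ∘ suc)
        in begin
        abs (a + x - (b + y))
          ≡⟨ cong abs (solve 4 (λ a x b y → a :+ x :- (b :+ y) := (a :- b) :+ (x :- y)) refl a x b y) ⟩
        abs ((a - b) + (x - y))          ≤⟨ ℚ.∣p+q∣≤∣p∣+∣q∣ (a - b) (x - y) ⟩
        abs (a - b) + abs (x - y)        ≤⟨ ℚ.+-mono-≤ (h₁ k (ℕ.m⊔n≤o⇒m≤o N₁ N₂ N≤k)) (h₂ k (ℕ.m⊔n≤o⇒n≤o N₁ N₂ N≤k)) ⟩
        ε * 1/suc 1 + ε * 1/suc 1        ≡⟨ halves ε ⟩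
        ε                                ∎

    Σ-< : ∀ {n n′} (d : Fin n → ℕ) (d′ : Fin n′ → ℕ) {η} → 0ℚ < η →
      (∃ λ K → ∀ k → K ℕ.≤ k → sum (F k ∘ d) + η ≤ sum (F k ∘ d′)) → Σ[ f ] d ℝ.< Σ[ f ] d′
    Σ-< d d′ {η} 0<η (K , h) =
      -- One quarter of `η` pays for the approximation error of each sum, one is the margin that
      -- remains, and the last is given away by `≤-gap q`.
      let q = η * 1/suc 3
          0<q = *-pos 0<η (0<1/suc 3)
          (N₁ , h₁) = Σ-limit d q 0<q
          (N₂ , h₂) = Σ-limit d′ q 0<q
          N = K ℕ.⊔ (N₁ ℕ.⊔ N₂)
      in q , 0<q , N , λ k N≤k →
        let N₁₂≤k = ℕ.m⊔n≤o⇒n≤o K (N₁ ℕ.⊔ N₂) N≤k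
            a = approx (Σ[ f ] d) k ; b = sum (F k ∘ d)
            a′ = approx (Σ[ f ] d′) k ; b′ = sum (F k ∘ d′)
        in begin
        a + q                        ≡⟨ solve 3 (λ a b q → a :+ q := (a :- b) :+ (b :+ q)) refl a b q ⟩
        (a - b) + (b + q)            ≤⟨ ℚ.+-monoˡ-≤ (b + q) (ℚ.≤-trans (p≤∣p∣ (a - b)) (h₁ k (ℕ.m⊔n≤o⇒m≤o N₁ N₂ N₁₂≤k))) ⟩
        q + (b + q)                  ≡⟨ solve 2 (λ b e → e :* con (1/suc 3) :+ (b :+ e :* con (1/suc 3))
                                          := (b :+ e) :- (e :* con (1/suc 3) :+ e :* con (1/suc 3))) refl b η ⟩
        (b + η) - (q + q)            ≤⟨ ℚ.+-monoˡ-≤ (- (q + q)) (h k (ℕ.m⊔n≤o⇒m≤o K (N₁ ℕ.⊔ N₂) N≤k)) ⟩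
        b′ - (q + q)                 ≤⟨ ≤-gap q (ℚ.<⇒≤ 0<q) refl ⟩
        b′ - (q + q) + q             ≡⟨ solve 2 (λ b q → b :- (q :+ q) :+ q := b :- q) refl b′ q ⟩
        b′ - q                       ≤⟨ ℚ.+-monoʳ-≤ b′ (ℚ.neg-antimono-≤ (h₂ k (ℕ.m⊔n≤o⇒n≤o N₁ N₂ N₁₂≤k))) ⟩
        b′ - abs (a′ - b′)           ≤⟨ ℚ.+-monoʳ-≤ b′ (ℚ.neg-antimono-≤ (ℚ.≤-trans (p≤∣p∣ (b′ - a′)) (ℚ.≤-reflexive (abs-sym b′ a′)))) ⟩
        b′ - (b′ - a′)               ≡⟨ solve 2 (λ a b → b :- (b :- a) := a) refl a′ b′ ⟩
        a′                           ∎

  <⇒≤ : ∀ {x y} → x ℝ.< y → x ℝ.≤ y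
  <⇒≤ {x} {y} (δ , 0<δ , N , h) ε 0<ε = N , λ n N≤n → begin
    approx x n        ≤⟨ ≤-gap δ (ℚ.<⇒≤ 0<δ) refl ⟩
    approx x n + δ    ≤⟨ h n N≤n ⟩
    approx y n        ≤⟨ ≤-gap ε (ℚ.<⇒≤ 0<ε) refl ⟩
    approx y n + ε    ∎

  <⇒≱ : ∀ {x y} → x ℝ.< y → ¬ y ℝ.≤ x
  <⇒≱ {x} {y} (δ , 0<δ , N , h) y≤x =
    let (N′ , h′) = y≤x (δ * 1/suc 1) (0<half 0<δ)
        k = N ℕ.⊔ N′
        a = approx x k
        η = δ * 1/suc 1
    in ℚ.<-irrefl refl (ℚ.<-≤-trans (0<half 0<δ) (begin
      η                      ≡⟨ solve 2 (λ a d → d :* con (1/suc 1) := (a :+ d) :- (a :+ d :* con (1/suc 1))) refl a δ ⟩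
      (a + δ) - (a + η)      ≤⟨ ℚ.+-monoˡ-≤ (- (a + η)) (ℚ.≤-trans (h k (ℕ.m≤m⊔n N N′)) (h′ k (ℕ.m≤n⊔m N N′))) ⟩
      (a + η) - (a + η)      ≡⟨ ℚ.+-inverseʳ (a + η) ⟩
      0ℚ                     ∎))

  module _ (f : ℕ → ℝ) (F : ℕ → ℕ → ℚ)
    (F→f : ∀ x ε → 0ℚ < ε → ∃ λ N → ∀ k → N ℕ.≤ k → abs (approx (f x) k - F k x) ≤ ε)
    {n m} (m≤n : m ℕ.≤ n) {η} (0<η : 0ℚ < η)
    (chordal : ∃ λ K → ∀ k → K ℕ.≤ k → Chordal (F k) m η) where

    private
      Q = QS (suc n) m (s≤s m≤n)
      K = proj₁ chordal
      M = ℕ→ℚ m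

    -- The factor m (m - 1) is a positive natural number `suc l`, the same for every precision.
    -- Cancelling it leaves the margin `η * 1/suc l`, which still does not depend on `k`.
    below-QS : 2 ℕ.≤ m → (G : Graph (suc n)) →
      (∀ k → K ℕ.≤ k → (M - 1ℚ) * M * sum (F k ∘ degrees G) + η ≤ (M - 1ℚ) * M * (F k m + M * F k 1)) →
      Σ[ f ] (degrees G) ℝ.< Σ[ f ] (degrees Q)
    below-QS 2≤m G bound = Σ-< f F F→f (degrees G) (degrees Q) (*-pos 0<η (0<1/suc l))
      (K , λ k K≤k → ℚ.*-cancelˡ-≤-pos P {{ℚ.positive 0<P}} (begin
        P * (sum (F k ∘ degrees G) + η * 1/suc l)
          ≡⟨ trans (solve 4 (λ p s e r → p :* (s :+ e :* r) := p :* s :+ p :* (e :* r)) refl P (sum (F k ∘ degrees G)) η (1/suc l))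
               (cong (_+_ (P * sum (F k ∘ degrees G))) (trans (cong (_* (η * 1/suc l)) P≡) (scale l η))) ⟩
        P * sum (F k ∘ degrees G) + η
          ≤⟨ bound k K≤k ⟩
        P * (F k m + M * F k 1)
          ≡⟨ cong (P *_) (sum-QS m≤n (F k) (Chordal.vanishes (proj₂ chordal k K≤k))) ⟨
        P * sum (F k ∘ degrees Q)  ∎))
      where
        P = (M - 1ℚ) * M
        factors : ∀ m → 2 ℕ.≤ m → ∃ λ l → (ℕ→ℚ m - 1ℚ) * ℕ→ℚ m ≡ ℕ→ℚ (suc l)
        factors (suc zero)    (s≤s ())
        factors (suc (suc r)) _ = ℕ.pred (suc r ℕ.* suc (suc r)) , trans
          (cong (_* ℕ→ℚ (suc (suc r))) (trans (cong (_- 1ℚ) (ℕ→ℚ-suc (suc r)))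
            (solve 1 (λ x → (con 1ℚ :+ x) :- con 1ℚ := x) refl (ℕ→ℚ (suc r)))))
          (sym (ℕ→ℚ-* (suc r) (suc (suc r))))
        l   = proj₁ (factors m 2≤m)
        P≡  = proj₂ (factors m 2≤m)
        0<P : 0ℚ < P
        0<P = subst (0ℚ <_) (sym P≡) (0<ℕ→ℚsuc l)

    ≅⇒Σ≤ : (G : Graph (suc n)) → G ≅ Q → Σ[ f ] (degrees G) ℝ.≤ Σ[ f ] (degrees Q)
    ≅⇒Σ≤ G iso@(φ , _) ε 0<ε = 0 , λ k _ → begin
      approx (Σ[ f ] (degrees G)) k
        ≡⟨ trans (approx-Σ f (degrees G) k) (sum-cong-≗ (λ i → cong (λ z → approx (f z) k) (degrees-≅ {G = G} {H = Q} iso i))) ⟩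
      sum (λ i → approx (f (degrees Q (Inverse.to φ i))) k)
        ≡⟨ trans (approx-Σ f (degrees Q) k) (sum-permute (λ i → approx (f (degrees Q i)) k) φ) ⟨
      approx (Σ[ f ] (degrees Q)) k
        ≤⟨ ≤-gap ε (ℚ.<⇒≤ 0<ε) refl ⟩
      approx (Σ[ f ] (degrees Q)) k + ε  ∎

    -- This alternative yields both halves of the result. It bounds every sum, and a maximizer in
    -- the second case would lie strictly below the star.
    QS-or-less : (G : Graph (suc n)) → G ∈𝔾 m → G ≅ Q ⊎ Σ[ f ] (degrees G) ℝ.< Σ[ f ] (degrees Q)
    QS-or-less G G∈ with shape G G∈
    ... | star c dc≡m            = inj₁ (star≅QS G G∈ (s≤s m≤n) c dc≡m)
    ... | middle 2≤m v 2≤dv dv<m = inj₂ (below-QS 2≤m G λ k K≤k →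
            middle-bound G G∈ (F k) (ℚ.<⇒≤ 0<η) (proj₂ chordal k K≤k) 2≤m v 2≤dv dv<m)
    ... | matching 2≤m S₂≤2m     = inj₂ (below-QS 2≤m G λ k K≤k →
            matching-bound G G∈ (F k) (ℚ.<⇒≤ 0<η) (proj₂ chordal k K≤k) 2≤m S₂≤2m)

    chordal⇒uniquelyMaximizes : UniquelyMaximizes f m Q
    chordal⇒uniquelyMaximizes = (QS∈𝔾 m≤n , maximal) , unique
      where
        maximal : ∀ G → G ∈𝔾 m → Σ[ f ] (degrees G) ℝ.≤ Σ[ f ] (degrees Q)
        maximal G G∈ with QS-or-less G G∈
        ... | inj₁ iso  = ≅⇒Σ≤ G iso
        ... | inj₂ less = <⇒≤ {Σ[ f ] (degrees G)} {Σ[ f ] (degrees Q)} less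
        unique : ∀ G → Maximizes f m G → G ≅ Q
        unique G (G∈ , G-max) with QS-or-less G G∈
        ... | inj₁ iso  = iso
        ... | inj₂ less = contradiction (G-max Q (QS∈𝔾 m≤n)) (<⇒≱ {Σ[ f ] (degrees G)} {Σ[ f ] (degrees Q)} less)

-- Chordality term by term, and the exponential series.

module ChordalSeries where

  open CauchyLemmas
  open ChordBound
  open import Data.Rational.Base using (_+_; _*_; _-_; -_; _≤_; _<_; _⊓_)
  open ℚ.≤-Reasoning
  open ℚ.+-*-Solver

  ∑-nonNeg : ∀ n {f} → (∀ i → 0ℚ ≤ f i) → 0ℚ ≤ ∑<ℚ n f
  ∑-nonNeg zero    0≤f = ℚ.≤-refl
  ∑-nonNeg (suc n) 0≤f = ℚ.+-mono-≤ (∑-nonNeg n 0≤f) (0≤f n)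

  term≤∑ : ∀ n {f} → (∀ i → 0ℚ ≤ f i) → ∀ i → i ℕ.< n → f i ≤ ∑<ℚ n f
  term≤∑ (suc n) {f} 0≤f i i<1+n with ℕ.m≤n⇒m<n∨m≡n (s≤s⁻¹ i<1+n)
  ... | inj₁ i<n  = ℚ.≤-trans (term≤∑ n 0≤f i i<n) (≤-gap (f n) (0≤f n) refl)
  ... | inj₂ refl = ≤-gap (∑<ℚ n f) (∑-nonNeg n 0≤f) (ℚ.+-comm (f n) (∑<ℚ n f))

  series : (ℕ → ℕ → ℚ) → ℕ → ℕ → ℚ
  series t n x = ∑<ℚ n (λ j → t j x)

  slack-series : ∀ t n m d → slack (series t n) m d ≡ ∑<ℚ n (λ j → slack (t j) m d)
  slack-series t zero    m d = solve 2 (λ m d →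
    (m :- d) :* d :* m :* con 0ℚ :+ (d :- con 1ℚ) :* d :* con 0ℚ :- (m :- con 1ℚ) :* m :* con 0ℚ := con 0ℚ)
    refl (ℕ→ℚ m) (ℕ→ℚ d)
  slack-series t (suc n) m d = trans
    (solve 8 (λ m d a b c x y z →
        (m :- d) :* d :* m :* (a :+ x) :+ (d :- con 1ℚ) :* d :* (b :+ y) :- (m :- con 1ℚ) :* m :* (c :+ z)
        := ((m :- d) :* d :* m :* a :+ (d :- con 1ℚ) :* d :* b :- (m :- con 1ℚ) :* m :* c)
           :+ ((m :- d) :* d :* m :* x :+ (d :- con 1ℚ) :* d :* y :- (m :- con 1ℚ) :* m :* z))
      refl (ℕ→ℚ m) (ℕ→ℚ d) (series t n 1) (series t n m) (series t n d) (t n 1) (t n m) (t n d))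
    (cong (_+ slack (t n) m d) (slack-series t n m d))

  excess : (ℕ → ℚ) → ℕ → ℚ
  excess F m = F m - ℕ→ℚ m * F 1

  excess-series : ∀ t n m → excess (series t n) m ≡ ∑<ℚ n (λ j → excess (t j) m)
  excess-series t zero    m = solve 1 (λ m → con 0ℚ :- m :* con 0ℚ := con 0ℚ) refl (ℕ→ℚ m)
  excess-series t (suc n) m = trans
    (solve 5 (λ m a b x y → (a :+ x) :- m :* (b :+ y) := (a :- m :* b) :+ (x :- m :* y))
      refl (ℕ→ℚ m) (series t n m) (series t n 1) (t n m) (t n 1))
    (cong (_+ excess (t n) m) (excess-series t n m))

  slack-zero : ∀ F m → F 0 ≡ 0ℚ → slack F m 0 ≡ 0ℚ
  slack-zero F m F0≡0 = trans
    (cong (λ z → (ℕ→ℚ m - 0ℚ) * 0ℚ * ℕ→ℚ m * F 1 + (0ℚ - 1ℚ) * 0ℚ * F m - (ℕ→ℚ m - 1ℚ) * ℕ→ℚ m * z) F0≡0)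
    (solve 3 (λ m a b → (m :- con 0ℚ) :* con 0ℚ :* m :* a :+ (con 0ℚ :- con 1ℚ) :* con 0ℚ :* b :- (m :- con 1ℚ) :* m :* con 0ℚ
       := con 0ℚ) refl (ℕ→ℚ m) (F 1) (F m))

  -- The cone of functions with nonnegative slack and excess is closed under
  -- sums, so it is enough to check the terms of a series.
  chordal-series : ∀ {m η} (t : ℕ → ℕ → ℚ) → (∀ j → t j 0 ≡ 0ℚ) →
    (∀ j d → 1 ℕ.≤ d → d ℕ.≤ m → 0ℚ ≤ slack (t j) m d) →
    (∀ j → 1 ℕ.≤ m → 0ℚ ≤ excess (t j) m) →
    ∀ a b → (∀ d → 2 ℕ.≤ d → d ℕ.< m → η ≤ slack (t a) m d) → (2 ℕ.≤ m → η ≤ excess (t b) m) →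
    ∀ n → a ℕ.< n → b ℕ.< n → Chordal (series t n) m η
  chordal-series {m} {η} t t0≡0 slack≥0 excess≥0 a b slack≥η excess≥η n a<n b<n = record
    { vanishes = vanishes
    ; slack≥0  = λ
      { zero    _   → ℚ.≤-reflexive (sym (slack-zero (series t n) m vanishes))
      ; (suc d) d<m → subst (0ℚ ≤_) (sym (slack-series t n m (suc d)))
                        (∑-nonNeg n (λ j → slack≥0 j (suc d) (s≤s z≤n) d<m))
      }
    ; slack≥η  = λ d 2≤d d<m → ℚ.≤-trans (slack≥η d 2≤d d<m)
        (subst (slack (t a) m d ≤_) (sym (slack-series t n m d))
          (term≤∑ n (λ j → slack≥0 j d (ℕ.<⇒≤ 2≤d) (ℕ.<⇒≤ d<m)) a a<n))
    ; growth   = λ 2≤m → ℚ.≤-trans (excess≥η 2≤m)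
        (subst (excess (t b) m ≤_) (sym (excess-series t n m))
          (term≤∑ n (λ j → excess≥0 j (ℕ.<⇒≤ 2≤m)) b b<n))
    }
    where
      vanishes : series t n 0 ≡ 0ℚ
      vanishes = trans (∑-cong n t0≡0) (trans (∑-const n 0ℚ) (ℚ.*-zeroʳ (ℕ→ℚ n)))

  1≤⇒ℚ : ∀ {n} → 1 ℕ.≤ n → 1ℚ ≤ ℕ→ℚ n
  1≤⇒ℚ = ℕ→ℚ-mono

  ℕ→ℚ-gap : ∀ {m n} → m ℕ.< n → 1ℚ ≤ ℕ→ℚ n - ℕ→ℚ m
  ℕ→ℚ-gap {m} {n} m<n = begin
    1ℚ                      ≡⟨ solve 1 (λ m → con 1ℚ := (con 1ℚ :+ m) :- m) refl (ℕ→ℚ m) ⟩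
    (1ℚ + ℕ→ℚ m) - ℕ→ℚ m    ≡⟨ cong (_- ℕ→ℚ m) (ℕ→ℚ-suc m) ⟨
    ℕ→ℚ (suc m) - ℕ→ℚ m     ≤⟨ ℚ.+-monoˡ-≤ (- ℕ→ℚ m) (ℕ→ℚ-mono m<n) ⟩
    ℕ→ℚ n - ℕ→ℚ m           ∎

  0≤1 : 0ℚ ≤ 1ℚ
  0≤1 = ℚ.nonNegative⁻¹ 1ℚ

  *-≥1 : ∀ {p q} → 1ℚ ≤ p → 1ℚ ≤ q → 1ℚ ≤ p * q
  *-≥1 1≤p 1≤q = *-mono 0≤1 (ℚ.≤-trans 0≤1 1≤q) 1≤p 1≤q

  scale-up : ∀ {p q} → 1ℚ ≤ p → 0ℚ ≤ q → q ≤ p * q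
  scale-up {p} {q} 1≤p 0≤q = subst (_≤ p * q) (ℚ.*-identityˡ q) (*-mono 0≤1 0≤q 1≤p ℚ.≤-refl)

  0<⊓ : ∀ {p q} → 0ℚ < p → 0ℚ < q → 0ℚ < p ⊓ q
  0<⊓ {p} {q} 0<p 0<q with ℚ.⊓-sel p q
  ... | inj₁ eq = subst (0ℚ <_) (sym eq) 0<p
  ... | inj₂ eq = subst (0ℚ <_) (sym eq) 0<q

  -- The shift of the index drops the constant term, so the terms add up to e^(lx) - 1 and vanish at
  -- 0. Term `j` has degree j + 1 in x.
  shiftedExpTerm : ℚ → ℕ → ℕ → ℚ
  shiftedExpTerm l j x = expTerm (l * ℕ→ℚ x) (suc j)

  module Exponential {l} (0≤l : 0ℚ ≤ l) where

    private t = shiftedExpTerm l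

    t-nonNeg : ∀ j x → 0ℚ ≤ t j x
    t-nonNeg j x = expTerm-nonNeg (*-nonNeg 0≤l (0≤ℕ→ℚ x)) (suc j)

    t-zero : ∀ j → t j 0 ≡ 0ℚ
    t-zero j = solve 3 (λ e l r → e :* (l :* con 0ℚ :* r) := con 0ℚ) refl (expTerm (l * 0ℚ) j) l (1/suc j)

    module _ (m : ℕ) where

      private M = ℕ→ℚ m

      excess-zero : excess (t 0) m ≡ 0ℚ
      excess-zero = solve 2 (λ l m → con 1ℚ :* (l :* m :* con 1ℚ) :- m :* (con 1ℚ :* (l :* con 1ℚ :* con 1ℚ)) := con 0ℚ) refl l M

      excess-suc : ∀ j → excess (t (suc j)) m ≡ l * 1/suc (suc j) * (M * excess (t j) m + (M - 1ℚ) * M * t j 1)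
      excess-suc j = solve 5 (λ a b l m r →
        a :* (l :* m :* r) :- m :* (b :* (l :* con 1ℚ :* r))
        := l :* r :* (m :* (a :- m :* b) :+ (m :- con 1ℚ) :* m :* b)) refl (t j m) (t j 1) l M (1/suc (suc j))

      slack-first : ∀ d → slack (t 0) m d ≡ 0ℚ
      slack-first d = solve 3 (λ l m d →
        (m :- d) :* d :* m :* (con 1ℚ :* (l :* con 1ℚ :* con 1ℚ)) :+ (d :- con 1ℚ) :* d :* (con 1ℚ :* (l :* m :* con 1ℚ))
          :- (m :- con 1ℚ) :* m :* (con 1ℚ :* (l :* d :* con 1ℚ)) := con 0ℚ) refl l M (ℕ→ℚ d)

      -- Term j + 1 is term j times l x / (j + 2). Multiplying a function by x turns its slack into
      -- a combination of slack and excess whose coefficients are nonnegative for 1 ≤ d ≤ m, so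
      -- nonnegativity passes from each power of x to the next.
      slack-suc : ∀ j d → slack (t (suc j)) m d ≡
        l * 1/suc (suc j) * (ℕ→ℚ d * slack (t j) m d + (M - ℕ→ℚ d) * (ℕ→ℚ d * (ℕ→ℚ d - 1ℚ)) * excess (t j) m)
      slack-suc j d = solve 7 (λ a b c l m d r →
        (m :- d) :* d :* m :* (b :* (l :* con 1ℚ :* r)) :+ (d :- con 1ℚ) :* d :* (a :* (l :* m :* r))
          :- (m :- con 1ℚ) :* m :* (c :* (l :* d :* r))
        := l :* r :* (d :* ((m :- d) :* d :* m :* b :+ (d :- con 1ℚ) :* d :* a :- (m :- con 1ℚ) :* m :* c)
             :+ (m :- d) :* (d :* (d :- con 1ℚ)) :* (a :- m :* b)))
        refl (t j m) (t j 1) (t j d) l M (ℕ→ℚ d) (1/suc (suc j))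

      0≤l/ : ∀ j → 0ℚ ≤ l * 1/suc j
      0≤l/ j = *-nonNeg 0≤l (0≤1/suc j)

      excess≥0 : ∀ j → 1 ℕ.≤ m → 0ℚ ≤ excess (t j) m
      excess≥0 zero    1≤m = ℚ.≤-reflexive (sym excess-zero)
      excess≥0 (suc j) 1≤m = subst (0ℚ ≤_) (sym (excess-suc j)) (*-nonNeg (0≤l/ (suc j))
        (ℚ.+-mono-≤ (*-nonNeg (0≤ℕ→ℚ m) (excess≥0 j 1≤m))
          (*-nonNeg (*-nonNeg (gap (1≤⇒ℚ 1≤m)) (0≤ℕ→ℚ m)) (t-nonNeg j 1))))

      slack≥0 : ∀ j d → 1 ℕ.≤ d → d ℕ.≤ m → 0ℚ ≤ slack (t j) m d
      slack≥0 zero    d 1≤d d≤m = ℚ.≤-reflexive (sym (slack-first d))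
      slack≥0 (suc j) d 1≤d d≤m = subst (0ℚ ≤_) (sym (slack-suc j d)) (*-nonNeg (0≤l/ (suc j))
        (ℚ.+-mono-≤ (*-nonNeg (0≤ℕ→ℚ d) (slack≥0 j d 1≤d d≤m))
          (*-nonNeg (*-nonNeg (gap (ℕ→ℚ-mono d≤m)) (*-nonNeg (0≤ℕ→ℚ d) (gap (1≤⇒ℚ 1≤d))))
            (excess≥0 j (ℕ.≤-trans 1≤d d≤m)))))

    module _ {e} (0≤e : 0ℚ ≤ e) (e≤l : e ≤ l) where

      -- The Taylor terms e²/2 and e³/6. As `e` is a fixed rational below the approximations `l` of
      -- the rate, these bounds are the same at every precision.
      quadratic cubic : ℚ
      quadratic = e * 1/suc 1 * e
      cubic     = e * 1/suc 2 * quadratic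

      0≤quadratic : 0ℚ ≤ quadratic
      0≤quadratic = *-nonNeg (*-nonNeg 0≤e (0≤1/suc 1)) 0≤e

      e/≤ : ∀ j → e * 1/suc j ≤ l * 1/suc j
      e/≤ j = ℚ.*-monoʳ-≤-nonNeg (1/suc j) {{ℚ.nonNegative (0≤1/suc j)}} e≤l

      excess≥quadratic : ∀ {m} → 2 ℕ.≤ m → quadratic ≤ excess (t 1) m
      excess≥quadratic {m} 2≤m = subst (quadratic ≤_) (sym (excess-suc m 0))
        (*-mono (*-nonNeg 0≤e (0≤1/suc 1)) 0≤sum (e/≤ 1) (begin
          e                              ≤⟨ e≤l ⟩
          l                              ≡⟨ solve 1 (λ l → l := con 1ℚ :* (l :* con 1ℚ :* con 1ℚ)) refl l ⟩
          t 0 1                          ≤⟨ scale-up (*-≥1 (ℕ→ℚ-gap 2≤m) (1≤⇒ℚ 1≤m)) (t-nonNeg 0 1) ⟩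
          (M - 1ℚ) * M * t 0 1           ≤⟨ ≤-gap (M * excess (t 0) m) 0≤first (ℚ.+-comm _ (M * excess (t 0) m)) ⟩
          M * excess (t 0) m + (M - 1ℚ) * M * t 0 1  ∎))
        where
          M = ℕ→ℚ m
          1≤m = ℕ.<⇒≤ 2≤m
          0≤first = *-nonNeg (0≤ℕ→ℚ m) (excess≥0 m 0 1≤m)
          0≤sum = ℚ.+-mono-≤ 0≤first (*-nonNeg (ℚ.≤-trans 0≤1 (*-≥1 (ℕ→ℚ-gap 2≤m) (1≤⇒ℚ 1≤m))) (t-nonNeg 0 1))

      slack≥cubic : ∀ {m} d → 2 ℕ.≤ d → d ℕ.< m → cubic ≤ slack (t 2) m d
      slack≥cubic {m} d 2≤d d<m = subst (cubic ≤_) (sym (slack-suc m 1 d))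
        (*-mono (*-nonNeg 0≤e (0≤1/suc 2)) (ℚ.≤-trans 0≤quadratic q≤) (e/≤ 2) q≤)
        where
          D = ℕ→ℚ d ; M = ℕ→ℚ m
          2≤m = ℕ.≤-trans 2≤d (ℕ.<⇒≤ d<m)
          E≥q = excess≥quadratic 2≤m
          q≤ : quadratic ≤ D * slack (t 1) m d + (M - D) * (D * (D - 1ℚ)) * excess (t 1) m
          q≤ = begin
            quadratic          ≤⟨ E≥q ⟩
            excess (t 1) m     ≤⟨ scale-up (*-≥1 (ℕ→ℚ-gap d<m) (*-≥1 (1≤⇒ℚ (ℕ.<⇒≤ 2≤d)) (ℕ→ℚ-gap 2≤d)))
                                    (ℚ.≤-trans 0≤quadratic E≥q) ⟩
            (M - D) * (D * (D - 1ℚ)) * excess (t 1) m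
              ≤⟨ ≤-gap (D * slack (t 1) m d) (*-nonNeg (0≤ℕ→ℚ d) (slack≥0 m 1 d (ℕ.<⇒≤ 2≤d) (ℕ.<⇒≤ d<m)))
                   (ℚ.+-comm _ (D * slack (t 1) m d)) ⟩
            D * slack (t 1) m d + (M - D) * (D * (D - 1ℚ)) * excess (t 1) m  ∎

      chordal : ∀ m n → 3 ℕ.≤ n → Chordal (series t n) m (quadratic ⊓ cubic)
      -- Index 1 is the quadratic term, the first with positive excess. Index 2 is the cubic one,
      -- the first with positive slack: x and x² lie on their chords.
      chordal m n 3≤n = chordal-series t t-zero (slack≥0 m) (excess≥0 m) 2 1
        (λ d 2≤d d<m → ℚ.≤-trans (ℚ.p⊓q≤q quadratic cubic) (slack≥cubic d 2≤d d<m))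
        (λ 2≤m → ℚ.≤-trans (ℚ.p⊓q≤p quadratic cubic) (excess≥quadratic 2≤m))
        n 3≤n (ℕ.<⇒≤ 3≤n)

-- Riemann sums of the logarithm, and the terms of x² exp (δ log x).

module PowerChord where

  open CauchyLemmas
  open ChordBound
  open ChordalSeries
  open import Data.Rational.Base using (_+_; _*_; _-_; -_; _≤_; _⊓_)
  open ℚ.≤-Reasoning
  open ℚ.+-*-Solver

  -- The integrand 1/t is at most 1: the sum has p (1 + k) terms, none larger than the step 1/(1 +
  -- k).
  logSum≤ : ∀ p k → logSum p k ≤ ℕ→ℚ p
  logSum≤ p k = begin
    logSum p k                                  ≤⟨ harmonicBlock-upper (suc k) (p ℕ.* suc k) ⟩
    ℕ→ℚ (p ℕ.* suc k) * 1/suc (suc k)           ≤⟨ ℚ.*-monoˡ-≤-nonNeg (ℕ→ℚ (p ℕ.* suc k)) {{ℚ.nonNegative (0≤ℕ→ℚ (p ℕ.* suc k))}}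
                                                     (1/suc-antimono (ℕ.n≤1+n k)) ⟩
    ℕ→ℚ (p ℕ.* suc k) * 1/suc k                 ≡⟨ cong (_* 1/suc k) (ℕ→ℚ-* p (suc k)) ⟩
    ℕ→ℚ p * ℕ→ℚ (suc k) * 1/suc k               ≡⟨ solve 3 (λ a b c → a :* b :* c := a :* (c :* b)) refl (ℕ→ℚ p) (ℕ→ℚ (suc k)) (1/suc k) ⟩
    ℕ→ℚ p * (1/suc k * ℕ→ℚ (suc k))             ≡⟨ cong (ℕ→ℚ p *_) (1/suc-inverse k) ⟩
    ℕ→ℚ p * 1ℚ                                  ≡⟨ ℚ.*-identityʳ (ℕ→ℚ p) ⟩
    ℕ→ℚ p                                       ∎

  -- The Riemann sum for 1 + p + q continues the one for 1 + p by q (1 + k) terms. Each is at least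
  -- the last of them, 1/((1 + k)(1 + p + q)), which is `1/suc l`.
  logSum-increment : ∀ p q k → logSum p k + ℕ→ℚ q * 1/suc (p ℕ.+ q) ≤ logSum (p ℕ.+ q) k
  logSum-increment p q k = begin
    logSum p k + ℕ→ℚ q * 1/suc (p ℕ.+ q)
      ≡⟨ cong (λ z → logSum p k + ℕ→ℚ q * z) (ratio k (p ℕ.+ q) l (ℕ.*-comm s (suc (p ℕ.+ q)))) ⟨
    logSum p k + ℕ→ℚ q * (ℕ→ℚ s * 1/suc l)
      ≡⟨ cong (_+_ (logSum p k)) (trans (sym (ℚ.*-assoc (ℕ→ℚ q) (ℕ→ℚ s) (1/suc l)))
           (trans (cong (_* 1/suc l) (sym (ℕ→ℚ-* q s))) (sym (∑-const (q ℕ.* s) (1/suc l))))) ⟩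
    logSum p k + ∑<ℚ (q ℕ.* s) (λ _ → 1/suc l)
      ≤⟨ ℚ.+-monoʳ-≤ (logSum p k) (∑-mono (q ℕ.* s) λ i i<qs → 1/suc-antimono (smaller i i<qs)) ⟩
    logSum p k + ∑<ℚ (q ℕ.* s) (λ i → 1/suc (s ℕ.+ (p ℕ.* s ℕ.+ i)))
      ≡⟨ ∑-split (p ℕ.* s) (q ℕ.* s) (λ i → 1/suc (s ℕ.+ i)) ⟨
    harmonicBlock s (p ℕ.* s ℕ.+ q ℕ.* s)
      ≡⟨ cong (harmonicBlock s) (ℕ.*-distribʳ-+ s p q) ⟨
    logSum (p ℕ.+ q) k  ∎
    where
      s = suc k
      l = k ℕ.+ (p ℕ.+ q) ℕ.* s
      smaller : ∀ i → i ℕ.< q ℕ.* s → s ℕ.+ (p ℕ.* s ℕ.+ i) ℕ.≤ l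
      smaller i i<qs = ℕ.≤-trans (ℕ.≤-reflexive (sym (ℕ.+-suc k (p ℕ.* s ℕ.+ i))))
        (ℕ.+-monoʳ-≤ k (subst₂ ℕ._≤_ (ℕ.+-suc (p ℕ.* s) i) (sym (ℕ.*-distribʳ-+ s p q))
          (ℕ.+-monoʳ-≤ (p ℕ.* s) i<qs)))

  logSum-mono : ∀ p q k → logSum p k ≤ logSum (p ℕ.+ q) k
  logSum-mono p q k = ℚ.≤-trans
    (≤-gap (ℕ→ℚ q * 1/suc (p ℕ.+ q)) (*-nonNeg (0≤ℕ→ℚ q) (0≤1/suc (p ℕ.+ q))) refl) (logSum-increment p q k)

  logSum-nonNeg : ∀ p k → 0ℚ ≤ logSum p k
  logSum-nonNeg = logSum-mono 0

  -- x log x / (x - 1) is increasing, by log x ≤ x - 1 and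
  -- log y - log x ≥ (y - x) / y.
  log-chord : ∀ p q k → let D = ℕ→ℚ (suc p) ; M = ℕ→ℚ (suc (p ℕ.+ q)) in
    (M - 1ℚ) * D * logSum p k ≤ (D - 1ℚ) * M * logSum (p ℕ.+ q) k
  log-chord p q k = begin
    (M - 1ℚ) * D * L
      ≡⟨ cong₂ (λ m d → (m - 1ℚ) * d * L) M≡ (ℕ→ℚ-suc p) ⟩
    ((1ℚ + (P + Q)) - 1ℚ) * (1ℚ + P) * L
      ≡⟨ solve 3 (λ p q l → ((con 1ℚ :+ (p :+ q)) :- con 1ℚ) :* (con 1ℚ :+ p) :* l
           := q :* l :+ p :* (con 1ℚ :+ (p :+ q)) :* l) refl P Q L ⟩
    Q * L + P * (1ℚ + (P + Q)) * L
      ≤⟨ ℚ.+-monoˡ-≤ (P * (1ℚ + (P + Q)) * L) (ℚ.*-monoˡ-≤-nonNeg Q {{ℚ.nonNegative (0≤ℕ→ℚ q)}} (logSum≤ p k)) ⟩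
    Q * P + P * (1ℚ + (P + Q)) * L
      ≡⟨ cong (_+ P * (1ℚ + (P + Q)) * L) (trans (sym (ℚ.*-identityʳ (Q * P))) (cong (Q * P *_) (sym inverse))) ⟩
    Q * P * (r * (1ℚ + (P + Q))) + P * (1ℚ + (P + Q)) * L
      ≡⟨ solve 4 (λ p q l r → q :* p :* (r :* (con 1ℚ :+ (p :+ q))) :+ p :* (con 1ℚ :+ (p :+ q)) :* l
           := p :* (con 1ℚ :+ (p :+ q)) :* (l :+ q :* r)) refl P Q L r ⟩
    P * (1ℚ + (P + Q)) * (L + Q * r)
      ≤⟨ ℚ.*-monoˡ-≤-nonNeg (P * (1ℚ + (P + Q))) {{ℚ.nonNegative (*-nonNeg (0≤ℕ→ℚ p)
           (ℚ.+-mono-≤ 0≤1 (ℚ.+-mono-≤ (0≤ℕ→ℚ p) (0≤ℕ→ℚ q))))}} (logSum-increment p q k) ⟩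
    P * (1ℚ + (P + Q)) * logSum (p ℕ.+ q) k
      ≡⟨ cong₂ (λ a m → a * m * logSum (p ℕ.+ q) k)
           (trans (solve 1 (λ p → p := (con 1ℚ :+ p) :- con 1ℚ) refl P) (cong (_- 1ℚ) (sym (ℕ→ℚ-suc p)))) (sym M≡) ⟩
    (D - 1ℚ) * M * logSum (p ℕ.+ q) k  ∎
    where
      D = ℕ→ℚ (suc p) ; M = ℕ→ℚ (suc (p ℕ.+ q))
      P = ℕ→ℚ p ; Q = ℕ→ℚ q ; L = logSum p k ; r = 1/suc (p ℕ.+ q)
      M≡ : M ≡ 1ℚ + (P + Q)
      M≡ = trans (ℕ→ℚ-suc (p ℕ.+ q)) (cong (_+_ 1ℚ) (ℕ→ℚ-+ p q))
      inverse : r * (1ℚ + (P + Q)) ≡ 1ℚ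
      inverse = trans (cong (r *_) (sym M≡)) (1/suc-inverse (p ℕ.+ q))

  expTerm-mono : ∀ {x y} → 0ℚ ≤ x → x ≤ y → ∀ j → expTerm x j ≤ expTerm y j
  expTerm-mono 0≤x x≤y zero    = ℚ.≤-refl
  expTerm-mono {x} {y} 0≤x x≤y (suc j) = *-mono (expTerm-nonNeg 0≤x j) (*-nonNeg (ℚ.≤-trans 0≤x x≤y) (0≤1/suc j))
    (expTerm-mono 0≤x x≤y j) (ℚ.*-monoʳ-≤-nonNeg (1/suc j) {{ℚ.nonNegative (0≤1/suc j)}} x≤y)

  -- The terms of x² exp (δ log x) = x ^ (2 + δ), with the k-th approximation
  -- of log x.
  powerTerm : ℚ → ℕ → ℕ → ℕ → ℚ
  powerTerm δ k j x = ℕ→ℚ x * ℕ→ℚ x * expTerm (δ * logSum (ℕ.pred x) k) j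

  module Power {δ} (0≤δ : 0ℚ ≤ δ) (k : ℕ) where

    private
      t = powerTerm δ k
      τ : ℕ → ℕ → ℚ
      τ j p = expTerm (δ * logSum p k) j

    t-zero : ∀ j → t j 0 ≡ 0ℚ
    t-zero j = ℚ.*-zeroˡ (τ j 0)

    τ-nonNeg : ∀ j p → 0ℚ ≤ τ j p
    τ-nonNeg j p = expTerm-nonNeg (*-nonNeg 0≤δ (logSum-nonNeg p k)) j

    τ-mono : ∀ j p q → τ j p ≤ τ j (p ℕ.+ q)
    τ-mono j p q = expTerm-mono (*-nonNeg 0≤δ (logSum-nonNeg p k))
      (ℚ.*-monoˡ-≤-nonNeg δ {{ℚ.nonNegative 0≤δ}} (logSum-mono p q k)) j

    excess≥0 : ∀ {m} j → 1 ℕ.≤ m → 0ℚ ≤ excess (t j) m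
    excess≥0 {suc p} j _ = gap (begin
      M * (1ℚ * 1ℚ * τ j 0)   ≡⟨ solve 2 (λ m a → m :* (con 1ℚ :* con 1ℚ :* a) := m :* a) refl M (τ j 0) ⟩
      M * τ j 0               ≤⟨ ℚ.*-monoˡ-≤-nonNeg M {{ℚ.nonNegative (0≤ℕ→ℚ (suc p))}} (τ-mono j 0 p) ⟩
      M * τ j p               ≤⟨ scale-up (1≤⇒ℚ {suc p} (s≤s z≤n)) (*-nonNeg (0≤ℕ→ℚ (suc p)) (τ-nonNeg j p)) ⟩
      M * (M * τ j p)         ≡⟨ ℚ.*-assoc M M (τ j p) ⟨
      M * M * τ j p           ∎)
      where M = ℕ→ℚ (suc p)

    excess≥1 : ∀ {m} → 2 ℕ.≤ m → 1ℚ ≤ excess (t 0) m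
    excess≥1 {m} 2≤m = begin
      1ℚ                ≤⟨ *-≥1 (ℕ→ℚ-gap 2≤m) (1≤⇒ℚ (ℕ.<⇒≤ 2≤m)) ⟩
      (M - 1ℚ) * M      ≡⟨ solve 1 (λ m → (m :- con 1ℚ) :* m := m :* m :* con 1ℚ :- m :* (con 1ℚ :* con 1ℚ :* con 1ℚ)) refl M ⟩
      excess (t 0) m    ∎
      where M = ℕ→ℚ m

    slack-first : ∀ m d → slack (t 0) m d ≡ 0ℚ
    slack-first m d = solve 2 (λ m d →
      (m :- d) :* d :* m :* (con 1ℚ :* con 1ℚ :* con 1ℚ) :+ (d :- con 1ℚ) :* d :* (m :* m :* con 1ℚ)
        :- (m :- con 1ℚ) :* m :* (d :* d :* con 1ℚ) := con 0ℚ) refl (ℕ→ℚ m) (ℕ→ℚ d)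

    module _ (p q : ℕ) where

      private
        D = ℕ→ℚ (suc p) ; M = ℕ→ℚ (suc (p ℕ.+ q))
        L = logSum p k
        1≤D = 1≤⇒ℚ {suc p} (s≤s z≤n)
        1≤M = 1≤⇒ℚ {suc (p ℕ.+ q)} (s≤s z≤n)

      chordLog : ℚ
      chordLog = (M - 1ℚ) * D * L

      0≤chordLog : 0ℚ ≤ chordLog
      0≤chordLog = *-nonNeg (*-nonNeg (gap 1≤M) (0≤ℕ→ℚ (suc p))) (logSum-nonNeg p k)

      -- Since log 1 = 0, the summand with F 1 drops out of the slack. What remains compares (D - 1)
      -- M log M at `M` with (M - 1) D log D at `D`, weighted by the previous exponential terms;
      -- `log-chord` lowers the former to the latter, leaving the growth of the weights.
      slack-suc : ∀ j → D * M * (δ * 1/suc j * (chordLog * (τ j (p ℕ.+ q) - τ j p)))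
        ≤ slack (t (suc j)) (suc (p ℕ.+ q)) (suc p)
      slack-suc j = begin
        D * M * (δ * r * (chordLog * (b - a)))
          ≡⟨ cong (D * M *_) (solve 4 (λ e c b a → e :* (c :* (b :- a)) := e :* (c :* b :- c :* a)) refl (δ * r) chordLog b a) ⟩
        D * M * (δ * r * (chordLog * b - chordLog * a))
          ≤⟨ ℚ.*-monoˡ-≤-nonNeg (D * M) {{ℚ.nonNegative (*-nonNeg (0≤ℕ→ℚ (suc p)) (0≤ℕ→ℚ (suc (p ℕ.+ q))))}}
               (ℚ.*-monoˡ-≤-nonNeg (δ * r) {{ℚ.nonNegative (*-nonNeg 0≤δ (0≤1/suc j))}}
                 (ℚ.+-monoˡ-≤ (- (chordLog * a))
                   (ℚ.*-monoʳ-≤-nonNeg b {{ℚ.nonNegative (τ-nonNeg j (p ℕ.+ q))}} (log-chord p q k)))) ⟩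
        D * M * (δ * r * ((D - 1ℚ) * M * N * b - (M - 1ℚ) * D * L * a))
          ≡⟨ solve 9 (λ m d l n e r a b c →
               d :* m :* (e :* r :* ((d :- con 1ℚ) :* m :* n :* b :- (m :- con 1ℚ) :* d :* l :* a))
               := (m :- d) :* d :* m :* (con 1ℚ :* con 1ℚ :* (c :* (e :* con 0ℚ :* r)))
                  :+ (d :- con 1ℚ) :* d :* (m :* m :* (b :* (e :* n :* r)))
                  :- (m :- con 1ℚ) :* m :* (d :* d :* (a :* (e :* l :* r))))
             refl M D L N δ r a b (τ j 0) ⟩
        slack (t (suc j)) (suc (p ℕ.+ q)) (suc p)  ∎
        where
          r = 1/suc j ; N = logSum (p ℕ.+ q) k
          a = τ j p ; b = τ j (p ℕ.+ q)

      slack≥0′ : ∀ j → 0ℚ ≤ slack (t j) (suc (p ℕ.+ q)) (suc p)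
      slack≥0′ zero    = ℚ.≤-reflexive (sym (slack-first (suc (p ℕ.+ q)) (suc p)))
      slack≥0′ (suc j) = ℚ.≤-trans
        (*-nonNeg (*-nonNeg (0≤ℕ→ℚ (suc p)) (0≤ℕ→ℚ (suc (p ℕ.+ q))))
          (*-nonNeg (*-nonNeg 0≤δ (0≤1/suc j)) (*-nonNeg 0≤chordLog (gap (τ-mono j p q)))))
        (slack-suc j)

    slack≥0 : ∀ {m} j d → 1 ℕ.≤ d → d ℕ.≤ m → 0ℚ ≤ slack (t j) m d
    slack≥0 {suc m} j (suc p) _ (s≤s p≤m) =
      subst (λ z → 0ℚ ≤ slack (t j) (suc z) (suc p)) (ℕ.m+[n∸m]≡n p≤m) (slack≥0′ p (m ℕ.∸ p) j)

    module _ {e} (0≤e : 0ℚ ≤ e) (e≤δ : e ≤ δ) where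

      -- The number 1/(m + 1) bounds from below both log d and log m - log d for 2 ≤ d < m, at every
      -- precision. The slack of the term with log² contains the product of the two, with δ²/2 in
      -- front.
      slackBound : ℕ → ℚ
      slackBound m = e * 1/suc 1 * (1/suc m * (e * 1/suc m))

      slack≥bound′ : ∀ p q → slackBound (suc (suc p ℕ.+ suc q)) ≤ slack (t 2) (suc (suc p ℕ.+ suc q)) (suc (suc p))
      slack≥bound′ p₀ q₀ = begin
        e * 1/suc 1 * (ρ * (e * ρ))
          ≤⟨ *-mono (*-nonNeg 0≤e (0≤1/suc 1)) (ℚ.≤-trans 0≤ρeρ inner) (ℚ.*-monoʳ-≤-nonNeg (1/suc 1) e≤δ) inner ⟩
        δ * 1/suc 1 * (chordLog p q * (τ 1 (p ℕ.+ q) - τ 1 p))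
          ≤⟨ scale-up (*-≥1 (1≤⇒ℚ {suc p} (s≤s z≤n)) 1≤M)
               (*-nonNeg (*-nonNeg 0≤δ (0≤1/suc 1)) (ℚ.≤-trans 0≤ρeρ inner)) ⟩
        D * M * (δ * 1/suc 1 * (chordLog p q * (τ 1 (p ℕ.+ q) - τ 1 p)))
          ≤⟨ slack-suc p q 1 ⟩
        slack (t 2) (suc (p ℕ.+ q)) (suc p)  ∎
        where
          p = suc p₀ ; q = suc q₀
          D = ℕ→ℚ (suc p) ; M = ℕ→ℚ (suc (p ℕ.+ q))
          1≤M = 1≤⇒ℚ {suc (p ℕ.+ q)} (s≤s z≤n)
          ρ = 1/suc (suc (p ℕ.+ q))
          0≤ρ = 0≤1/suc (suc (p ℕ.+ q))
          0≤ρeρ = *-nonNeg 0≤ρ (*-nonNeg 0≤e 0≤ρ)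
          increment : ∀ a b → a ℕ.+ suc b ℕ.≤ suc (p ℕ.+ q) → logSum a k + ρ ≤ logSum (a ℕ.+ suc b) k
          increment a b le = ℚ.≤-trans (ℚ.+-monoʳ-≤ (logSum a k) (ℚ.≤-trans (1/suc-antimono le)
              (scale-up (1≤⇒ℚ {suc b} (s≤s z≤n)) (0≤1/suc (a ℕ.+ suc b)))))
            (logSum-increment a (suc b) k)
          ρ≤L : ρ ≤ logSum p k
          ρ≤L = subst (_≤ logSum p k) (ℚ.+-identityˡ ρ) (increment 0 p₀ (ℕ.m≤n⇒m≤1+n (ℕ.m≤m+n p q)))
          inner : ρ * (e * ρ) ≤ chordLog p q * (τ 1 (p ℕ.+ q) - τ 1 p)
          inner = *-mono 0≤ρ (gap (τ-mono 1 p q))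
            (ℚ.≤-trans ρ≤L (scale-up (*-≥1 (ℕ→ℚ-gap {1} {suc (p ℕ.+ q)} (s≤s (s≤s z≤n))) (1≤⇒ℚ {suc p} (s≤s z≤n)))
              (logSum-nonNeg p k)))
            (begin
              e * ρ        ≤⟨ ℚ.*-monoʳ-≤-nonNeg ρ {{ℚ.nonNegative 0≤ρ}} e≤δ ⟩
              δ * ρ        ≡⟨ solve 3 (λ d l r → d :* r := con 1ℚ :* (d :* (l :+ r) :* con 1ℚ) :- con 1ℚ :* (d :* l :* con 1ℚ))
                                refl δ (logSum p k) ρ ⟩
              1ℚ * (δ * (logSum p k + ρ) * 1ℚ) - τ 1 p
                ≤⟨ ℚ.+-monoˡ-≤ (- τ 1 p) (ℚ.*-monoˡ-≤-nonNeg 1ℚ (ℚ.*-monoʳ-≤-nonNeg 1ℚ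
                     (ℚ.*-monoˡ-≤-nonNeg δ {{ℚ.nonNegative 0≤δ}} (increment p q₀ (ℕ.n≤1+n (p ℕ.+ q)))))) ⟩
              τ 1 (p ℕ.+ q) - τ 1 p  ∎)

      slack≥bound : ∀ {m} d → 2 ℕ.≤ d → d ℕ.< m → slackBound m ≤ slack (t 2) m d
      slack≥bound {suc m} (suc (suc p)) _ (s≤s 2+p≤m) =
        subst (λ z → slackBound (suc z) ≤ slack (t 2) (suc z) (suc (suc p)))
          (trans (ℕ.+-suc (suc p) (m ℕ.∸ suc (suc p))) (ℕ.m+[n∸m]≡n 2+p≤m))
          (slack≥bound′ p (m ℕ.∸ suc (suc p)))
      slack≥bound (suc zero) (s≤s ()) _

      chordal : ∀ m n → 3 ℕ.≤ n → Chordal (series t n) m (1ℚ ⊓ slackBound m)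
      -- Index 0 is x², which has excess but no slack. For the slack, `slack-suc` gives only 0 at
      -- index 1, where the weights are constant, so index 2 is taken.
      chordal m n 3≤n = chordal-series t t-zero slack≥0 excess≥0 2 0
        (λ d 2≤d d<m → ℚ.≤-trans (ℚ.p⊓q≤q 1ℚ (slackBound m)) (slack≥bound d 2≤d d<m))
        (λ 2≤m → ℚ.≤-trans (ℚ.p⊓q≤p 1ℚ (slackBound m)) (excess≥1 2≤m))
        n 3≤n (ℕ.≤-trans (s≤s z≤n) 3≤n)

-- Products of exponential sums, exp (log x) = x, and the limit for powers.

module ExpLog where

  open CauchyLemmas
  open ChordalSeries
  open PowerChord
  open import Data.Rational.Base using (_+_; _*_; _-_; -_; _≤_; _<_; _⊓_) renaming (∣_∣ to abs)
  open ℚ.≤-Reasoning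
  open ℚ.+-*-Solver

  -- Coefficient n of the Cauchy product of two power series, unfolded along the first one.
  convolution : (ℕ → ℚ) → (ℕ → ℚ) → ℕ → ℚ
  convolution a b zero    = a 0 * b 0
  convolution a b (suc n) = a 0 * b (suc n) + convolution (a ∘ suc) b n

  convolution-cong : ∀ {a a′ b b′} → (∀ i → a i ≡ a′ i) → (∀ i → b i ≡ b′ i) →
    ∀ n → convolution a b n ≡ convolution a′ b′ n
  convolution-cong a≡ b≡ zero    = cong₂ _*_ (a≡ 0) (b≡ 0)
  convolution-cong a≡ b≡ (suc n) = cong₂ _+_ (cong₂ _*_ (a≡ 0) (b≡ (suc n))) (convolution-cong (a≡ ∘ suc) b≡ n)

  convolution-nonNeg : ∀ {a b} → (∀ i → 0ℚ ≤ a i) → (∀ i → 0ℚ ≤ b i) → ∀ n → 0ℚ ≤ convolution a b n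
  convolution-nonNeg 0≤a 0≤b zero    = *-nonNeg (0≤a 0) (0≤b 0)
  convolution-nonNeg 0≤a 0≤b (suc n) = ℚ.+-mono-≤ (*-nonNeg (0≤a 0) (0≤b (suc n))) (convolution-nonNeg (0≤a ∘ suc) 0≤b n)

  convolution-*ˡ : ∀ c a b n → convolution (λ i → a i * c) b n ≡ convolution a b n * c
  convolution-*ˡ c a b zero    = solve 3 (λ a b c → a :* c :* b := a :* b :* c) refl (a 0) (b 0) c
  convolution-*ˡ c a b (suc n) = trans (cong (_+_ (a 0 * c * b (suc n))) (convolution-*ˡ c (a ∘ suc) b n))
    (solve 4 (λ a b c z → a :* c :* b :+ z :* c := (a :* b :+ z) :* c) refl (a 0) (b (suc n)) c (convolution (a ∘ suc) b n))

  convolution-*ʳ : ∀ c a b n → convolution a (λ i → b i * c) n ≡ convolution a b n * c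
  convolution-*ʳ c a b zero    = sym (ℚ.*-assoc (a 0) (b 0) c)
  convolution-*ʳ c a b (suc n) = trans (cong (_+_ (a 0 * (b (suc n) * c))) (convolution-*ʳ c (a ∘ suc) b n))
    (solve 4 (λ a b c z → a :* (b :* c) :+ z :* c := (a :* b :+ z) :* c) refl (a 0) (b (suc n)) c (convolution (a ∘ suc) b n))

  convolution-shiftʳ : ∀ a b → b 0 ≡ 0ℚ → ∀ n → convolution a b (suc n) ≡ convolution a (b ∘ suc) n
  convolution-shiftʳ a b b0≡0 zero    = trans (cong (λ z → a 0 * b 1 + a 1 * z) b0≡0)
    (solve 2 (λ x y → x :+ y :* con 0ℚ := x) refl (a 0 * b 1) (a 1))
  convolution-shiftʳ a b b0≡0 (suc n) = cong (_+_ (a 0 * b (suc (suc n)))) (convolution-shiftʳ (a ∘ suc) b b0≡0 n)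

  -- For c = 0 the coefficients of z A′(z). The offset `c` keeps the original index when an
  -- induction has shifted the sequence.
  weighted : ℕ → (ℕ → ℚ) → ℕ → ℚ
  weighted c a i = ℕ→ℚ (c ℕ.+ i) * a i

  -- The product rule for z d/dz: in every summand the weights c + i and n - i add up to c + n.
  convolution-leibniz : ∀ c a b n →
    convolution (weighted c a) b n + convolution a (weighted 0 b) n ≡ ℕ→ℚ (c ℕ.+ n) * convolution a b n
  convolution-leibniz c a b zero    = solve 3 (λ n a b → n :* a :* b :+ a :* (con 0ℚ :* b) := n :* (a :* b)) refl (ℕ→ℚ (c ℕ.+ 0)) (a 0) (b 0)
  convolution-leibniz c a b (suc n) = begin-equality
    ℕ→ℚ (c ℕ.+ 0) * a 0 * b₁ + X + (a 0 * (ℕ→ℚ (suc n) * b₁) + Y)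
      ≡⟨ solve 6 (λ c n a b x y → c :* a :* b :+ x :+ (a :* (n :* b) :+ y) := (c :+ n) :* (a :* b) :+ (x :+ y))
           refl (ℕ→ℚ (c ℕ.+ 0)) (ℕ→ℚ (suc n)) (a 0) b₁ X Y ⟩
    (ℕ→ℚ (c ℕ.+ 0) + ℕ→ℚ (suc n)) * (a 0 * b₁) + (X + Y)
      ≡⟨ cong₂ (λ u v → u * (a 0 * b₁) + v)
           (trans (sym (ℕ→ℚ-+ (c ℕ.+ 0) (suc n))) (cong (λ z → ℕ→ℚ (z ℕ.+ suc n)) (ℕ.+-identityʳ c)))
           (trans (cong (_+ Y) (convolution-cong (λ i → cong (λ z → ℕ→ℚ z * a (suc i)) (ℕ.+-suc c i)) (λ _ → refl) n))
             (trans (convolution-leibniz (suc c) (a ∘ suc) b n)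
               (cong (λ z → ℕ→ℚ z * convolution (a ∘ suc) b n) (sym (ℕ.+-suc c n))))) ⟩
    ℕ→ℚ (c ℕ.+ suc n) * (a 0 * b₁) + ℕ→ℚ (c ℕ.+ suc n) * convolution (a ∘ suc) b n
      ≡⟨ ℚ.*-distribˡ-+ (ℕ→ℚ (c ℕ.+ suc n)) (a 0 * b₁) (convolution (a ∘ suc) b n) ⟨
    ℕ→ℚ (c ℕ.+ suc n) * convolution a b (suc n)  ∎
    where
      b₁ = b (suc n)
      X = convolution (weighted c a ∘ suc) b n
      Y = convolution (a ∘ suc) (weighted 0 b) n

  -- Both sides satisfy u (n + 1) (n + 1) = u n (x + y).
  expTerm-+ : ∀ x y n → expTerm (x + y) n ≡ convolution (expTerm x) (expTerm y) n
  expTerm-+ x y zero    = refl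
  expTerm-+ x y (suc n) = begin-equality
    expTerm (x + y) n * ((x + y) * 1/suc n)
      ≡⟨ cong (_* ((x + y) * 1/suc n)) (expTerm-+ x y n) ⟩
    convolution a b n * ((x + y) * 1/suc n)
      ≡⟨ solve 4 (λ c x y r → c :* ((x :+ y) :* r) := r :* (c :* x :+ c :* y)) refl (convolution a b n) x y (1/suc n) ⟩
    1/suc n * (convolution a b n * x + convolution a b n * y)
      ≡⟨ cong (1/suc n *_) (cong₂ _+_ (sym left) (sym right)) ⟩
    1/suc n * (convolution (weighted 0 a) b (suc n) + convolution a (weighted 0 b) (suc n))
      ≡⟨ cong (1/suc n *_) (convolution-leibniz 0 a b (suc n)) ⟩
    1/suc n * (ℕ→ℚ (suc n) * convolution a b (suc n))
      ≡⟨ ℚ.*-assoc (1/suc n) (ℕ→ℚ (suc n)) _ ⟨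
    1/suc n * ℕ→ℚ (suc n) * convolution a b (suc n)
      ≡⟨ trans (cong (_* convolution a b (suc n)) (1/suc-inverse n)) (ℚ.*-identityˡ _) ⟩
    convolution a b (suc n)  ∎
    where
      a = expTerm x ; b = expTerm y
      left : convolution (weighted 0 a) b (suc n) ≡ convolution a b n * x
      left = begin-equality
        0ℚ * a 0 * b (suc n) + convolution (weighted 0 a ∘ suc) b n
          ≡⟨ cong₂ _+_ (solve 2 (λ a b → con 0ℚ :* a :* b := con 0ℚ) refl (a 0) (b (suc n)))
               (trans (convolution-cong (expTerm-recurrence x) (λ _ → refl) n) (convolution-*ˡ x a b n)) ⟩
        0ℚ + convolution a b n * x
          ≡⟨ ℚ.+-identityˡ _ ⟩
        convolution a b n * x  ∎
      right : convolution a (weighted 0 b) (suc n) ≡ convolution a b n * y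
      right = trans (convolution-shiftʳ a (weighted 0 b) refl n)
        (trans (convolution-cong {a} (λ _ → refl) (expTerm-recurrence y) n) (convolution-*ʳ y a b n))

  ∑-distrib-+ : ∀ n f g → ∑<ℚ n (λ i → f i + g i) ≡ ∑<ℚ n f + ∑<ℚ n g
  ∑-distrib-+ zero    f g = refl
  ∑-distrib-+ (suc n) f g = trans (cong (_+ (f n + g n)) (∑-distrib-+ n f g))
    (solve 4 (λ a b c d → (a :+ b) :+ (c :+ d) := (a :+ c) :+ (b :+ d)) refl (∑<ℚ n f) (∑<ℚ n g) (f n) (g n))

  ∑-*ˡ : ∀ n c f → ∑<ℚ n (λ i → c * f i) ≡ c * ∑<ℚ n f
  ∑-*ˡ zero    c f = sym (ℚ.*-zeroʳ c)
  ∑-*ˡ (suc n) c f = trans (cong (_+ c * f n) (∑-*ˡ n c f)) (sym (ℚ.*-distribˡ-+ c (∑<ℚ n f) (f n)))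

  ∑-head : ∀ n f → ∑<ℚ (suc n) f ≡ f 0 + ∑<ℚ n (f ∘ suc)
  ∑-head n f = trans (∑-split 1 n f) (cong (_+ ∑<ℚ n (f ∘ suc)) (ℚ.+-identityˡ (f 0)))

  ∑-monoˡ : ∀ {f} → (∀ i → 0ℚ ≤ f i) → ∀ {m n} → m ℕ.≤ n → ∑<ℚ m f ≤ ∑<ℚ n f
  ∑-monoˡ {f} 0≤f {m} {n} m≤n = ≤-gap (∑<ℚ (n ℕ.∸ m) (λ i → f (m ℕ.+ i))) (∑-nonNeg (n ℕ.∸ m) (λ i → 0≤f (m ℕ.+ i)))
    (trans (sym (∑-split m (n ℕ.∸ m) f)) (cong (λ z → ∑<ℚ z f) (ℕ.m+[n∸m]≡n m≤n)))

  -- Splits the row i = 0 off the triangle i + j ≤ n.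
  ∑-convolution : ∀ a b n → ∑<ℚ (suc n) (convolution a b) ≡ a 0 * ∑<ℚ (suc n) b + ∑<ℚ n (convolution (a ∘ suc) b)
  ∑-convolution a b n = begin-equality
    ∑<ℚ (suc n) (convolution a b)
      ≡⟨ ∑-head n (convolution a b) ⟩
    a 0 * b 0 + ∑<ℚ n (λ k → a 0 * b (suc k) + convolution (a ∘ suc) b k)
      ≡⟨ cong (_+_ (a 0 * b 0)) (trans (∑-distrib-+ n (λ k → a 0 * b (suc k)) (convolution (a ∘ suc) b))
           (cong (_+ R) (∑-*ˡ n (a 0) (b ∘ suc)))) ⟩
    a 0 * b 0 + (a 0 * ∑<ℚ n (b ∘ suc) + R)
      ≡⟨ solve 4 (λ a b s r → a :* b :+ (a :* s :+ r) := a :* (b :+ s) :+ r) refl (a 0) (b 0) (∑<ℚ n (b ∘ suc)) R ⟩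
    a 0 * (b 0 + ∑<ℚ n (b ∘ suc)) + R
      ≡⟨ cong (λ z → a 0 * z + R) (∑-head n b) ⟨
    a 0 * ∑<ℚ (suc n) b + R  ∎
    where R = ∑<ℚ n (convolution (a ∘ suc) b)

  -- The triangle i + j < n lies in the square i, j < n.
  ∑-convolution≤ : ∀ {a b} → (∀ i → 0ℚ ≤ a i) → (∀ i → 0ℚ ≤ b i) →
    ∀ n → ∑<ℚ n (convolution a b) ≤ ∑<ℚ n a * ∑<ℚ n b
  ∑-convolution≤ 0≤a 0≤b zero = ℚ.≤-refl
  ∑-convolution≤ {a} {b} 0≤a 0≤b (suc n) = begin
    ∑<ℚ (suc n) (convolution a b)                                 ≡⟨ ∑-convolution a b n ⟩
    a 0 * ∑<ℚ (suc n) b + ∑<ℚ n (convolution (a ∘ suc) b)         ≤⟨ ℚ.+-monoʳ-≤ (a 0 * ∑<ℚ (suc n) b) (∑-convolution≤ (0≤a ∘ suc) 0≤b n) ⟩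
    a 0 * ∑<ℚ (suc n) b + ∑<ℚ n (a ∘ suc) * ∑<ℚ n b               ≤⟨ ℚ.+-monoʳ-≤ (a 0 * ∑<ℚ (suc n) b)
                                                                       (*-mono (∑-nonNeg n (0≤a ∘ suc)) (∑-nonNeg (suc n) 0≤b) ℚ.≤-refl (∑-monoˡ 0≤b (ℕ.n≤1+n n))) ⟩
    a 0 * ∑<ℚ (suc n) b + ∑<ℚ n (a ∘ suc) * ∑<ℚ (suc n) b         ≡⟨ ℚ.*-distribʳ-+ (∑<ℚ (suc n) b) (a 0) (∑<ℚ n (a ∘ suc)) ⟨
    (a 0 + ∑<ℚ n (a ∘ suc)) * ∑<ℚ (suc n) b                       ≡⟨ cong (_* ∑<ℚ (suc n) b) (∑-head n a) ⟨
    ∑<ℚ (suc n) a * ∑<ℚ (suc n) b                                 ∎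

  -- The rectangle i < m, j < n lies in the triangle i + j < m + n, at the price of a longer sum.
  ≤∑-convolution : ∀ {a b} → (∀ i → 0ℚ ≤ a i) → (∀ i → 0ℚ ≤ b i) →
    ∀ m n → ∑<ℚ m a * ∑<ℚ n b ≤ ∑<ℚ (m ℕ.+ n) (convolution a b)
  ≤∑-convolution {a} {b} 0≤a 0≤b zero n = subst (_≤ ∑<ℚ n (convolution a b)) (sym (ℚ.*-zeroˡ (∑<ℚ n b)))
    (∑-nonNeg n (convolution-nonNeg 0≤a 0≤b))
  ≤∑-convolution {a} {b} 0≤a 0≤b (suc m) n = begin
    ∑<ℚ (suc m) a * ∑<ℚ n b                                       ≡⟨ cong (_* ∑<ℚ n b) (∑-head m a) ⟩
    (a 0 + ∑<ℚ m (a ∘ suc)) * ∑<ℚ n b                             ≡⟨ ℚ.*-distribʳ-+ (∑<ℚ n b) (a 0) (∑<ℚ m (a ∘ suc)) ⟩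
    a 0 * ∑<ℚ n b + ∑<ℚ m (a ∘ suc) * ∑<ℚ n b                     ≤⟨ ℚ.+-mono-≤
                                                                       (*-mono (0≤a 0) (∑-nonNeg (suc m ℕ.+ n) 0≤b) ℚ.≤-refl (∑-monoˡ 0≤b (ℕ.m≤n+m n (suc m))))
                                                                       (≤∑-convolution (0≤a ∘ suc) 0≤b m n) ⟩
    a 0 * ∑<ℚ (suc m ℕ.+ n) b + ∑<ℚ (m ℕ.+ n) (convolution (a ∘ suc) b)  ≡⟨ ∑-convolution a b (m ℕ.+ n) ⟨
    ∑<ℚ (suc m ℕ.+ n) (convolution a b)                           ∎

  module _ {x y} (0≤x : 0ℚ ≤ x) (0≤y : 0ℚ ≤ y) where

    expSum-+≤ : ∀ n → expSum (x + y) n ≤ expSum x n * expSum y n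
    expSum-+≤ n = subst (_≤ expSum x n * expSum y n) (sym (∑-cong n (expTerm-+ x y)))
      (∑-convolution≤ (expTerm-nonNeg 0≤x) (expTerm-nonNeg 0≤y) n)

    ≤expSum-+ : ∀ m n → expSum x m * expSum y n ≤ expSum (x + y) (m ℕ.+ n)
    ≤expSum-+ m n = subst (expSum x m * expSum y n ≤_) (sym (∑-cong (m ℕ.+ n) (expTerm-+ x y)))
      (≤∑-convolution (expTerm-nonNeg 0≤x) (expTerm-nonNeg 0≤y) m n)

  expSum-nonNeg : ∀ {x} → 0ℚ ≤ x → ∀ n → 0ℚ ≤ expSum x n
  expSum-nonNeg 0≤x n = ∑-nonNeg n (expTerm-nonNeg 0≤x)

  expSum-monoˡ : ∀ {x y} → 0ℚ ≤ x → x ≤ y → ∀ n → expSum x n ≤ expSum y n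
  expSum-monoˡ 0≤x x≤y n = ∑-mono n (λ j _ → expTerm-mono 0≤x x≤y j)

  expSum-monoʳ : ∀ {x} → 0ℚ ≤ x → ∀ {m n} → m ℕ.≤ n → expSum x m ≤ expSum x n
  expSum-monoʳ 0≤x = ∑-monoˡ (expTerm-nonNeg 0≤x)

  -- The quotient of successive terms is at most x, as in a geometric series. In the form multiplied
  -- out by 1 - x the bound holds for every x ≥ 0 and proves itself by induction.
  expSum-geometric : ∀ {x} → 0ℚ ≤ x → ∀ n → expSum x n * (1ℚ - x) ≤ 1ℚ - expTerm x n
  expSum-geometric {x} 0≤x zero    = ℚ.≤-reflexive (ℚ.*-zeroˡ (1ℚ - x))
  expSum-geometric {x} 0≤x (suc n) = begin
    (expSum x n + t) * (1ℚ - x)           ≡⟨ ℚ.*-distribʳ-+ (1ℚ - x) (expSum x n) t ⟩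
    expSum x n * (1ℚ - x) + t * (1ℚ - x)  ≤⟨ ℚ.+-monoˡ-≤ (t * (1ℚ - x)) (expSum-geometric 0≤x n) ⟩
    (1ℚ - t) + t * (1ℚ - x)               ≡⟨ solve 2 (λ t x → (con 1ℚ :- t) :+ t :* (con 1ℚ :- x) := con 1ℚ :- t :* (x :* con 1ℚ)) refl t x ⟩
    1ℚ - t * (x * 1ℚ)                     ≤⟨ ℚ.+-monoʳ-≤ 1ℚ (ℚ.neg-antimono-≤ (ℚ.*-monoˡ-≤-nonNeg t {{ℚ.nonNegative (expTerm-nonNeg 0≤x n)}}
                                               (ℚ.*-monoˡ-≤-nonNeg x {{ℚ.nonNegative 0≤x}} (1/suc-antimono {0} {n} z≤n)))) ⟩
    1ℚ - t * (x * 1/suc n)                ∎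
    where t = expTerm x n

  -- exp (1/(j+1)) ≤ 1/(1 - 1/(j+1))
  expSum-1/suc : ∀ j n → ℕ→ℚ j * expSum (1/suc j) n ≤ ℕ→ℚ (suc j)
  expSum-1/suc j n = begin
    ℕ→ℚ j * S                        ≡⟨ cong (_* S) (trans (solve 1 (λ j → j := (con 1ℚ :+ j) :- con 1ℚ) refl (ℕ→ℚ j))
                                          (cong₂ _-_ (sym (ℕ→ℚ-suc j)) (sym (1/suc-inverse j)))) ⟩
    (S₊ - 1/suc j * S₊) * S            ≡⟨ solve 3 (λ j r s → (j :- r :* j) :* s := j :* (s :* (con 1ℚ :- r))) refl S₊ (1/suc j) S ⟩
    S₊ * (S * (1ℚ - 1/suc j))         ≤⟨ ℚ.*-monoˡ-≤-nonNeg S₊ {{ℚ.nonNegative (0≤ℕ→ℚ (suc j))}} (begin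
        S * (1ℚ - 1/suc j)           ≤⟨ expSum-geometric (0≤1/suc j) n ⟩
        1ℚ - t                       ≤⟨ ≤-gap t (expTerm-nonNeg (0≤1/suc j) n) (solve 1 (λ t → con 1ℚ :- t :+ t := con 1ℚ) refl t) ⟩
        1ℚ                           ∎) ⟩
    S₊ * 1ℚ                           ≡⟨ ℚ.*-identityʳ S₊ ⟩
    S₊                                ∎
    where S₊ = ℕ→ℚ (suc j) ; S = expSum (1/suc j) n ; t = expTerm (1/suc j) n

  harmonicBlock-nonNeg : ∀ a c → 0ℚ ≤ harmonicBlock a c
  harmonicBlock-nonNeg a c = ∑-nonNeg c (λ i → 0≤1/suc (a ℕ.+ i))

  expSum-zero : ∀ n → expSum 0ℚ n ≤ 1ℚ
  expSum-zero n = begin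
    expSum 0ℚ n                ≡⟨ ℚ.*-identityʳ (expSum 0ℚ n) ⟨
    expSum 0ℚ n * (1ℚ - 0ℚ)    ≤⟨ expSum-geometric ℚ.≤-refl n ⟩
    1ℚ - expTerm 0ℚ n          ≤⟨ ≤-gap (expTerm 0ℚ n) (expTerm-nonNeg ℚ.≤-refl n)
                                    (solve 1 (λ t → con 1ℚ :- t :+ t := con 1ℚ) refl (expTerm 0ℚ n)) ⟩
    1ℚ                         ∎

  -- The products of the bounds 1 + 1/(j+1) ≤ exp (1/(j+1)) ≤ 1/(1 - 1/(j+1))
  -- telescope.
  expSum-harmonicBlock≤ : ∀ a c n → ℕ→ℚ a * expSum (harmonicBlock a c) n ≤ ℕ→ℚ (a ℕ.+ c)
  expSum-harmonicBlock≤ a zero n = begin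
    ℕ→ℚ a * expSum 0ℚ n    ≤⟨ ℚ.*-monoˡ-≤-nonNeg (ℕ→ℚ a) {{ℚ.nonNegative (0≤ℕ→ℚ a)}} (expSum-zero n) ⟩
    ℕ→ℚ a * 1ℚ             ≡⟨ ℚ.*-identityʳ (ℕ→ℚ a) ⟩
    ℕ→ℚ a                  ≡⟨ cong ℕ→ℚ (ℕ.+-identityʳ a) ⟨
    ℕ→ℚ (a ℕ.+ 0)          ∎
  expSum-harmonicBlock≤ a (suc c) n = begin
    A * expSum (harmonicBlock a c + 1/suc j) n
      ≤⟨ ℚ.*-monoˡ-≤-nonNeg A {{ℚ.nonNegative (0≤ℕ→ℚ a)}} (expSum-+≤ (harmonicBlock-nonNeg a c) (0≤1/suc j) n) ⟩
    A * (expSum (harmonicBlock a c) n * expSum (1/suc j) n)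
      ≡⟨ ℚ.*-assoc A _ _ ⟨
    A * expSum (harmonicBlock a c) n * expSum (1/suc j) n
      ≤⟨ ℚ.*-monoʳ-≤-nonNeg (expSum (1/suc j) n) {{ℚ.nonNegative (expSum-nonNeg (0≤1/suc j) n)}} (expSum-harmonicBlock≤ a c n) ⟩
    ℕ→ℚ j * expSum (1/suc j) n
      ≤⟨ expSum-1/suc j n ⟩
    ℕ→ℚ (suc j)
      ≡⟨ cong ℕ→ℚ (ℕ.+-suc a c) ⟨
    ℕ→ℚ (a ℕ.+ suc c)  ∎
    where A = ℕ→ℚ a ; j = a ℕ.+ c

  -- Two Taylor terms give a factor 1 + 1/(j + 1), but multiplying partial sums adds their lengths.
  -- The order n therefore grows with the block, and is left existential.
  ≤expSum-harmonicBlock : ∀ a c → ∃ λ n → ℕ→ℚ (suc (a ℕ.+ c)) ≤ ℕ→ℚ (suc a) * expSum (harmonicBlock a c) n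
  ≤expSum-harmonicBlock a zero = 1 , ℚ.≤-reflexive (trans (cong (λ z → ℕ→ℚ (suc z)) (ℕ.+-identityʳ a)) (sym (ℚ.*-identityʳ (ℕ→ℚ (suc a)))))
  ≤expSum-harmonicBlock a (suc c) =
    let (n , ih) = ≤expSum-harmonicBlock a c in n ℕ.+ 2 , (begin
    ℕ→ℚ (suc (a ℕ.+ suc c))
      ≡⟨ trans (cong (λ z → ℕ→ℚ (suc z)) (ℕ.+-suc a c)) (ℕ→ℚ-suc (suc j)) ⟩
    1ℚ + S₊
      ≡⟨ cong (_+ S₊) (1/suc-inverse j) ⟨
    1/suc j * S₊ + S₊
      ≡⟨ solve 2 (λ r j → r :* j :+ j := j :* (con 0ℚ :+ con 1ℚ :+ con 1ℚ :* (r :* con 1ℚ))) refl (1/suc j) S₊ ⟩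
    S₊ * expSum (1/suc j) 2
      ≤⟨ ℚ.*-monoʳ-≤-nonNeg (expSum (1/suc j) 2) {{ℚ.nonNegative (expSum-nonNeg (0≤1/suc j) 2)}} ih ⟩
    A * expSum (harmonicBlock a c) n * expSum (1/suc j) 2
      ≡⟨ ℚ.*-assoc A _ _ ⟩
    A * (expSum (harmonicBlock a c) n * expSum (1/suc j) 2)
      ≤⟨ ℚ.*-monoˡ-≤-nonNeg A {{ℚ.nonNegative (0≤ℕ→ℚ (suc a))}} (≤expSum-+ (harmonicBlock-nonNeg a c) (0≤1/suc j) n 2) ⟩
    A * expSum (harmonicBlock a (suc c)) (n ℕ.+ 2)  ∎)
    where A = ℕ→ℚ (suc a) ; j = a ℕ.+ c ; S₊ = ℕ→ℚ (suc j)

  -- The telescoped ratio is exactly 1 + p, so this side carries no error at any precision or order.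
  expSum-logSum≤ : ∀ p k n → expSum (logSum p k) n ≤ ℕ→ℚ (suc p)
  expSum-logSum≤ p k n = ℚ.*-cancelˡ-≤-pos S {{ℚ.positive (0<ℕ→ℚsuc k)}} (begin
    S * expSum (logSum p k) n       ≤⟨ expSum-harmonicBlock≤ (suc k) (p ℕ.* suc k) n ⟩
    ℕ→ℚ (suc p ℕ.* suc k)           ≡⟨ trans (ℕ→ℚ-* (suc p) (suc k)) (ℚ.*-comm (ℕ→ℚ (suc p)) S) ⟩
    S * ℕ→ℚ (suc p)                 ∎)
    where S = ℕ→ℚ (suc k)

  -- Here the product telescopes to ((1 + p)(1 + k) + 1)/(k + 2), which is 1 + p - p/(k + 2).
  ≤expSum-logSum : ∀ p k → ∃ λ n → ℕ→ℚ (suc p) ≤ expSum (logSum p k) n + ℕ→ℚ p * 1/suc (suc k)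
  ≤expSum-logSum p k = let (n , h) = ≤expSum-harmonicBlock (suc k) (p ℕ.* suc k) ; E = expSum (logSum p k) n in
    n , ℚ.*-cancelˡ-≤-pos S {{ℚ.positive (0<ℕ→ℚsuc (suc k))}} (begin
    S * ℕ→ℚ (suc p)
      ≡⟨ trans (sym (ℕ→ℚ-* (suc (suc k)) (suc p))) (trans (cong ℕ→ℚ regroup) (ℕ→ℚ-+ (suc (suc p ℕ.* suc k)) p)) ⟩
    ℕ→ℚ (suc (suc p ℕ.* suc k)) + P
      ≤⟨ ℚ.+-monoˡ-≤ P h ⟩
    S * E + P
      ≡⟨ cong (_+_ (S * E)) (trans (sym (ℚ.*-identityʳ P)) (cong (P *_) (sym (1/suc-inverse (suc k))))) ⟩
    S * E + P * (1/suc (suc k) * S)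
      ≡⟨ solve 4 (λ s e p r → s :* e :+ p :* (r :* s) := s :* (e :+ p :* r)) refl S E P (1/suc (suc k)) ⟩
    S * (E + P * 1/suc (suc k))  ∎)
    where
      S = ℕ→ℚ (suc (suc k)) ; P = ℕ→ℚ p
      regroup : suc (suc k) ℕ.* suc p ≡ suc (suc p ℕ.* suc k) ℕ.+ p
      regroup = trans (ℕ.*-comm (suc (suc k)) (suc p)) (trans (ℕ.*-suc (suc p) (suc k))
        (cong suc (ℕ.+-comm p (suc p ℕ.* suc k))))

  -- One `N` serves all x in [0, B], because the tail at x is dominated by the tail at `B`. The
  -- arguments met later change with `k`.
  expSum-tail-uniform : ∀ B ε → 0ℚ < ε → ∃ λ N → ∀ {x} → 0ℚ ≤ x → x ≤ ℕ→ℚ B →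
    ∀ k n → N ℕ.≤ k → k ℕ.≤ n → expSum x n ≤ expSum x k + ε
  expSum-tail-uniform B ε 0<ε = let (N , h) = expSum-cauchy-ℕ B ε 0<ε in
    N , λ {x} 0≤x x≤b k n N≤k k≤n → begin
    expSum x n
      ≡⟨ solve 2 (λ a b → b := a :+ (b :- a)) refl (expSum x k) (expSum x n) ⟩
    expSum x k + (expSum x n - expSum x k)
      ≤⟨ ℚ.+-monoʳ-≤ (expSum x k) (begin
           expSum x n - expSum x k                  ≤⟨ p≤∣p∣ _ ⟩
           abs (expSum x n - expSum x k)            ≤⟨ expSum-tail (subst (_≤ ℕ→ℚ B) (sym (ℚ.0≤p⇒∣p∣≡p 0≤x)) x≤b) k n k≤n ⟩
           expSum (ℕ→ℚ B) n - expSum (ℕ→ℚ B) k      ≤⟨ p≤∣p∣ _ ⟩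
           abs (expSum (ℕ→ℚ B) n - expSum (ℕ→ℚ B) k)  ≤⟨ h n k (ℕ.≤-trans N≤k k≤n) N≤k ⟩
           ε                                        ∎) ⟩
    expSum x k + ε  ∎

  -- The order n from `≤expSum-logSum` may exceed `k`. The sum is first extended to order k ⊔ n and
  -- then cut back to order `k` by the uniform tail bound.
  exp-log : ∀ p ε → 0ℚ < ε → ∃ λ N → ∀ k → N ℕ.≤ k → ℕ→ℚ (suc p) ≤ expSum (logSum p k) k + ε
  exp-log p ε 0<ε =
    let δ = ε * 1/suc 1
        0<δ = 0<half 0<ε
        (N₁ , tail) = expSum-tail-uniform p δ 0<δ
        (N₂ , small) = 1/suc-null (δ * 1/suc p) (*-pos 0<δ (0<1/suc p))
    in N₁ ℕ.⊔ N₂ , λ k N≤k →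
      let (n , h) = ≤expSum-logSum p k
          E = expSum (logSum p k)
      in begin
      ℕ→ℚ (suc p)                              ≤⟨ h ⟩
      E n + ℕ→ℚ p * 1/suc (suc k)              ≤⟨ ℚ.+-mono-≤
          (ℚ.≤-trans (expSum-monoʳ (logSum-nonNeg p k) (ℕ.m≤n⊔m k n))
            (tail (logSum-nonNeg p k) (logSum≤ p k) k (k ℕ.⊔ n) (ℕ.m⊔n≤o⇒m≤o N₁ N₂ N≤k) (ℕ.m≤m⊔n k n)))
          (*-mono (0≤ℕ→ℚ p) (ℚ.<⇒≤ (*-pos 0<δ (0<1/suc p))) (ℕ→ℚ-mono (ℕ.n≤1+n p))
            (small (suc k) (ℕ.m≤n⇒m≤1+n (ℕ.m⊔n≤o⇒n≤o N₁ N₂ N≤k)))) ⟩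
      E k + δ + ℕ→ℚ (suc p) * (δ * 1/suc p)    ≡⟨ cong (_+_ (E k + δ)) (scale p δ) ⟩
      E k + δ + δ                              ≡⟨ trans (ℚ.+-assoc (E k) δ δ) (cong (_+_ (E k)) (halves ε)) ⟩
      E k + ε                                  ∎

  -- Together: exp (u + 2 log x) = x² exp u, up to the error of exp-log.
  module _ (p : ℕ) {u : ℚ} (0≤u : 0ℚ ≤ u) (k : ℕ) where

    private
      X = ℕ→ℚ (suc p) ; L = logSum p k
      A = expSum u k ; E = expSum L k
      0≤L = logSum-nonNeg p k
      0≤A = expSum-nonNeg 0≤u k
      0≤E = expSum-nonNeg 0≤L k
      0≤u+L = ℚ.+-mono-≤ 0≤u 0≤L

    square-upper : expSum (u + L + L) k ≤ X * X * A
    square-upper = begin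
      expSum (u + L + L) k     ≤⟨ expSum-+≤ 0≤u+L 0≤L k ⟩
      expSum (u + L) k * E     ≤⟨ *-mono (expSum-nonNeg 0≤u+L k) (0≤ℕ→ℚ (suc p))
                                    (ℚ.≤-trans (expSum-+≤ 0≤u 0≤L k)
                                      (*-mono 0≤A (0≤ℕ→ℚ (suc p)) ℚ.≤-refl (expSum-logSum≤ p k k)))
                                    (expSum-logSum≤ p k k) ⟩
      A * X * X                ≡⟨ solve 2 (λ a x → a :* x :* x := x :* x :* a) refl A X ⟩
      X * X * A                ∎

    -- Multiplying three partial sums of order k needs order 3k. Replacing X² by E² costs A (X +
    -- E)(X - E), where E ≤ X and X - E ≤ η.
    square-lower : ∀ {η} → 0ℚ ≤ η → X ≤ E + η →
      X * X * A ≤ expSum (u + L + L) (k ℕ.+ k ℕ.+ k) + A * (X + X) * η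
    square-lower {η} 0≤η X≤E+η = begin
      X * X * A                           ≡⟨ solve 3 (λ a x e → x :* x :* a := a :* e :* e :+ a :* (x :+ e) :* (x :- e)) refl A X E ⟩
      A * E * E + A * (X + E) * (X - E)   ≤⟨ ℚ.+-mono-≤
          (ℚ.≤-trans (*-mono (*-nonNeg 0≤A 0≤E) 0≤E (≤expSum-+ 0≤u 0≤L k k) ℚ.≤-refl) (≤expSum-+ 0≤u+L 0≤L (k ℕ.+ k) k))
          (*-mono (*-nonNeg 0≤A (ℚ.+-mono-≤ (0≤ℕ→ℚ (suc p)) 0≤E)) 0≤η
            (ℚ.*-monoˡ-≤-nonNeg A {{ℚ.nonNegative 0≤A}} (ℚ.+-monoʳ-≤ X (expSum-logSum≤ p k k)))
            (begin
              X - E              ≤⟨ ℚ.+-monoˡ-≤ (- E) X≤E+η ⟩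
              E + η - E          ≡⟨ solve 2 (λ e n → e :+ n :- e := n) refl E η ⟩
              η                  ∎)) ⟩
      expSum (u + L + L) (k ℕ.+ k ℕ.+ k) + A * (X + X) * η  ∎

  -- The upper half is free of error once β k ≥ 2. The lower half has two errors of ε/2: one for
  -- cutting order 3k back to k, one inherited from `exp-log`.
  power-limit : ∀ {β : ℕ → ℚ} → IsCauchy β → (∃ λ K → ∀ k → K ℕ.≤ k → ℕ→ℚ 2 ≤ β k) →
    ∀ p ε → 0ℚ < ε → ∃ λ N → ∀ k → N ℕ.≤ k →
      abs (expSum (β k * logSum p k) k - series (powerTerm (β k - ℕ→ℚ 2) k) k (suc p)) ≤ ε
  power-limit {β} β-cauchy (K , 2≤β) p ε 0<ε = N , bound
    where
      bounded = eventually-bounded β-cauchy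
      B₀ = proj₁ bounded ; N₁ = proj₁ (proj₂ bounded)
      -- `B₀` bounds `β k` and `p` bounds `logSum p k`, so the exponent β k log x stays below `B`,
      -- and with it the smaller `u`.
      B = B₀ ℕ.* p
      bounded′ = eventually-bounded (expSum-cauchy-ℕ B)
      C = proj₁ bounded′ ; N₂ = proj₁ (proj₂ bounded′)
      δ = ε * 1/suc 1
      0<δ = 0<half 0<ε
      uniform = expSum-tail-uniform B δ 0<δ
      N₃ = proj₁ uniform
      -- `C` bounds `A`, hence `c` bounds the factor `A * (X + X)` of `η` in `square-lower`.
      c = C ℕ.* (suc p ℕ.+ suc p)
      η = δ * 1/suc c
      0<η = *-pos 0<δ (0<1/suc c)
      N₄ = proj₁ (exp-log p η 0<η)
      N = K ℕ.⊔ N₁ ℕ.⊔ (N₂ ℕ.⊔ (N₃ ℕ.⊔ N₄))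
      X = ℕ→ℚ (suc p)
      bound : ∀ k → N ℕ.≤ k → abs (expSum (β k * logSum p k) k - series (powerTerm (β k - ℕ→ℚ 2) k) k (suc p)) ≤ ε
      bound k N≤k = subst (λ z → abs (W - z) ≤ ε) (sym (∑-*ˡ k (X * X) (expTerm u))) (abs-≤
        (begin
          W - X * X * A              ≤⟨ ℚ.+-monoˡ-≤ (- (X * X * A)) W≤ ⟩
          X * X * A - X * X * A      ≡⟨ ℚ.+-inverseʳ (X * X * A) ⟩
          0ℚ                         ≤⟨ ℚ.<⇒≤ 0<ε ⟩
          ε                          ∎)
        (begin
          - (W - X * X * A)          ≡⟨ solve 2 (λ w a → :- (w :- a) := a :- w) refl W (X * X * A) ⟩
          X * X * A - W              ≤⟨ ℚ.+-monoˡ-≤ (- W) ≤W ⟩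
          W + ε - W                  ≡⟨ solve 2 (λ w e → w :+ e :- w := e) refl W ε ⟩
          ε                          ∎))
        where
          KN₁≤k = ℕ.m⊔n≤o⇒m≤o (K ℕ.⊔ N₁) (N₂ ℕ.⊔ (N₃ ℕ.⊔ N₄)) N≤k
          N₂₃₄≤k = ℕ.m⊔n≤o⇒n≤o (K ℕ.⊔ N₁) (N₂ ℕ.⊔ (N₃ ℕ.⊔ N₄)) N≤k
          N₃₄≤k = ℕ.m⊔n≤o⇒n≤o N₂ (N₃ ℕ.⊔ N₄) N₂₃₄≤k
          L = logSum p k ; b = ℕ→ℚ B
          u = (β k - ℕ→ℚ 2) * L
          A = expSum u k ; W = expSum (β k * L) k
          0≤L = logSum-nonNeg p k
          0≤u : 0ℚ ≤ u
          0≤u = *-nonNeg (gap (2≤β k (ℕ.m⊔n≤o⇒m≤o K N₁ KN₁≤k))) 0≤L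
          0≤βL : 0ℚ ≤ β k * L
          0≤βL = *-nonNeg (ℚ.≤-trans (0≤ℕ→ℚ 2) (2≤β k (ℕ.m⊔n≤o⇒m≤o K N₁ KN₁≤k))) 0≤L
          total : u + L + L ≡ β k * L
          total = solve 2 (λ b l → (b :- con (ℕ→ℚ 2)) :* l :+ l :+ l := b :* l) refl (β k) L
          βL≤b : β k * L ≤ b
          βL≤b = begin
            β k * L        ≤⟨ *-mono (ℚ.≤-trans (0≤ℕ→ℚ 2) (2≤β k (ℕ.m⊔n≤o⇒m≤o K N₁ KN₁≤k))) (0≤ℕ→ℚ p)
                                (ℚ.≤-trans (p≤∣p∣ (β k)) (proj₂ (proj₂ bounded) k (ℕ.m⊔n≤o⇒n≤o K N₁ KN₁≤k))) (logSum≤ p k) ⟩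
            ℕ→ℚ B₀ * ℕ→ℚ p  ≡⟨ ℕ→ℚ-* B₀ p ⟨
            b              ∎
          u≤b : u ≤ b
          u≤b = ℚ.≤-trans (≤-gap (L + L) (ℚ.+-mono-≤ 0≤L 0≤L) (trans (sym (ℚ.+-assoc u L L)) total)) βL≤b
          A≤C : A ≤ ℕ→ℚ C
          A≤C = begin
            A              ≤⟨ expSum-monoˡ 0≤u u≤b k ⟩
            expSum b k     ≤⟨ p≤∣p∣ (expSum b k) ⟩
            abs (expSum b k)  ≤⟨ proj₂ (proj₂ bounded′) k (ℕ.m⊔n≤o⇒m≤o N₂ (N₃ ℕ.⊔ N₄) N₂₃₄≤k) ⟩
            ℕ→ℚ C          ∎
          W≤ : W ≤ X * X * A
          W≤ = subst (λ z → expSum z k ≤ X * X * A) total (square-upper p 0≤u k)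
          ≤W : X * X * A ≤ W + ε
          ≤W = begin
            X * X * A
              ≤⟨ square-lower p 0≤u k (ℚ.<⇒≤ 0<η) (proj₂ (exp-log p η 0<η) k (ℕ.m⊔n≤o⇒n≤o N₃ N₄ N₃₄≤k)) ⟩
            expSum (u + L + L) (k ℕ.+ k ℕ.+ k) + A * (X + X) * η
              ≤⟨ ℚ.+-mono-≤
                   (subst (λ z → expSum z (k ℕ.+ k ℕ.+ k) ≤ W + δ) (sym total)
                     (proj₂ uniform 0≤βL βL≤b k (k ℕ.+ k ℕ.+ k) (ℕ.m⊔n≤o⇒m≤o N₃ N₄ N₃₄≤k) (ℕ.m≤n+m k (k ℕ.+ k))))
                   (ℚ.*-monoʳ-≤-nonNeg η {{ℚ.nonNegative (ℚ.<⇒≤ 0<η)}} (begin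
                     A * (X + X)                ≤⟨ ℚ.*-monoʳ-≤-nonNeg (X + X) {{ℚ.nonNegative (ℚ.+-mono-≤ (0≤ℕ→ℚ (suc p)) (0≤ℕ→ℚ (suc p)))}} A≤C ⟩
                     ℕ→ℚ C * (X + X)            ≡⟨ trans (cong (ℕ→ℚ C *_) (sym (ℕ→ℚ-+ (suc p) (suc p)))) (sym (ℕ→ℚ-* C (suc p ℕ.+ suc p))) ⟩
                     ℕ→ℚ c                      ≤⟨ ℕ→ℚ-mono (ℕ.n≤1+n c) ⟩
                     ℕ→ℚ (suc c)                ∎)) ⟩
            W + δ + ℕ→ℚ (suc c) * η
              ≡⟨ trans (cong (_+_ (W + δ)) (scale c δ)) (trans (ℚ.+-assoc W δ δ) (cong (_+_ W) (halves ε))) ⟩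
            W + ε  ∎

  -- The exponential and the power functions.

  limit-trans : ∀ (u v w : ℕ → ℚ) →
    (∀ ε → 0ℚ < ε → ∃ λ N → ∀ k → N ℕ.≤ k → abs (u k - v k) ≤ ε) →
    (∀ ε → 0ℚ < ε → ∃ λ N → ∀ k → N ℕ.≤ k → abs (v k - w k) ≤ ε) →
    ∀ ε → 0ℚ < ε → ∃ λ N → ∀ k → N ℕ.≤ k → abs (u k - w k) ≤ ε
  limit-trans u v w h g ε 0<ε =
    let (M , hM) = h (ε * 1/suc 1) (0<half 0<ε)
        (N , gN) = g (ε * 1/suc 1) (0<half 0<ε)
    in M ℕ.⊔ N , λ k le → begin
      abs (u k - w k)                      ≤⟨ triangle (u k) (v k) (w k) ⟩
      abs (u k - v k) + abs (v k - w k)    ≤⟨ ℚ.+-mono-≤ (hM k (ℕ.m⊔n≤o⇒m≤o M N le)) (gN k (ℕ.m⊔n≤o⇒n≤o M N le)) ⟩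
      ε * 1/suc 1 + ε * 1/suc 1            ≡⟨ halves ε ⟩
      ε                                    ∎

  eventually-equal : ∀ (u v : ℕ → ℚ) N → (∀ k → N ℕ.≤ k → u k ≡ v k) →
    ∀ ε → 0ℚ < ε → ∃ λ N → ∀ k → N ℕ.≤ k → abs (u k - v k) ≤ ε
  eventually-equal u v N u≡v ε 0<ε = N , λ k N≤k → subst (_≤ ε)
    (sym (trans (cong (λ z → abs (z - v k)) (u≡v k N≤k)) (cong abs (ℚ.+-inverseʳ (v k))))) (ℚ.<⇒≤ 0<ε)

  exponential-maximizes : ∀ f → IsShiftedExponential f → ∀ {m n} (m≤n : m ℕ.≤ n) →
    UniquelyMaximizes f m (QS (suc n) m (s≤s m≤n))
  exponential-maximizes f (rate , (e , 0<e , K , above) , f≈) {m} m≤n =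
    ChordBound.chordal⇒uniquelyMaximizes f F F→f m≤n 0<η
      -- Of the `k` Taylor terms the constant one cancels against -1, leaving `ℕ.pred k`; at least
      -- three must remain to reach the cubic term.
      (K ℕ.⊔ 4 , λ k K≤k → Exponential.chordal (0≤l k (ℕ.m⊔n≤o⇒m≤o K 4 K≤k)) (ℚ.<⇒≤ 0<e) (e≤l k (ℕ.m⊔n≤o⇒m≤o K 4 K≤k))
        m (ℕ.pred k) (ℕ.pred-mono-≤ (ℕ.m⊔n≤o⇒n≤o K 4 K≤k)))
    where
      l = approx rate
      F : ℕ → ℕ → ℚ
      F k = series (shiftedExpTerm (l k)) (ℕ.pred k)
      e≤l : ∀ k → K ℕ.≤ k → e ≤ l k
      e≤l k K≤k = subst (_≤ l k) (ℚ.+-identityˡ e) (above k K≤k)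
      0≤l : ∀ k → K ℕ.≤ k → 0ℚ ≤ l k
      0≤l k K≤k = ℚ.≤-trans (ℚ.<⇒≤ 0<e) (e≤l k K≤k)
      0<η : 0ℚ < (e * 1/suc 1 * e) ⊓ (e * 1/suc 2 * (e * 1/suc 1 * e))
      0<η = 0<⊓ 0<quadratic (*-pos (*-pos 0<e (0<1/suc 2)) 0<quadratic)
        where 0<quadratic = *-pos (*-pos 0<e (0<1/suc 1)) 0<e
      shifted : ∀ x k → 1 ℕ.≤ k → expSum (l k * ℕ→ℚ x) k - 1ℚ ≡ F k x
      shifted x (suc k) _ = trans (cong (_- 1ℚ) (∑-head k (expTerm y)))
        (solve 1 (λ s → con 1ℚ :+ s :- con 1ℚ := s) refl (∑<ℚ k (expTerm y ∘ suc)))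
        where y = l (suc k) * ℕ→ℚ x
      F→f : ∀ x ε → 0ℚ < ε → ∃ λ N → ∀ k → N ℕ.≤ k → abs (approx (f x) k - F k x) ≤ ε
      F→f x = limit-trans (approx (f x)) g (λ k → F k x) (f≈ x) (eventually-equal g (λ k → F k x) 1 (shifted x))
        where
          g : ℕ → ℚ
          g k = expSum (l k * ℕ→ℚ x) k - 1ℚ

  power-maximizes : ∀ f → IsPowerAbove2 f → ∀ {m n} (m≤n : m ℕ.≤ n) →
    UniquelyMaximizes f m (QS (suc n) m (s≤s m≤n))
  power-maximizes f (β , (e , 0<e , K , above) , f≈) {m} m≤n =
    ChordBound.chordal⇒uniquelyMaximizes f F F→f m≤n 0<η
      (K ℕ.⊔ 3 , λ k K≤k → Power.chordal (0≤δ k (ℕ.m⊔n≤o⇒m≤o K 3 K≤k)) k (ℚ.<⇒≤ 0<e) (e≤δ k (ℕ.m⊔n≤o⇒m≤o K 3 K≤k))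
        m k (ℕ.m⊔n≤o⇒n≤o K 3 K≤k))
    where
      δ : ℕ → ℚ
      δ k = approx β k - ℕ→ℚ 2
      F : ℕ → ℕ → ℚ
      F k = series (powerTerm (δ k) k) k
      e≤δ : ∀ k → K ℕ.≤ k → e ≤ δ k
      e≤δ k K≤k = begin
        e                          ≡⟨ solve 2 (λ a e → e := a :+ e :- a) refl (ℕ→ℚ 2) e ⟩
        ℕ→ℚ 2 + e - ℕ→ℚ 2          ≤⟨ ℚ.+-monoˡ-≤ (- ℕ→ℚ 2) (above k K≤k) ⟩
        δ k                        ∎
      0≤δ : ∀ k → K ℕ.≤ k → 0ℚ ≤ δ k
      0≤δ k K≤k = ℚ.≤-trans (ℚ.<⇒≤ 0<e) (e≤δ k K≤k)
      2≤β : ∀ k → K ℕ.≤ k → ℕ→ℚ 2 ≤ approx β k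
      2≤β k K≤k = ℚ.≤-trans (≤-gap e (ℚ.<⇒≤ 0<e) refl) (above k K≤k)
      0<η : 0ℚ < 1ℚ ⊓ (e * 1/suc 1 * (1/suc m * (e * 1/suc m)))
      0<η = 0<⊓ (ℚ.positive⁻¹ 1ℚ) (*-pos (*-pos 0<e (0<1/suc 1)) (*-pos (0<1/suc m) (*-pos 0<e (0<1/suc m))))
      F→f : ∀ x ε → 0ℚ < ε → ∃ λ N → ∀ k → N ℕ.≤ k → abs (approx (f x) k - F k x) ≤ ε
      -- The power of base 0 is 0 by definition, and the series vanishes there through its factor
      -- x².
      F→f zero    = limit-trans (approx (f zero)) (λ _ → 0ℚ) (λ k → F k zero) (f≈ zero)
        (eventually-equal (λ _ → 0ℚ) (λ k → F k zero) 0 λ k _ →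
          sym (trans (∑-*ˡ k (0ℚ * 0ℚ) (expTerm (δ k * logSum 0 k))) (ℚ.*-zeroˡ (expSum (δ k * logSum 0 k) k))))
      F→f (suc p) = limit-trans (approx (f (suc p))) (λ k → expSum (approx β k * logSum p k) k) (λ k → F k (suc p))
        (f≈ (suc p)) (power-limit (cauchy β) (K , 2≤β) p)

corollary8 : (f : ℕ → ℝ) → IsShiftedExponential f ⊎ IsPowerAbove2 f →
    (m n : ℕ) (m<n : m ℕ.< n) → UniquelyMaximizes f m (QS n m m<n)
corollary8 f (inj₁ exponential) m (suc n) (s≤s m≤n) = ExpLog.exponential-maximizes f exponential m≤n
corollary8 f (inj₂ power)       m (suc n) (s≤s m≤n) = ExpLog.power-maximizes f power m≤n
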